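{- Let $\Delta\ge 3$, $c\in[0,\Delta-2]$, $\kappa=\Delta+c$. Against an oblivious adversary, the expected recourse of each update performed by {\textsc{DistMaint}} (in the rooted version and in the general unrooted version) on a fully dynamic forest of maximum degree at most $\Delta$ on $n$ vertices is at most $\frac{\Delta}{\kappa}\cdot\min\left\{\frac{\kappa-1}{c},\ 2+\lceil\log_{\kappa-1}n\rceil\right\}$ if $c\ge1$, and at most $2+\lceil\log_{\Delta-1}n\rceil$ if $c=0$.
   Context: Updates (fixed in advance) are insertions of edges joining two distinct trees and deletions; the forest starts empty; in the rooted version an insertion $(p,r)$ requires $r$ to be a root and makes it a child of $p$, and deleting $(p,r)$ with $p$ the parent of $r$ makes $r$ a root. $A(x)$ = colors of $[\kappa]$ not used at $x$. Recourse of an update = number of previously colored edges whose color changes. {\textsc{DistMaint}}: trees have designated roots (initially each vertex). FixForbidden$(v,\alpha,\beta)$: if no child edge of $v$ has color $\beta$ stop; else recolor that child edge $(v,w)$ to $\alpha$ and call FixForbidden$(w,\beta,\alpha)$. Rooted insertion $(p,r)$: choose $\beta$ uniformly from $A(p)$, color $(p,r)$ by $\beta$; if no child edge of $r$ has color $\beta$ stop; else for that edge $(r,w)$ choose $\alpha$ uniformly from $A(r)$, recolor $(r,w)$ to $\alpha$, call FixForbidden$(w,\beta,\alpha)$. In the unrooted version, an insertion $(u,v)$ first names endpoints so $\deg(v)\le\deg(u)$ if both trees have at most $\Delta$ edges and otherwise so $v$'s tree has at most as many edges, reroots $v$'s tree at $v$, then does the rooted insertion $(u,v)$. Deletion of $(p,r)$,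 $p$ the parent of $r$ in the current rooting, color $\alpha$: delete; with $\ell$ the number of children of $r$, with probability $(\kappa-\ell)/\kappa$ stop; else pick a uniformly random child $w$, $\beta=\mathrm{color}(r,w)$, recolor $(r,w)$ to $\alpha$, call FixForbidden$(w,\beta,\alpha)$. Random choices independent. -}

module Defs where

open import Data.Nat as ℕ using (ℕ; zero; suc; _+_; _∸_; _^_; _≤ᵇ_)
open import Data.Integer using (+_)
open import Data.Rational as ℚ using (ℚ; 0ℚ; 1ℚ; _/_; _⊓_)
open import Data.Fin as Fin using (Fin; toℕ)
open import Data.Bool using (Bool; true; false; if_then_else_; not; _∧_)
open import Data.Maybe as Maybe using (Maybe; just; nothing)
open import Data.Product using (_×_; _,_; proj₁; proj₂; Σ)
open import Data.Sum using (_⊎_)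
open import Data.Unit using (⊤)
open import Data.List as List using (List; []; _∷_; _++_; map; filterᵇ; length; concatMap; foldr; allFin)
open import Data.Bool.ListAction using (any)
open import Data.List.Membership.Propositional using (_∈_)
open import Relation.Nullary using (¬_)
open import Relation.Nullary.Decidable using (⌊_⌋)
open import Relation.Binary.PropositionalEquality using (_≡_)

Dist : Set → Set
Dist A = List (ℚ × A)

return : {A : Set} → A → Dist A
return a = (1ℚ , a) ∷ []

scale : {A : Set} → ℚ → Dist A → Dist A
scale p = map (λ qa → (p ℚ.* proj₁ qa , proj₂ qa))

bind : {A B : Set} → Dist A → (A → Dist B) → Dist B
bind d f = concatMap (λ pa → scale (proj₁ pa) (f (proj₂ pa))) d

-- uniform distribution on a list (empty list: empty distribution; never
-- used on an empty list for valid update sequences)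
uniform : {A : Set} → List A → Dist A
uniform [] = []
uniform (x ∷ xs) = map (λ a → ((+ 1) / suc (List.length xs) , a)) (x ∷ xs)

choice : {A : Set} → ℚ → Dist A → Dist A → Dist A
choice p d₁ d₂ = scale p d₁ ++ scale (1ℚ ℚ.- p) d₂

E : {A : Set} → Dist A → (A → ℚ) → ℚ
E d f = foldr (λ pa acc → proj₁ pa ℚ.* f (proj₂ pa) ℚ.+ acc) 0ℚ d

-- a / b as a rational (b = 0 gives 0; irrelevant here)
frac : ℕ → ℕ → ℚ
frac a zero = 0ℚ
frac a (suc b) = (+ a) / suc b

fromℕ : ℕ → ℚ
fromℕ a = (+ a) / 1

-- Rooted edge-coloured forests on vertex set Fin n with colours Fin κ.
-- s v = just (p , col) : p is the parent of v and edge (p,v) has colour col;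
-- s v = nothing       : v is a root.

State : ℕ → ℕ → Set
State n κ = Fin n → Maybe (Fin n × Fin κ)

emptyForest : {n κ : ℕ} → State n κ
emptyForest _ = nothing

_==_ : {m : ℕ} → Fin m → Fin m → Bool
x == y = ⌊ x Fin.≟ y ⌋

_==ᶜ_ : {m : ℕ} → Fin m → Fin m → Bool
x ==ᶜ y = ⌊ x Fin.≟ y ⌋

module _ {n κ : ℕ} where

  set : State n κ → Fin n → Maybe (Fin n × Fin κ) → State n κ
  set s v x w = if w == v then x else s w

  parentOf : State n κ → Fin n → Maybe (Fin n)
  parentOf s v = Maybe.map proj₁ (s v)

  isChildOf : State n κ → Fin n → Fin n → Bool
  isChildOf s v w with s w
  ... | nothing = false
  ... | just (p , _) = p == v

  children : State n κ → Fin n → List (Fin n)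
  children s v = filterᵇ (isChildOf s v) (allFin n)

  childWithColor : State n κ → Fin n → Fin κ → Maybe (Fin n)
  childWithColor s v β = List.head (filterᵇ ok (allFin n))
    where
    ok : Fin n → Bool
    ok w with s w
    ... | nothing = false
    ... | just (p , col) = (p == v) ∧ (col ==ᶜ β)

  edgeColor : State n κ → Fin n → Maybe (Fin κ)
  edgeColor s w = Maybe.map proj₂ (s w)

  usedAt : State n κ → Fin n → List (Fin κ)
  usedAt s x = Maybe.maybe (λ pc → proj₂ pc ∷ []) [] (s x)
               ++ concatMap (λ w → Maybe.maybe (λ pc → proj₂ pc ∷ []) [] (s w)) (children s x)

  deg : State n κ → Fin n → ℕ
  deg s x = length (usedAt s x)

  avail : State n κ → Fin n → List (Fin κ)
  avail s x = filterᵇ (λ col → not (any (λ d → d ==ᶜ col) (usedAt s x))) (allFin κ)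

  rootOf′ : ℕ → State n κ → Fin n → Fin n
  rootOf′ zero s v = v
  rootOf′ (suc f) s v with s v
  ... | nothing = v
  ... | just (p , _) = rootOf′ f s p

  rootOf : State n κ → Fin n → Fin n
  rootOf = rootOf′ n

  -- number of edges of the tree containing v (= number of non-roots in it)
  treeEdges : State n κ → Fin n → ℕ
  treeEdges s v = length (filterᵇ ok (allFin n))
    where
    ok : Fin n → Bool
    ok w with s w
    ... | nothing = false
    ... | just _ = rootOf s w == rootOf s v

  reroot′ : ℕ → State n κ → Fin n → Maybe (Fin n × Fin κ) → State n κ
  reroot′ zero s x new = set s x new
  reroot′ (suc f) s x new with s x
  ... | nothing = set s x new
  ... | just (y , col) = reroot′ f (set s x new) y (just (x , col))

  reroot : State n κ → Fin n → State n κ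
  reroot s v = reroot′ n s v nothing

  -- FixForbidden(v, α, β) (with fuel n; depth of a forest is < n)
  fixForbidden′ : ℕ → State n κ → Fin n → Fin κ → Fin κ → State n κ
  fixForbidden′ zero s _ _ _ = s
  fixForbidden′ (suc f) s v α β with childWithColor s v β
  ... | nothing = s
  ... | just w = fixForbidden′ f (set s w (just (v , α))) w β α

  fixForbidden : State n κ → Fin n → Fin κ → Fin κ → State n κ
  fixForbidden = fixForbidden′ n

  rootedInsert : State n κ → Fin n → Fin n → Dist (State n κ)
  rootedInsert s p r = bind (uniform (avail s p)) λ β → step β (set s r (just (p , β)))
    where
    step : Fin κ → State n κ → Dist (State n κ)
    step β s₁ with childWithColor s₁ r β
    ... | nothing = return s₁
    ... | just w = bind (uniform (avail s₁ r)) λ α →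
                     return (fixForbidden (set s₁ w (just (r , α))) w β α)

  deletion : State n κ → Fin n → Fin n → Dist (State n κ)
  deletion s p r with s r
  ... | nothing = return s
  ... | just (_ , α) =
        choice (frac (κ ∸ length (children s₁ r)) κ)
               (return s₁)
               (bind (uniform (children s₁ r)) λ w → recol w (s₁ w))
    where
    s₁ : State n κ
    s₁ = set s r nothing
    recol : Fin n → Maybe (Fin n × Fin κ) → Dist (State n κ)
    recol w nothing = return s₁
    recol w (just (_ , β)) = return (fixForbidden (set s₁ w (just (r , α))) w β α)

data Upd (n : ℕ) : Set where
  ins : Fin n → Fin n → Upd n
  del : Fin n → Fin n → Upd n

module _ {n κ : ℕ} (Δ : ℕ) where

  -- rooted version: ins p r / del p r with p the (new / current) parent of r
  rootedStep : State n κ → Upd n → Dist (State n κ)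
  rootedStep s (ins p r) = rootedInsert s p r
  rootedStep s (del p r) = deletion s p r

  RootedValid : State n κ → Upd n → Set
  RootedValid s (ins p r) =
    (s r ≡ nothing) × (¬ (rootOf s p ≡ r)) × (deg s p ℕ.< Δ) × (deg s r ℕ.< Δ)
  RootedValid s (del p r) = Σ (Fin κ) λ α → s r ≡ just (p , α)

  unrootedStep : State n κ → Upd n → Dist (State n κ)
  unrootedStep s (ins a b) =
    if vIsB then rootedInsert (reroot s b) a b else rootedInsert (reroot s a) b a
    where
    small : Bool
    small = (treeEdges s a ≤ᵇ Δ) ∧ (treeEdges s b ≤ᵇ Δ)
    vIsB : Bool
    vIsB = if small then deg s b ≤ᵇ deg s a else treeEdges s b ≤ᵇ treeEdges s a
  unrootedStep s (del a b) =
    if isChildOf s a b then deletion s a b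
    else (if isChildOf s b a then deletion s b a else return s)

  UnrootedValid : State n κ → Upd n → Set
  UnrootedValid s (ins a b) =
    (¬ (rootOf s a ≡ rootOf s b)) × (deg s a ℕ.< Δ) × (deg s b ℕ.< Δ)
  UnrootedValid s (del a b) = (parentOf s b ≡ just a) ⊎ (parentOf s a ≡ just b)

-- Validity of a (fixed, oblivious) update sequence and expected recourse

module _ {n κ : ℕ} (step : State n κ → Upd n → Dist (State n κ))
                   (valid : State n κ → Upd n → Set) where

  ValidSeq : State n κ → List (Upd n) → Set
  ValidSeq s [] = ⊤
  ValidSeq s (u ∷ us) =
    valid s u × (∀ {p : ℚ} {s′ : State n κ} → (p , s′) ∈ step s u → ValidSeq s′ us)

  colorOf : State n κ → Fin n → Fin n → Maybe (Fin κ)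
  colorOf s x y with s x | s y
  ... | just (p , col) | _ = if p == y then just col else other
    where
    other : Maybe (Fin κ)
    other with s y
    ... | just (q , d) = if q == x then just d else nothing
    ... | nothing = nothing
  ... | nothing | just (q , d) = if q == x then just d else nothing
  ... | nothing | nothing = nothing

  changed : Maybe (Fin κ) → Maybe (Fin κ) → Bool
  changed (just a) (just b) = not (a ==ᶜ b)
  changed _ _ = false

  recourse : State n κ → State n κ → ℕ
  recourse s s′ = length (filterᵇ (λ xy → (toℕ (proj₁ xy) ℕ.<ᵇ toℕ (proj₂ xy))
                                        ∧ changed (colorOf s (proj₁ xy) (proj₂ xy))
                                                  (colorOf s′ (proj₁ xy) (proj₂ xy)))
                                  (List.cartesianProduct (allFin n) (allFin n)))

  -- expected recourse of update number t (0-based) of the sequence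
  expRecourse : State n κ → List (Upd n) → ℕ → ℚ
  expRecourse s [] t = 0ℚ
  expRecourse s (u ∷ us) zero = E (step s u) (λ s′ → fromℕ (recourse s s′))
  expRecourse s (u ∷ us) (suc t) = E (step s u) (λ s′ → expRecourse s′ us t)

-- ⌈log_b n⌉ : least k with n ≤ b^k (searched up to k = n, enough for b ≥ 2)

ceilLog : ℕ → ℕ → ℕ
ceilLog b n = go n 0
  where
  go : ℕ → ℕ → ℕ
  go zero k = k
  go (suc f) k = if n ≤ᵇ b ^ k then k else go f (suc k)

-- the bound of the theorem; κ = Δ + c (written suc c + Δ in the denominator)
bound : ℕ → ℕ → ℕ → ℚ
bound Δ zero n = fromℕ (2 + ceilLog (Δ ∸ 1) n)
bound Δ (suc c) n =
  ((+ Δ) / (suc c + Δ)) ℚ.*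
  (((+ (Δ + suc c ∸ 1)) / suc c) ⊓ fromℕ (2 + ceilLog (Δ + suc c ∸ 1) n))

{-# OPTIONS --safe #-}
module Submission where

open import Defs
open import Algebra.Properties.Group using (∙-cancelˡ)
open import Data.Bool using (Bool; true; false; if_then_else_; not; _∧_; _∨_; T; T?)
import Data.Bool.Properties as Boolₚ
open import Data.Bool.ListAction using (any)
open import Data.Empty using (⊥)
open import Data.Fin as Fin using (Fin; zero; suc; toℕ)
import Data.Fin.Properties as Finₚ
open import Data.Integer as ℤ using (+_)
import Data.Integer.Properties as ℤₚ
open import Data.List as List using (List; []; _∷_; _++_; map; filterᵇ; length; concatMap; allFin)
import Data.List.Properties as Listₚ
open import Data.List.Membership.Propositional using (_∈_; find; lose)
import Data.List.Membership.Propositional.Properties as ∈ₚ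
open import Data.List.Relation.Binary.Pointwise as PW using (Pointwise; []; _∷_)
open import Data.List.Relation.Unary.Any using (here; there)
open import Data.Maybe as Maybe using (Maybe; just; nothing)
import Data.Maybe.Properties as Maybeₚ
open import Data.Nat as ℕ using (ℕ; zero; suc; _+_; _∸_; _≤_; _<_; _≤ᵇ_)
import Data.Nat.Properties as ℕₚ
open import Data.Product using (∃-syntax; _×_; _,_; proj₁; proj₂)
open import Data.Product.Properties using () renaming (≡-dec to ×-≡-dec)
import Data.Rational
open import Data.Rational as ℚ using (ℚ; 0ℚ; 1ℚ) renaming (_+_ to _⊕_; _*_ to _⊛_; _≤_ to _≼_)
import Data.Rational.Properties as ℚₚ
import Data.Rational.Unnormalised as ℚᵘ
import Data.Rational.Unnormalised.Properties as ℚᵘₚ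
open import Data.Sum as Sum using (_⊎_; inj₁; inj₂; [_,_])
open import Data.Unit using (⊤; tt)
open import Data.Vec as Vec using (Vec; []; _∷_; lookup; tabulate; _[_]≔_)
import Data.Vec.Properties as Vecₚ
open import Function using (_∘_; id; Equivalence)
open import Relation.Binary using (DecidableEquality; tri<; tri≈; tri>)
open import Relation.Binary.PropositionalEquality using (_≡_; _≢_; _≗_; refl; sym; trans; cong; cong₂; subst; ≢-sym; module ≡-Reasoning)
open import Relation.Nullary using (¬_; Dec; yes; no; does; contradiction)
open import Relation.Nullary.Decidable using (dec-true; dec-false; dec⇒maybe; isYes≗does; map′; _×-dec_; _⊎-dec_; _→-dec_; ¬?)
open import Tactic.RingSolver using (solve-∀)
open import Tactic.RingSolver.Core.AlmostCommutativeRing using (AlmostCommutativeRing; fromCommutativeRing)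

-- Idea. After every update the colouring is uniformly distributed over the proper colourings
-- of the current forest. Compare the forest with and without the edge (p, r). For a child w
-- of r, exchanging two colours along the Kempe chain descending through (r, w) is a bijection
-- between the pairs (colouring without (p, r) in which (r, w) clashes with the colour chosen
-- for (p, r), colour free at r) and the colourings with (p, r); counting shows that insertion
-- and deletion both map uniform to uniform, and that both have expected recourse 1/κ times the
-- sum over the children w of r of the expected length of the chain through (r, w). In a uniform
-- colouring such a chain continues into a given child edge with probability 1/(κ − 1). Hence
-- its expected length A satisfies (κ − 1) A ≤ (κ − 1) + (Δ − 1) A, which gives the bound
-- (κ − 1)/c; moreover each level contributes at most 1 and a vertex i levels down at most
-- (κ − 1)^(−i), which gives the logarithmic bound. Rerooting only renames the edges (each is
-- named by its lower endpoint), so it preserves uniformity and colours.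

-- Since the updates are fixed in advance, the shape of the forest at any time is determined and
-- only the colouring is random. Hence a state is split into a shape and a vector of colours, and
-- every quantity is an average over the proper vectors of one shape. Let aₚ and aᵣ be the numbers
-- of free colours at p and r in the absence of (p, r), and ℓ = κ - aᵣ the number of children of r.
-- An insertion reaches a colouring x either without a clash, with weight 1/aₚ, or, for each child
-- w, from exactly one clashing pair, with weight 1/(aₚ aᵣ): the total (1/aₚ)(1 + ℓ/aᵣ) does not
-- depend on x. For a deletion, let y still record the removed colour at r. A y without clash is
-- reached only from itself, with weight aᵣ/κ; a clashing y is reached from aᵣ colourings, one for
-- each colour free at r, with weight 1/κ each. The stopping probability (κ - ℓ)/κ = aᵣ/κ is the one
-- that balances the two cases. Later updates are known to be valid only in reachable states, so
-- each step must also exhibit one outcome.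

ℚ-ring : AlmostCommutativeRing _ _
ℚ-ring = fromCommutativeRing ℚₚ.+-*-commutativeRing (λ q → dec⇒maybe (0ℚ ℚₚ.≟ q))

⊛-swap : ∀ a b c → a ⊛ (b ⊛ c) ≡ b ⊛ (a ⊛ c)
⊛-swap = solve-∀ ℚ-ring

-- Finite sums and indicators

sumL : {A : Set} → List A → (A → ℚ) → ℚ
sumL [] f = 0ℚ
sumL (x ∷ xs) f = f x ⊕ sumL xs f

𝟙ᵇ : Bool → ℚ
𝟙ᵇ true = 1ℚ
𝟙ᵇ false = 0ℚ

𝟙 : {P : Set} → Dec P → ℚ
𝟙 d = 𝟙ᵇ (does d)

private variable
  A : Set
  B : Set
  Φ : Set
  Ψ : Set

sumL-cong : (xs : List A) {f g : A → ℚ} → (∀ a → f a ≡ g a) → sumL xs f ≡ sumL xs g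
sumL-cong [] e = refl
sumL-cong (x ∷ xs) e = cong₂ _⊕_ (e x) (sumL-cong xs e)

sumL-mono : (xs : List A) {f g : A → ℚ} → (∀ a → f a ≼ g a) → sumL xs f ≼ sumL xs g
sumL-mono [] e = ℚₚ.≤-refl
sumL-mono (x ∷ xs) e = ℚₚ.+-mono-≤ (e x) (sumL-mono xs e)

sumL-zero : (xs : List A) → sumL xs (λ _ → 0ℚ) ≡ 0ℚ
sumL-zero [] = refl
sumL-zero (x ∷ xs) = trans (ℚₚ.+-identityˡ _) (sumL-zero xs)

sumL-⊕ : (xs : List A) (f g : A → ℚ) → sumL xs (λ a → f a ⊕ g a) ≡ sumL xs f ⊕ sumL xs g
sumL-⊕ [] f g = refl
sumL-⊕ (x ∷ xs) f g = trans (cong (f x ⊕ g x ⊕_) (sumL-⊕ xs f g)) (lem (f x) (g x) _ _)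
  where
  lem : ∀ a b c d → (a ⊕ b) ⊕ (c ⊕ d) ≡ (a ⊕ c) ⊕ (b ⊕ d)
  lem = solve-∀ ℚ-ring

sumL-⊛ : (xs : List A) (c : ℚ) (f : A → ℚ) → sumL xs (λ a → c ⊛ f a) ≡ c ⊛ sumL xs f
sumL-⊛ [] c f = sym (ℚₚ.*-zeroʳ c)
sumL-⊛ (x ∷ xs) c f = trans (cong (c ⊛ f x ⊕_) (sumL-⊛ xs c f)) (sym (ℚₚ.*-distribˡ-+ c (f x) _))

sumL-swap : (xs : List A) (ys : List B) (f : A → B → ℚ) →
  sumL xs (λ a → sumL ys (f a)) ≡ sumL ys (λ b → sumL xs (λ a → f a b))
sumL-swap [] ys f = sym (sumL-zero ys)
sumL-swap (x ∷ xs) ys f =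
  trans (cong (sumL ys (f x) ⊕_) (sumL-swap xs ys f)) (sym (sumL-⊕ ys (f x) _))

sumL-++ : (xs ys : List A) (f : A → ℚ) → sumL (xs ++ ys) f ≡ sumL xs f ⊕ sumL ys f
sumL-++ [] ys f = sym (ℚₚ.+-identityˡ _)
sumL-++ (x ∷ xs) ys f = trans (cong (f x ⊕_) (sumL-++ xs ys f)) (sym (ℚₚ.+-assoc (f x) _ _))

sumL-map : (g : A → B) (xs : List A) (f : B → ℚ) → sumL (map g xs) f ≡ sumL xs (f ∘ g)
sumL-map g [] f = refl
sumL-map g (x ∷ xs) f = cong (f (g x) ⊕_) (sumL-map g xs f)

sumL-concatMap : (g : A → List B) (xs : List A) (f : B → ℚ) →
  sumL (concatMap g xs) f ≡ sumL xs (λ a → sumL (g a) f)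
sumL-concatMap g [] f = refl
sumL-concatMap g (x ∷ xs) f =
  trans (sumL-++ (g x) (concatMap g xs) f) (cong (sumL (g x) f ⊕_) (sumL-concatMap g xs f))

sumL-filterᵇ : (p : A → Bool) (xs : List A) (f : A → ℚ) →
  sumL (filterᵇ p xs) f ≡ sumL xs (λ a → 𝟙ᵇ (p a) ⊛ f a)
sumL-filterᵇ p [] f = refl
sumL-filterᵇ p (x ∷ xs) f with p x
... | true = cong₂ _⊕_ (sym (ℚₚ.*-identityˡ (f x))) (sumL-filterᵇ p xs f)
... | false = trans (sumL-filterᵇ p xs f)
  (sym (trans (cong (_⊕ sumL xs (λ a → 𝟙ᵇ (p a) ⊛ f a)) (ℚₚ.*-zeroˡ (f x))) (ℚₚ.+-identityˡ _)))

𝟙-yes : (d : Dec Φ) → Φ → 𝟙 d ≡ 1ℚ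
𝟙-yes d p = cong 𝟙ᵇ (dec-true d p)

𝟙-no : (d : Dec Φ) → ¬ Φ → 𝟙 d ≡ 0ℚ
𝟙-no d p = cong 𝟙ᵇ (dec-false d p)

-- The form in which summands are rewritten throughout: a factor behind an indicator has to be
-- understood only where the indicator is 1.
𝟙-guard : (d : Dec Φ) (e : Dec Ψ) (a b : ℚ) → (Φ → Ψ) → (Ψ → Φ) → (Φ → a ≡ b) → 𝟙 d ⊛ a ≡ 𝟙 e ⊛ b
𝟙-guard (yes p) e a b f g h = cong₂ _⊛_ (sym (𝟙-yes e (f p))) (h p)
𝟙-guard (no ¬p) e a b f g h =
  trans (ℚₚ.*-zeroˡ a) (sym (trans (cong (_⊛ b) (𝟙-no e (¬p ∘ g))) (ℚₚ.*-zeroˡ b)))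

𝟙-cong : (d : Dec Φ) (e : Dec Ψ) → (Φ → Ψ) → (Ψ → Φ) → 𝟙 d ≡ 𝟙 e
𝟙-cong d e f g =
  trans (sym (ℚₚ.*-identityʳ _)) (trans (𝟙-guard d e 1ℚ 1ℚ f g (λ _ → refl)) (ℚₚ.*-identityʳ _))

𝟙-× : (d : Dec Φ) (e : Dec Ψ) → 𝟙 (d ×-dec e) ≡ 𝟙 d ⊛ 𝟙 e
𝟙-× (yes p) (yes q) = refl
𝟙-× (yes p) (no q) = refl
𝟙-× (no p) (yes q) = refl
𝟙-× (no p) (no q) = refl

0≤1 : 0ℚ ≼ 1ℚ
0≤1 = ℚₚ.nonNegative⁻¹ 1ℚ

𝟙-nonneg : (d : Dec Φ) → 0ℚ ≼ 𝟙 d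
𝟙-nonneg (yes _) = 0≤1
𝟙-nonneg (no _) = ℚₚ.≤-refl

𝟙-≤1 : (d : Dec Φ) → 𝟙 d ≼ 1ℚ
𝟙-≤1 (yes _) = ℚₚ.≤-refl
𝟙-≤1 (no _) = 0≤1

𝟙-mono : (d : Dec Φ) (e : Dec Ψ) → (Φ → Ψ) → 𝟙 d ≼ 𝟙 e
𝟙-mono (yes p) e f = ℚₚ.≤-reflexive (sym (𝟙-yes e (f p)))
𝟙-mono (no p) e f = 𝟙-nonneg e

*-mono-≼ˡ : {a b c : ℚ} → 0ℚ ≼ c → a ≼ b → c ⊛ a ≼ c ⊛ b
*-mono-≼ˡ {c = c} 0≤c a≤b = ℚₚ.*-monoˡ-≤-nonNeg c {{ℚ.nonNegative 0≤c}} a≤b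

*-mono-≼ʳ : {a b c : ℚ} → 0ℚ ≼ c → a ≼ b → a ⊛ c ≼ b ⊛ c
*-mono-≼ʳ {c = c} 0≤c a≤b = ℚₚ.*-monoʳ-≤-nonNeg c {{ℚ.nonNegative 0≤c}} a≤b

*-nonneg : {a b : ℚ} → 0ℚ ≼ a → 0ℚ ≼ b → 0ℚ ≼ a ⊛ b
*-nonneg {a} 0≤a 0≤b = ℚₚ.≤-trans (ℚₚ.≤-reflexive (sym (ℚₚ.*-zeroʳ a))) (*-mono-≼ˡ 0≤a 0≤b)

sumL-nonneg : (xs : List A) {f : A → ℚ} → (∀ a → 0ℚ ≼ f a) → 0ℚ ≼ sumL xs f
sumL-nonneg xs h = ℚₚ.≤-trans (ℚₚ.≤-reflexive (sym (sumL-zero xs))) (sumL-mono xs h)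

𝟙-guard-≼ : (d : Dec Φ) (a b : ℚ) → (Φ → a ≼ b) → 𝟙 d ⊛ a ≼ 𝟙 d ⊛ b
𝟙-guard-≼ (yes p) a b h = *-mono-≼ˡ 0≤1 (h p)
𝟙-guard-≼ (no _) a b h = ℚₚ.≤-reflexive (trans (ℚₚ.*-zeroˡ a) (sym (ℚₚ.*-zeroˡ b)))

-- Naturals and fractions inside ℚ

fromℕ-homo-+ : ∀ a b → fromℕ (a + b) ≡ fromℕ a ⊕ fromℕ b
fromℕ-homo-+ a b = ℚₚ.toℚᵘ-injective (begin
  ℚ.toℚᵘ (fromℕ (a + b))                    ≈⟨ ℚₚ.toℚᵘ-fromℚᵘ (ℚᵘ.mkℚᵘ (+ (a + b)) 0) ⟩
  ℚᵘ.mkℚᵘ (+ (a + b)) 0                     ≈⟨ ℚᵘ.*≡* (cong (ℤ._* + 1) (cong₂ ℤ._+_ (sym (ℤₚ.*-identityʳ (+ a))) (sym (ℤₚ.*-identityʳ (+ b))))) ⟩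
  ℚᵘ.mkℚᵘ (+ a) 0 ℚᵘ.+ ℚᵘ.mkℚᵘ (+ b) 0      ≈⟨ ℚᵘₚ.+-cong (ℚₚ.toℚᵘ-fromℚᵘ (ℚᵘ.mkℚᵘ (+ a) 0)) (ℚₚ.toℚᵘ-fromℚᵘ (ℚᵘ.mkℚᵘ (+ b) 0)) ⟨
  ℚ.toℚᵘ (fromℕ a) ℚᵘ.+ ℚ.toℚᵘ (fromℕ b)    ≈⟨ ℚₚ.toℚᵘ-homo-+ (fromℕ a) (fromℕ b) ⟨
  ℚ.toℚᵘ (fromℕ a ⊕ fromℕ b)                ∎)
  where open ℚᵘₚ.≃-Reasoning

/-fromℕ : ∀ a b → (+ a ℚ./ suc b) ⊛ fromℕ (suc b) ≡ fromℕ a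
/-fromℕ a b = ℚₚ.toℚᵘ-injective (begin
  ℚ.toℚᵘ ((+ a ℚ./ suc b) ⊛ fromℕ (suc b))   ≈⟨ ℚₚ.toℚᵘ-homo-* (+ a ℚ./ suc b) (fromℕ (suc b)) ⟩
  ℚ.toℚᵘ (+ a ℚ./ suc b) ℚᵘ.* ℚ.toℚᵘ (fromℕ (suc b)) ≈⟨ ℚᵘₚ.*-cong (ℚₚ.toℚᵘ-fromℚᵘ (ℚᵘ.mkℚᵘ (+ a) b)) (ℚₚ.toℚᵘ-fromℚᵘ (ℚᵘ.mkℚᵘ (+ suc b) 0)) ⟩
  ℚᵘ.mkℚᵘ (+ a) b ℚᵘ.* ℚᵘ.mkℚᵘ (+ suc b) 0   ≈⟨ ℚᵘ.*≡* (trans (ℤₚ.*-identityʳ _) (cong (+ a ℤ.*_) (cong +_ (sym (ℕₚ.*-identityʳ (suc b)))))) ⟩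
  ℚᵘ.mkℚᵘ (+ a) 0                            ≈⟨ ℚₚ.toℚᵘ-fromℚᵘ (ℚᵘ.mkℚᵘ (+ a) 0) ⟨
  ℚ.toℚᵘ (fromℕ a)                           ∎)
  where open ℚᵘₚ.≃-Reasoning

0≤fromℕ : ∀ a → 0ℚ ≼ fromℕ a
0≤fromℕ a = ℚₚ.nonNegative⁻¹ (fromℕ a) {{ℚₚ.normalize-nonNeg a 1}}

fromℕ-suc : ∀ a → fromℕ (suc a) ≡ 1ℚ ⊕ fromℕ a
fromℕ-suc a = fromℕ-homo-+ 1 a

fromℕ-mono : ∀ {a b} → a ≤ b → fromℕ a ≼ fromℕ b
fromℕ-mono {a} {b} a≤b = begin
  fromℕ a                   ≡⟨ ℚₚ.+-identityʳ _ ⟨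
  fromℕ a ⊕ 0ℚ              ≤⟨ ℚₚ.+-monoʳ-≤ (fromℕ a) (0≤fromℕ (b ∸ a)) ⟩
  fromℕ a ⊕ fromℕ (b ∸ a)   ≡⟨ fromℕ-homo-+ a (b ∸ a) ⟨
  fromℕ (a + (b ∸ a))       ≡⟨ cong fromℕ (ℕₚ.m+[n∸m]≡n a≤b) ⟩
  fromℕ b                   ∎
  where open ℚₚ.≤-Reasoning

fromℕ-pos : ∀ {a} → 0 < a → ℚ.Positive (fromℕ a)
fromℕ-pos {suc a} _ = ℚₚ.normalize-pos (suc a) 1

fromℕ-homo-* : ∀ a b → fromℕ (a ℕ.* b) ≡ fromℕ a ⊛ fromℕ b
fromℕ-homo-* zero b = sym (ℚₚ.*-zeroˡ (fromℕ b))
fromℕ-homo-* (suc a) b = begin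
  fromℕ (b + a ℕ.* b)            ≡⟨ fromℕ-homo-+ b (a ℕ.* b) ⟩
  fromℕ b ⊕ fromℕ (a ℕ.* b)      ≡⟨ cong (fromℕ b ⊕_) (fromℕ-homo-* a b) ⟩
  fromℕ b ⊕ fromℕ a ⊛ fromℕ b    ≡⟨ lem (fromℕ a) (fromℕ b) ⟩
  (1ℚ ⊕ fromℕ a) ⊛ fromℕ b       ≡⟨ cong (_⊛ fromℕ b) (fromℕ-suc a) ⟨
  fromℕ (suc a) ⊛ fromℕ b        ∎
  where
  open ≡-Reasoning
  lem : ∀ x y → y ⊕ x ⊛ y ≡ (1ℚ ⊕ x) ⊛ y
  lem = solve-∀ ℚ-ring

sumL-const : (xs : List A) (c : ℚ) → sumL xs (λ _ → c) ≡ fromℕ (length xs) ⊛ c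
sumL-const [] c = sym (ℚₚ.*-zeroˡ c)
sumL-const (x ∷ xs) c = begin
  c ⊕ sumL xs (λ _ → c)              ≡⟨ cong (c ⊕_) (sumL-const xs c) ⟩
  c ⊕ fromℕ (length xs) ⊛ c          ≡⟨ lem (fromℕ (length xs)) c ⟩
  (1ℚ ⊕ fromℕ (length xs)) ⊛ c       ≡⟨ cong (_⊛ c) (fromℕ-suc (length xs)) ⟨
  fromℕ (suc (length xs)) ⊛ c        ∎
  where
  open ≡-Reasoning
  lem : ∀ x y → y ⊕ x ⊛ y ≡ (1ℚ ⊕ x) ⊛ y
  lem = solve-∀ ℚ-ring

length-sumL : (xs : List A) → fromℕ (length xs) ≡ sumL xs (λ _ → 1ℚ)
length-sumL xs = sym (trans (sumL-const xs 1ℚ) (ℚₚ.*-identityʳ _))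

-- Finite types

-- Completeness of the enumeration and absence of repetitions are stated together as a sum of
-- indicators. This is directly the evaluation rule `∑-δ`, and it passes to products and vectors by
-- calculation.
record Finite (A : Set) : Set where
  field
    enum : List A
    eq? : DecidableEquality A
    enum-once : ∀ b → sumL enum (λ a → 𝟙 (eq? a b)) ≡ 1ℚ

  ∑ : (A → ℚ) → ℚ
  ∑ = sumL enum

  ∑-δ : ∀ b (f : A → ℚ) → ∑ (λ a → 𝟙 (eq? a b) ⊛ f a) ≡ f b
  ∑-δ b f = begin
    ∑ (λ a → 𝟙 (eq? a b) ⊛ f a)   ≡⟨ sumL-cong enum (λ a → trans (𝟙-guard (eq? a b) (eq? a b) (f a) (f b) id id (cong f)) (ℚₚ.*-comm _ (f b))) ⟩
    ∑ (λ a → f b ⊛ 𝟙 (eq? a b))   ≡⟨ sumL-⊛ enum (f b) _ ⟩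
    f b ⊛ ∑ (λ a → 𝟙 (eq? a b))   ≡⟨ cong (f b ⊛_) (enum-once b) ⟩
    f b ⊛ 1ℚ                      ≡⟨ ℚₚ.*-identityʳ (f b) ⟩
    f b                           ∎
    where open ≡-Reasoning

open Finite

-- Double counting of the pairs (a, b) with b = φ a: insert the indicator of b = φ a, exchange the
-- sums, and recognise the indicator of a = ψ b. No list is ever permuted.
reindex : (FA : Finite A) (FB : Finite B) {P : A → Set} {Q : B → Set}
  (P? : ∀ a → Dec (P a)) (Q? : ∀ b → Dec (Q b)) (φ : A → B) (ψ : B → A) →
  (∀ a → P a → Q (φ a) × ψ (φ a) ≡ a) → (∀ b → Q b → P (ψ b) × φ (ψ b) ≡ b) →
  (f : A → ℚ) → ∑ FA (λ a → 𝟙 (P? a) ⊛ f a) ≡ ∑ FB (λ b → 𝟙 (Q? b) ⊛ f (ψ b))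
reindex FA FB {P} {Q} P? Q? φ ψ fwd bwd f = begin
  ∑ FA (λ a → 𝟙 (P? a) ⊛ f a)
    ≡⟨ sumL-cong (enum FA) (λ a → sym (∑-δ FB (φ a) _)) ⟩
  ∑ FA (λ a → ∑ FB (λ b → 𝟙 (eq? FB b (φ a)) ⊛ (𝟙 (P? a) ⊛ f a)))
    ≡⟨ sumL-swap (enum FA) (enum FB) _ ⟩
  ∑ FB (λ b → ∑ FA (λ a → 𝟙 (eq? FB b (φ a)) ⊛ (𝟙 (P? a) ⊛ f a)))
    ≡⟨ sumL-cong (enum FB) (λ b → sumL-cong (enum FA) (point b)) ⟩
  ∑ FB (λ b → ∑ FA (λ a → 𝟙 (eq? FA a (ψ b)) ⊛ (𝟙 (Q? b) ⊛ f (ψ b))))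
    ≡⟨ sumL-cong (enum FB) (λ b → ∑-δ FA (ψ b) _) ⟩
  ∑ FB (λ b → 𝟙 (Q? b) ⊛ f (ψ b)) ∎
  where
  open ≡-Reasoning
  assoc₂ : ∀ {P₁ P₂ : Set} (d : Dec P₁) (e : Dec P₂) x → 𝟙 d ⊛ (𝟙 e ⊛ x) ≡ 𝟙 (d ×-dec e) ⊛ x
  assoc₂ d e x = trans (sym (ℚₚ.*-assoc (𝟙 d) (𝟙 e) x)) (cong (_⊛ x) (sym (𝟙-× d e)))
  point : ∀ b a → 𝟙 (eq? FB b (φ a)) ⊛ (𝟙 (P? a) ⊛ f a) ≡ 𝟙 (eq? FA a (ψ b)) ⊛ (𝟙 (Q? b) ⊛ f (ψ b))
  point b a = trans (assoc₂ (eq? FB b (φ a)) (P? a) (f a))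
    (trans (𝟙-guard (eq? FB b (φ a) ×-dec P? a) (eq? FA a (ψ b) ×-dec Q? b) (f a) (f (ψ b))
             (λ { (refl , pa) → sym (proj₂ (fwd a pa)) , proj₁ (fwd a pa) })
             (λ { (refl , qb) → sym (proj₂ (bwd b qb)) , proj₁ (bwd b qb) })
             (λ { (refl , pa) → cong f (sym (proj₂ (fwd a pa))) }))
           (sym (assoc₂ (eq? FA a (ψ b)) (Q? b) (f (ψ b)))))

allFin-suc : ∀ n → allFin (suc n) ≡ zero ∷ map suc (allFin n)
allFin-suc n = cong (zero ∷_) (sym (Listₚ.map-tabulate id suc))

finFinite : ∀ n → Finite (Fin n)
finFinite n = record { enum = allFin n ; eq? = Fin._≟_ ; enum-once = once n }
  where
  once : ∀ n (b : Fin n) → sumL (allFin n) (λ a → 𝟙 (a Fin.≟ b)) ≡ 1ℚ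
  once (suc n) zero = trans (cong (λ l → sumL l (λ a → 𝟙 (a Fin.≟ zero))) (allFin-suc n))
    (trans (cong (1ℚ ⊕_) (trans (sumL-map suc (allFin n) (λ a → 𝟙 (a Fin.≟ zero))) (sumL-zero (allFin n)))) (ℚₚ.+-identityʳ 1ℚ))
  once (suc n) (suc b) = trans (cong (λ l → sumL l (λ a → 𝟙 (a Fin.≟ suc b))) (allFin-suc n))
    (trans (ℚₚ.+-identityˡ _) (trans (sumL-map suc (allFin n) _)
      (trans (sumL-cong (allFin n) (λ a → 𝟙-cong (suc a Fin.≟ suc b) (a Fin.≟ b) (λ { refl → refl }) (cong suc))) (once n b))))

_×-finite_ : Finite A → Finite B → Finite (A × B)
_×-finite_ {A} {B} FA FB = record
  { enum = concatMap (λ a → map (a ,_) (enum FB)) (enum FA)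
  ; eq? = pair?
  ; enum-once = λ { (a₀ , b₀) → trans (fubini (λ ab → 𝟙 (pair? ab (a₀ , b₀))))
      (trans (sumL-cong (enum FA) (λ a → trans (sumL-cong (enum FB) (λ b →
          trans (𝟙-cong (pair? (a , b) (a₀ , b₀)) (eq? FA a a₀ ×-dec eq? FB b b₀) (λ { refl → refl , refl }) (λ { (refl , refl) → refl }))
                (𝟙-× (eq? FA a a₀) (eq? FB b b₀))))
        (trans (sumL-⊛ (enum FB) (𝟙 (eq? FA a a₀)) _) (cong (𝟙 (eq? FA a a₀) ⊛_) (enum-once FB b₀)))))
      (∑-δ FA a₀ (λ _ → 1ℚ))) } }
  where
  pair? : DecidableEquality (A × B)
  pair? = ×-≡-dec (eq? FA) (eq? FB)
  fubini : ∀ f → sumL (concatMap (λ a → map (a ,_) (enum FB)) (enum FA)) f ≡ ∑ FA (λ a → ∑ FB (λ b → f (a , b)))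
  fubini f = trans (sumL-concatMap _ (enum FA) f) (sumL-cong (enum FA) (λ a → sumL-map (a ,_) (enum FB) f))

∑-× : (FA : Finite A) (FB : Finite B) (f : A × B → ℚ) →
  ∑ (FA ×-finite FB) f ≡ ∑ FA (λ a → ∑ FB (λ b → f (a , b)))
∑-× FA FB f = trans (sumL-concatMap _ (enum FA) f) (sumL-cong (enum FA) (λ a → sumL-map (a ,_) (enum FB) f))

vecFinite : ∀ κ n → Finite (Vec (Fin κ) n)
vecFinite κ n = record { enum = vecs n ; eq? = Vecₚ.≡-dec Fin._≟_ ; enum-once = once n }
  where
  vecs : ∀ n → List (Vec (Fin κ) n)
  vecs zero = [] ∷ []
  vecs (suc n) = concatMap (λ c → map (c ∷_) (vecs n)) (allFin κ)
  once : ∀ n b → sumL (vecs n) (λ a → 𝟙 (Vecₚ.≡-dec Fin._≟_ a b)) ≡ 1ℚ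
  once zero [] = refl
  once (suc n) (c₀ ∷ v₀) = trans (sumL-concatMap _ (allFin κ) _)
    (trans (sumL-cong (allFin κ) (λ c → trans (sumL-map (c ∷_) (vecs n) _)
      (trans (sumL-cong (vecs n) (λ v →
          trans (𝟙-cong (Vecₚ.≡-dec Fin._≟_ (c ∷ v) (c₀ ∷ v₀)) ((c Fin.≟ c₀) ×-dec Vecₚ.≡-dec Fin._≟_ v v₀) (λ { refl → refl , refl }) (λ { (refl , refl) → refl }))
                (𝟙-× (c Fin.≟ c₀) (Vecₚ.≡-dec Fin._≟_ v v₀))))
        (trans (sumL-⊛ (vecs n) (𝟙 (c Fin.≟ c₀)) _) (cong (𝟙 (c Fin.≟ c₀) ⊛_) (once n v₀))))))
      (∑-δ (finFinite κ) c₀ (λ _ → 1ℚ)))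

just-injective : {A : Set} {x y : A} → just x ≡ just y → x ≡ y
just-injective = Maybeₚ.just-injective

just≢nothing : {A : Set} {x : A} {m : Maybe A} → m ≡ just x → m ≡ nothing → ⊥
just≢nothing refl ()

vec-ext : ∀ {A : Set} {n} {x y : Vec A n} → (∀ i → lookup x i ≡ lookup y i) → x ≡ y
vec-ext {x = x} {y} e =
  trans (sym (Vecₚ.tabulate∘lookup x)) (trans (Vecₚ.tabulate-cong e) (Vecₚ.tabulate∘lookup y))

-- Rooted forests, given by their parent maps

Str : ℕ → Set
Str n = Fin n → Maybe (Fin n)

-- Any rank that decreases towards the root is accepted as a witness, because linking and turning
-- edges produce new ranks by simple shifts. The canonical rank is `depth`.
record Acyclic {n} (S : Str n) : Set where
  field
    rank : Fin n → ℕ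
    rank-< : ∀ {z q} → S z ≡ just q → rank q < rank z

module _ {n : ℕ} {S : Str n} (a : Acyclic S) where
  open Acyclic a

  parent-ind : (P : Fin n → Set) → (∀ z → (∀ q → S z ≡ just q → P q) → P z) → ∀ z → P z
  parent-ind P h z = go (suc (rank z)) z ℕₚ.≤-refl
    where
    go : ∀ f z → rank z < f → P z
    go (suc f) z (ℕ.s≤s l) = h z (λ q e → go f q (ℕₚ.<-≤-trans (rank-< e) l))

  private
    depth′ : ℕ → Fin n → ℕ
    depth′ zero z = 0
    depth′ (suc f) z = Maybe.maybe (suc ∘ depth′ f) 0 (S z)

    depth′-stable : ∀ f g z → rank z ≤ f → rank z ≤ g → depth′ f z ≡ depth′ g z
    depth′-stable zero zero z _ _ = refl
    depth′-stable zero (suc g) z l m with S z in e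
    ... | nothing = refl
    ... | just q = contradiction (ℕₚ.<-≤-trans (rank-< e) l) λ ()
    depth′-stable (suc f) zero z l m with S z in e
    ... | nothing = refl
    ... | just q = contradiction (ℕₚ.<-≤-trans (rank-< e) m) λ ()
    depth′-stable (suc f) (suc g) z l m with S z in e
    ... | nothing = refl
    ... | just q = cong suc (depth′-stable f g q (ℕₚ.≤-pred (ℕₚ.<-≤-trans (rank-< e) l)) (ℕₚ.≤-pred (ℕₚ.<-≤-trans (rank-< e) m)))

  depth : Fin n → ℕ
  depth z = depth′ (rank z) z

  depth-root : ∀ {z} → S z ≡ nothing → depth z ≡ 0
  depth-root {z} e = trans (depth′-stable (rank z) (suc (rank z)) z ℕₚ.≤-refl (ℕₚ.n≤1+n _)) (cong (Maybe.maybe _ 0) e)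

  depth-child : ∀ {z q} → S z ≡ just q → depth z ≡ suc (depth q)
  depth-child {z} {q} e =
    trans (depth′-stable (rank z) (suc (rank z)) z ℕₚ.≤-refl (ℕₚ.n≤1+n _))
      (trans (cong (Maybe.maybe _ 0) e) (cong suc (depth′-stable (rank z) (rank q) q (ℕₚ.<⇒≤ (rank-< e)) ℕₚ.≤-refl)))

  depth-< : ∀ {z q} → S z ≡ just q → depth q < depth z
  depth-< e = ℕₚ.≤-reflexive (sym (depth-child e))

  private
    ancestor : ∀ z j → j ≤ depth z → ∃[ v ] depth v ≡ j
    ancestor = parent-ind (λ z → ∀ j → j ≤ depth z → ∃[ v ] depth v ≡ j) step
      where
      step : ∀ z → (∀ q → S z ≡ just q → ∀ j → j ≤ depth q → ∃[ v ] depth v ≡ j) →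
             ∀ j → j ≤ depth z → ∃[ v ] depth v ≡ j
      step z ih j l with ℕₚ.m≤n⇒m<n∨m≡n l
      ... | inj₂ e = z , sym e
      ... | inj₁ j<d with S z in e
      ...   | nothing = contradiction (subst (j <_) (depth-root e) j<d) λ ()
      ...   | just q = ih q refl j (ℕₚ.≤-pred (subst (j <_) (depth-child e) j<d))

  -- Every depth up to that of z is attained by an ancestor of z, so a depth of n or more would give
  -- n + 1 vertices of distinct depths. This is what makes the fuel n of the algorithm's recursions
  -- sufficient.
  depth<n : ∀ z → depth z < n
  depth<n z = ℕₚ.≰⇒> λ n≤d →
    let f = λ (i : Fin (suc n)) → ancestor z (Fin.toℕ i) (ℕₚ.≤-trans (ℕₚ.≤-pred (Finₚ.toℕ<n i)) n≤d)
        (i , j , i<j , fi≡fj) = Finₚ.pigeonhole (ℕₚ.n<1+n n) (proj₁ ∘ f)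
    in ℕₚ.<⇒≢ i<j (trans (sym (proj₂ (f i))) (trans (cong depth fi≡fj) (proj₂ (f j))))

-- The vertices that can be reached by descending from v along edges whose names satisfy `ok`; the
-- edge above v is included without a test. With two colours as `ok` this is a Kempe chain entered
-- through the edge above v, with the trivial predicate it is the subtree of v.
data Reach {n} (S : Str n) (ok : Fin n → Set) (v : Fin n) : Fin n → Set where
  here : Reach S ok v v
  there : ∀ {z q} → S z ≡ just q → ok z → Reach S ok v q → Reach S ok v z

module _ {n : ℕ} {S : Str n} where

  Reach-map : {ok ok′ : Fin n → Set} {v : Fin n} → (∀ z → ok z → ok′ z) → ∀ {z} → Reach S ok v z → Reach S ok′ v z
  Reach-map f here = here
  Reach-map f (there e o c) = there e (f _ o) (Reach-map f c)

  Reach-parent : {ok : Fin n → Set} {v z q : Fin n} → z ≢ v → S z ≡ just q → Reach S ok v z → ok z × Reach S ok v q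
  Reach-parent z≢v e here = contradiction refl z≢v
  Reach-parent z≢v e (there e′ o c) with trans (sym e) e′
  ... | refl = o , c

  Reach-root : {ok : Fin n → Set} {v z : Fin n} → S z ≡ nothing → Reach S ok v z → z ≡ v
  Reach-root e here = refl
  Reach-root e (there e′ _ _) with () ← just≢nothing e′ e

module _ {n : ℕ} {S : Str n} (a : Acyclic S) where

  Reach-depth : {ok : Fin n → Set} {v z : Fin n} → Reach S ok v z → depth a v ≤ depth a z
  Reach-depth here = ℕₚ.≤-refl
  Reach-depth (there e _ c) = ℕₚ.≤-trans (Reach-depth c) (ℕₚ.<⇒≤ (depth-< a e))

  ¬Reach-above : {ok : Fin n → Set} {v z : Fin n} → depth a z < depth a v → ¬ Reach S ok v z
  ¬Reach-above l c = ℕₚ.<⇒≱ l (Reach-depth c)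

  abstract
    reach? : {ok : Fin n → Set} → (∀ z → Dec (ok z)) → ∀ v z → Dec (Reach S ok v z)
    reach? {ok} ok? v = parent-ind a (λ z → Dec (Reach S ok v z)) step
      where
      step : ∀ z → (∀ q → S z ≡ just q → Dec (Reach S ok v q)) → Dec (Reach S ok v z)
      step z ih with z Fin.≟ v
      ... | yes refl = yes here
      ... | no z≢v with S z in e
      ...   | nothing = no λ c → z≢v (Reach-root e c)
      ...   | just q = map′ (λ (o , c) → there e o c) (Reach-parent z≢v e) (ok? z ×-dec ih q refl)

Inc : ∀ {n} → Str n → Fin n → Fin n → Set
Inc S z u = ∃[ q ] (S z ≡ just q × (z ≡ u ⊎ q ≡ u))

abstract
  inc? : ∀ {n} (S : Str n) z u → Dec (Inc S z u)
  inc? S z u with S z in e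
  ... | nothing = no λ { (_ , () , _) }
  ... | just q = map′ (λ d → q , refl , d) (λ { (_ , refl , d) → d }) ((z Fin.≟ u) ⊎-dec (q Fin.≟ u))

module _ {n κ : ℕ} where

  -- `Inc` requires a parent, so the coordinates of roots are unconstrained: each proper colouring
  -- of the edges is represented by κ vectors for every root, in product. The numbers of proper
  -- vectors used below include this multiplicity.
  Proper : Str n → Vec (Fin κ) n → Set
  Proper S x = ∀ u z z′ → z ≢ z′ → Inc S z u → Inc S z′ u → lookup x z ≢ lookup x z′

  abstract
    proper? : ∀ S x → Dec (Proper S x)
    proper? S x = Finₚ.all? λ u → Finₚ.all? λ z → Finₚ.all? λ z′ →
      ¬? (z Fin.≟ z′) →-dec inc? S z u →-dec inc? S z′ u →-dec ¬? (lookup x z Fin.≟ lookup x z′)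

  Free : Str n → Vec (Fin κ) n → Fin n → Fin κ → Set
  Free S x u γ = ∀ z → Inc S z u → lookup x z ≢ γ

  abstract
    free? : ∀ S x u γ → Dec (Free S x u γ)
    free? S x u γ = Finₚ.all? λ z → inc? S z u →-dec ¬? (lookup x z Fin.≟ γ)

-- Transpositions of colours and Kempe changes

module _ {κ : ℕ} where

  tr : Fin κ → Fin κ → Fin κ → Fin κ
  tr α β γ with γ Fin.≟ α | γ Fin.≟ β
  ... | yes _ | _ = β
  ... | no _ | yes _ = α
  ... | no _ | no _ = γ

  tr-left : ∀ α β → tr α β α ≡ β
  tr-left α β with α Fin.≟ α | α Fin.≟ β
  ... | yes _ | _ = refl
  ... | no α≢α | _ = contradiction refl α≢α

  tr-right : ∀ α β → tr α β β ≡ α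
  tr-right α β with β Fin.≟ α | β Fin.≟ β
  ... | yes β≡α | _ = β≡α
  ... | no _ | yes _ = refl
  ... | no _ | no β≢β = contradiction refl β≢β

  tr-other : ∀ {α β γ} → γ ≢ α → γ ≢ β → tr α β γ ≡ γ
  tr-other {α} {β} {γ} γ≢α γ≢β with γ Fin.≟ α | γ Fin.≟ β
  ... | yes e | _ = contradiction e γ≢α
  ... | no _ | yes e = contradiction e γ≢β
  ... | no _ | no _ = refl

  tr-sym : ∀ α β γ → tr α β γ ≡ tr β α γ
  tr-sym α β γ with γ Fin.≟ α | γ Fin.≟ β
  ... | yes refl | yes refl = refl
  ... | yes _ | no _ = refl
  ... | no _ | yes _ = refl
  ... | no _ | no _ = refl

  tr-involutive : ∀ α β γ → tr α β (tr α β γ) ≡ γ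
  tr-involutive α β γ with γ Fin.≟ α | γ Fin.≟ β
  ... | yes refl | _ = tr-right γ β
  ... | no _ | yes refl = tr-left α γ
  ... | no γ≢α | no γ≢β = tr-other γ≢α γ≢β

  tr-injective : ∀ α β {γ δ} → tr α β γ ≡ tr α β δ → γ ≡ δ
  tr-injective α β {γ} {δ} e = trans (sym (tr-involutive α β γ)) (trans (cong (tr α β) e) (tr-involutive α β δ))

  OneOf : Fin κ → Fin κ → Fin κ → Set
  OneOf α β γ = γ ≡ α ⊎ γ ≡ β

  oneOf? : ∀ α β γ → Dec (OneOf α β γ)
  oneOf? α β γ = (γ Fin.≟ α) ⊎-dec (γ Fin.≟ β)

  tr-fix : ∀ {α β γ} → ¬ OneOf α β γ → tr α β γ ≡ γ
  tr-fix h = tr-other (h ∘ inj₁) (h ∘ inj₂)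

  tr-oneOf : ∀ {α β γ} → OneOf α β γ → OneOf α β (tr α β γ)
  tr-oneOf {α} {β} (inj₁ refl) = inj₂ (tr-left α β)
  tr-oneOf {α} {β} (inj₂ refl) = inj₁ (tr-right α β)

  tr-oneOf⁻ : ∀ {α β γ} → OneOf α β (tr α β γ) → OneOf α β γ
  tr-oneOf⁻ {α} {β} {γ} h = subst (OneOf α β) (tr-involutive α β γ) (tr-oneOf h)

module _ {n κ : ℕ} where

  flip : {M : Fin n → Set} → (∀ z → Dec (M z)) → Fin κ → Fin κ → Vec (Fin κ) n → Vec (Fin κ) n
  flip M? α β x = tabulate (λ z → if does (M? z) then tr α β (lookup x z) else lookup x z)

  module _ {M : Fin n → Set} (M? : ∀ z → Dec (M z)) (α β : Fin κ) (x : Vec (Fin κ) n) where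

    flip-in : ∀ {z} → M z → lookup (flip M? α β x) z ≡ tr α β (lookup x z)
    flip-in {z} m = trans (Vecₚ.lookup∘tabulate _ z) (cong (if_then _ else _) (dec-true (M? z) m))

    flip-out : ∀ {z} → ¬ M z → lookup (flip M? α β x) z ≡ lookup x z
    flip-out {z} m = trans (Vecₚ.lookup∘tabulate _ z) (cong (if_then _ else _) (dec-false (M? z) m))

  flip-involutive : {M M′ : Fin n → Set} (M? : ∀ z → Dec (M z)) (M′? : ∀ z → Dec (M′ z)) →
    (∀ z → M z → M′ z) → (∀ z → M′ z → M z) → ∀ α β x → flip M′? α β (flip M? α β x) ≡ x
  flip-involutive M? M′? f g α β x = vec-ext λ z → case z (M? z)
    where
    case : ∀ z → Dec _ → lookup (flip M′? α β (flip M? α β x)) z ≡ lookup x z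
    case z (yes m) = trans (flip-in M′? α β (flip M? α β x) (f z m)) (trans (cong (tr α β) (flip-in M? α β x m)) (tr-involutive α β (lookup x z)))
    case z (no m) = trans (flip-out M′? α β (flip M? α β x) (m ∘ g z)) (flip-out M? α β x m)

  flip-cong : {M M′ : Fin n → Set} (M? : ∀ z → Dec (M z)) (M′? : ∀ z → Dec (M′ z)) →
    (∀ z → M z → M′ z) → (∀ z → M′ z → M z) → ∀ α β x → flip M? α β x ≡ flip M′? α β x
  flip-cong M? M′? f g α β x = vec-ext λ z → case z (M? z)
    where
    case : ∀ z → Dec _ → lookup (flip M? α β x) z ≡ lookup (flip M′? α β x) z
    case z (yes m) = trans (flip-in M? α β x m) (sym (flip-in M′? α β x (f z m)))
    case z (no m) = trans (flip-out M? α β x m) (sym (flip-out M′? α β x (m ∘ g z)))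

  flip-sym : {M : Fin n → Set} (M? : ∀ z → Dec (M z)) → ∀ α β x → flip M? α β x ≡ flip M? β α x
  flip-sym M? α β x = vec-ext λ z → case z (M? z)
    where
    case : ∀ z → Dec _ → lookup (flip M? α β x) z ≡ lookup (flip M? β α x) z
    case z (yes m) = trans (flip-in M? α β x m) (trans (tr-sym α β (lookup x z)) (sym (flip-in M? β α x m)))
    case z (no m) = trans (flip-out M? α β x m) (sym (flip-out M? β α x m))

module _ {n κ : ℕ} {S : Str n} (a : Acyclic S) (w : Fin n) (α β : Fin κ) where

  Chain : Vec (Fin κ) n → Fin n → Set
  Chain x = Reach S (λ z → OneOf α β (lookup x z)) w

  chain? : ∀ x z → Dec (Chain x z)
  chain? x = reach? a (λ z → oneOf? α β (lookup x z)) w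

  kempe : Vec (Fin κ) n → Vec (Fin κ) n
  kempe x = flip (chain? x) α β x

  module _ (x : Vec (Fin κ) n) where

    kempe-in : ∀ {z} → Chain x z → lookup (kempe x) z ≡ tr α β (lookup x z)
    kempe-in = flip-in (chain? x) α β x

    kempe-out : ∀ {z} → ¬ Chain x z → lookup (kempe x) z ≡ lookup x z
    kempe-out = flip-out (chain? x) α β x

    kempe-oneOf : ∀ z → OneOf α β (lookup x z) → OneOf α β (lookup (kempe x) z)
    kempe-oneOf z o with chain? x z
    ... | yes c = subst (OneOf α β) (sym (kempe-in c)) (tr-oneOf o)
    ... | no ¬c = subst (OneOf α β) (sym (kempe-out ¬c)) o

    kempe-oneOf⁻ : ∀ z → OneOf α β (lookup (kempe x) z) → OneOf α β (lookup x z)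
    kempe-oneOf⁻ z o with chain? x z
    ... | yes c = tr-oneOf⁻ (subst (OneOf α β) (kempe-in c) o)
    ... | no ¬c = subst (OneOf α β) (kempe-out ¬c) o

    kempe-chain : ∀ z → Chain x z → Chain (kempe x) z
    kempe-chain z = Reach-map kempe-oneOf

    kempe-chain⁻ : ∀ z → Chain (kempe x) z → Chain x z
    kempe-chain⁻ z = Reach-map kempe-oneOf⁻

    -- Exchanging α and β does not affect which edges have one of these two colours, so the chain of
    -- the changed colouring is the same set of edges.
    kempe-involutive : kempe (kempe x) ≡ x
    kempe-involutive = flip-involutive (chain? x) (chain? (kempe x)) kempe-chain kempe-chain⁻ α β x

    -- At a vertex of the chain every incident edge coloured α or β lies on the chain.
    kempe-distinct : ∀ {u z z′} → Chain x u → Inc S z u → Inc S z′ u →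
      lookup x z ≢ lookup x z′ → lookup (kempe x) z ≢ lookup (kempe x) z′
    kempe-distinct {u} {z} {z′} cu iz iz′ ne e = ne (tr-injective α β (trans (sym (as-tr iz)) (trans e (as-tr iz′))))
      where
      as-tr : ∀ {z} → Inc S z u → lookup (kempe x) z ≡ tr α β (lookup x z)
      as-tr {z} i with chain? x z
      as-tr {z} i | yes c = kempe-in c
      as-tr {z} (q , e , inj₁ refl) | no ¬c = contradiction cu ¬c
      as-tr {z} (q , e , inj₂ refl) | no ¬c =
        trans (kempe-out ¬c) (sym (tr-fix (λ o → ¬c (there e o cu))))

    -- A chain edge other than the topmost one has both endpoints on the chain. So at a vertex off
    -- the chain, the edge named `w` is the only one that can change.
    kempe-unchanged : ∀ {u z} → ¬ Chain x u → Inc S z u → z ≢ w → lookup (kempe x) z ≡ lookup x z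
    kempe-unchanged ¬cu (q , e , inj₁ refl) z≢w = kempe-out ¬cu
    kempe-unchanged ¬cu (q , e , inj₂ refl) z≢w = kempe-out (λ c → ¬cu (proj₂ (Reach-parent z≢w e c)))

kempe-sym : ∀ {n κ} {S : Str n} (a : Acyclic S) w (α β : Fin κ) x → kempe a w α β x ≡ kempe a w β α x
kempe-sym a w α β x = trans
  (flip-cong (chain? a w α β x) (chain? a w β α x) (λ z → Reach-map (λ _ → Sum.swap)) (λ z → Reach-map (λ _ → Sum.swap)) α β x)
  (flip-sym (chain? a w β α x) α β x)

-- Linking a root r below p

record Link {n} (S⁻ S⁺ : Str n) (p r : Fin n) : Set where
  field
    root⁻ : S⁻ r ≡ nothing
    edge⁺ : S⁺ r ≡ just p
    same : ∀ {z} → z ≢ r → S⁻ z ≡ S⁺ z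
    acyclic⁺ : Acyclic S⁺

  acyclic⁻ : Acyclic S⁻
  acyclic⁻ = record { rank = rank ; rank-< = λ {z} {q} e → rank-< (trans (sym (same (λ { refl → just≢nothing e root⁻ }))) e) }
    where open Acyclic acyclic⁺

  lift : ∀ {z q} → S⁻ z ≡ just q → S⁺ z ≡ just q
  lift {z} e with z Fin.≟ r
  ... | yes refl with () ← just≢nothing e root⁻
  ... | no z≢r = trans (sym (same z≢r)) e

  lower : ∀ {z q} → z ≢ r → S⁺ z ≡ just q → S⁻ z ≡ just q
  lower z≢r e = trans (same z≢r) e

  lift-Inc : ∀ {z u} → Inc S⁻ z u → Inc S⁺ z u
  lift-Inc (q , e , d) = q , lift e , d

  lower-Inc : ∀ {z u} → z ≢ r → Inc S⁺ z u → Inc S⁻ z u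
  lower-Inc z≢r (q , e , d) = q , lower z≢r e , d

  Inc⁻≢r : ∀ {z u} → Inc S⁻ z u → z ≢ r
  Inc⁻≢r (q , e , _) refl = just≢nothing e root⁻

  p≢r : p ≢ r
  p≢r refl = ℕₚ.<-irrefl refl (Acyclic.rank-< acyclic⁺ edge⁺)

  module _ {κ : ℕ} where

    -- A proper colouring of the forest without (p, r) whose dummy coordinate y_r is a
    -- legal colour for (p, r) as far as p is concerned.
    Half : Vec (Fin κ) n → Set
    Half y = Proper S⁻ y × Free S⁻ y p (lookup y r)

    half? : ∀ y → Dec (Half y)
    half? y = proper? S⁻ y ×-dec free? S⁻ y p (lookup y r)

    private
      half-at-r : ∀ {y z u} → Free S⁻ y p (lookup y r) → (∀ z → S⁻ z ≡ just r → lookup y z ≢ lookup y r) →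
        z ≢ r → Inc S⁺ z u → Inc S⁺ r u → lookup y z ≢ lookup y r
      half-at-r fr h z≢r (q , e , inj₁ refl) (_ , _ , inj₁ refl) = contradiction refl z≢r
      half-at-r fr h z≢r (q , e , inj₂ refl) (_ , _ , inj₁ refl) = h _ (lower z≢r e)
      half-at-r fr h z≢r i (_ , e , inj₂ refl) with refl ← just-injective (trans (sym edge⁺) e) = fr _ (lower-Inc z≢r i)

    -- The new edge meets the edges at p, where its colour is free by `Half`, and the child edges of
    -- r. A clash is therefore always with a child of r, which is the only place where the algorithm
    -- looks for one.
    half-proper : ∀ {y} → Half y → (∀ z → S⁻ z ≡ just r → lookup y z ≢ lookup y r) → Proper S⁺ y
    half-proper {y} (pr , fr) h u z z′ z≢z′ i i′ with z Fin.≟ r | z′ Fin.≟ r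
    ... | no z≢r | no z′≢r = pr u z z′ z≢z′ (lower-Inc z≢r i) (lower-Inc z′≢r i′)
    ... | yes refl | yes refl = contradiction refl z≢z′
    ... | no z≢r | yes refl = half-at-r {y} fr h z≢r i i′
    ... | yes refl | no z≢r = ≢-sym (half-at-r {y} fr h z≢r i′ i)

    proper-half : ∀ {y} → Proper S⁺ y → Half y
    proper-half pr = (λ u z z′ ne i i′ → pr u z z′ ne (lift-Inc i) (lift-Inc i′)) ,
      λ z i → pr p z r (Inc⁻≢r i) (lift-Inc i) (p , edge⁺ , inj₂ refl)

    module Switch {w : Fin n} (wr : S⁻ w ≡ just r) where

      private
        w≢r : w ≢ r
        w≢r refl = just≢nothing wr root⁻
        d-w : depth acyclic⁺ r < depth acyclic⁺ w
        d-w = depth-< acyclic⁺ (lift wr)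
        d-r : depth acyclic⁺ p < depth acyclic⁺ r
        d-r = depth-< acyclic⁺ edge⁺

      ¬chain-r : {ok : Fin n → Set} → ¬ Reach S⁺ ok w r
      ¬chain-r = ¬Reach-above acyclic⁺ d-w

      ¬chain-p : {ok : Fin n → Set} → ¬ Reach S⁺ ok w p
      ¬chain-p = ¬Reach-above acyclic⁺ (ℕₚ.<-trans d-r d-w)

      Reach-lower : {ok : Fin n → Set} → ∀ {z} → Reach S⁺ ok w z → Reach S⁻ ok w z
      Reach-lower here = here
      Reach-lower (there e o c) = there (lower (λ { refl → ¬chain-r (there e o c) }) e) o (Reach-lower c)

      Reach-lift : {ok : Fin n → Set} → ∀ {z} → Reach S⁻ ok w z → Reach S⁺ ok w z
      Reach-lift here = here
      Reach-lift (there e o c) = there (lift e) o (Reach-lift c)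

      -- The situation in which the algorithm recolours (r, w) to α, or, read backwards, the
      -- outcome of a deletion that recoloured (r, w) from α: resolve is a bijection from these
      -- pairs to the proper colourings of the forest with (p, r).
      Clash : Vec (Fin κ) n × Fin κ → Set
      Clash (y , α) = Half y × lookup y w ≡ lookup y r × Free S⁺ y r α

      clash? : ∀ yα → Dec (Clash yα)
      clash? (y , α) = half? y ×-dec (lookup y w Fin.≟ lookup y r) ×-dec free? S⁺ y r α

      resolve : Vec (Fin κ) n × Fin κ → Vec (Fin κ) n
      resolve (y , α) = kempe acyclic⁺ w α (lookup y r) y

      -- The repair leaves (p, r) untouched and gives (r, w) the colour α. Both exchanged colours,
      -- and with them the exchange itself, can therefore be read off from its result.
      unresolve : Vec (Fin κ) n → Vec (Fin κ) n × Fin κ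
      unresolve x = kempe acyclic⁺ w (lookup x w) (lookup x r) x , lookup x w

      private
        at-r : ∀ {y α β u} → ¬ Chain acyclic⁺ w α β y u → Inc S⁺ w u → u ≡ r
        at-r ¬c (q , e , inj₁ refl) = contradiction here ¬c
        at-r ¬c (q , e , inj₂ refl) = just-injective (trans (sym e) (lift wr))

      resolve-at-r : ∀ y α → lookup (resolve (y , α)) r ≡ lookup y r
      resolve-at-r y α = kempe-out acyclic⁺ w α (lookup y r) y ¬chain-r

      resolve-at-w : ∀ y α → lookup y w ≡ lookup y r → lookup (resolve (y , α)) w ≡ α
      resolve-at-w y α e = trans (kempe-in acyclic⁺ w α (lookup y r) y here) (trans (cong (tr α (lookup y r)) e) (tr-right α (lookup y r)))

      unresolve-resolve : ∀ y α → lookup y w ≡ lookup y r → unresolve (resolve (y , α)) ≡ (y , α)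
      unresolve-resolve y α e rewrite resolve-at-r y α | resolve-at-w y α e =
        cong (_, α) (kempe-involutive acyclic⁺ w α (lookup y r) y)

      private
        un-r : ∀ x → lookup (proj₁ (unresolve x)) r ≡ lookup x r
        un-r x = kempe-out acyclic⁺ w (lookup x w) (lookup x r) x ¬chain-r

        un-w : ∀ x → lookup (proj₁ (unresolve x)) w ≡ lookup x r
        un-w x = trans (kempe-in acyclic⁺ w (lookup x w) (lookup x r) x here) (tr-left (lookup x w) (lookup x r))

      resolve-unresolve : ∀ x → resolve (unresolve x) ≡ x
      resolve-unresolve x rewrite un-r x = kempe-involutive acyclic⁺ w (lookup x w) (lookup x r) x

      private
        resolve-at-w-distinct : ∀ y α {u z} → lookup y w ≡ lookup y r → Free S⁺ y r α →
          ¬ Chain acyclic⁺ w α (lookup y r) y u → z ≢ w → Inc S⁺ w u → Inc S⁺ z u →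
          lookup (resolve (y , α)) z ≢ lookup (resolve (y , α)) w
        resolve-at-w-distinct y α {u} {z} yw≡yr frα ¬c z≢w i i′ e with refl ← at-r {y} {α} {lookup y r} ¬c i =
          frα z i′ (trans (sym (kempe-unchanged acyclic⁺ w α (lookup y r) y ¬c i′ z≢w)) (trans e (resolve-at-w y α yw≡yr)))

      -- The chain lies strictly below r, so at its vertices only edges of `S⁻` meet and the
      -- exchange keeps them distinct. Off the chain only w can have changed, which matters at r
      -- alone, and there α is free. Among unchanged edges, (p, r) conflicts with nothing: at p by
      -- `Free`, and at r because w had its colour in the proper colouring y, so no other child edge
      -- has it.
      resolve-proper : ∀ yα → Clash yα → Proper S⁺ (resolve yα)
      resolve-proper (y , α) ((pr , fr) , yw≡yr , frα) u z z′ z≢z′ i i′ with chain? acyclic⁺ w α (lookup y r) y u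
      ... | yes c = kempe-distinct acyclic⁺ w α (lookup y r) y c i i′ (pr u z z′ z≢z′ (lower-Inc (z≢r i) i) (lower-Inc (z≢r i′) i′))
        where
        z≢r : ∀ {z} → Inc S⁺ z u → z ≢ r
        z≢r (_ , e , inj₁ refl) refl = ¬chain-r c
        z≢r (_ , e , inj₂ refl) refl with refl ← just-injective (trans (sym e) edge⁺) = ¬chain-p c
      ... | no ¬c with z Fin.≟ w | z′ Fin.≟ w
      ...   | yes refl | yes refl = contradiction refl z≢z′
      ...   | yes refl | no z′≢w = ≢-sym (resolve-at-w-distinct y α yw≡yr frα ¬c z′≢w i i′)
      ...   | no z≢w | yes refl = resolve-at-w-distinct y α yw≡yr frα ¬c z≢w i′ i
      ...   | no z≢w | no z′≢w = λ e → off-w (trans (sym (unch i z≢w)) (trans e (unch i′ z′≢w)))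
        where
        unch : ∀ {z} → Inc S⁺ z u → z ≢ w → lookup (resolve (y , α)) z ≡ lookup y z
        unch = kempe-unchanged acyclic⁺ w α (lookup y r) y ¬c
        r-case : ∀ {z} → z ≢ w → z ≢ r → Inc S⁺ r u → Inc S⁺ z u → lookup y z ≢ lookup y r
        r-case z≢w z≢r (_ , e , inj₁ refl) i′ e′ =
          pr r _ w z≢w (lower-Inc z≢r i′) (r , wr , inj₂ refl) (trans e′ (sym yw≡yr))
        r-case z≢w z≢r (_ , e , inj₂ refl) i′ with refl ← just-injective (trans (sym e) edge⁺) = fr _ (lower-Inc z≢r i′)
        off-w : lookup y z ≢ lookup y z′
        off-w with z Fin.≟ r | z′ Fin.≟ r
        ... | no z≢r | no z′≢r = pr u z z′ z≢z′ (lower-Inc z≢r i) (lower-Inc z′≢r i′)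
        ... | yes refl | yes refl = contradiction refl z≢z′
        ... | yes refl | no z′≢r = ≢-sym (r-case z′≢w z′≢r i i′)
        ... | no z≢r | yes refl = r-case z≢w z≢r i′ i

      -- Once (p, r) is gone, w may take its colour, which no other child edge of r has. The former
      -- colour of w is then free at r, because w was the only edge there that had it.
      unresolve-clash : ∀ x → Proper S⁺ x → Clash (unresolve x)
      unresolve-clash x pr = (proper , free-p) , trans (un-w x) (sym (un-r x)) , free-r
        where
        y = proj₁ (unresolve x)
        unch : ∀ {u z} → ¬ Chain acyclic⁺ w (lookup x w) (lookup x r) x u → Inc S⁺ z u → z ≢ w → lookup y z ≡ lookup x z
        unch = kempe-unchanged acyclic⁺ w (lookup x w) (lookup x r) x
        at-w : ∀ {u z} → ¬ Chain acyclic⁺ w (lookup x w) (lookup x r) x u → z ≢ w → Inc S⁻ w u → Inc S⁻ z u → lookup y z ≢ lookup y w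
        at-w {u} {z} ¬c z≢w i i′ e with refl ← at-r {x} {lookup x w} {lookup x r} ¬c (lift-Inc i) =
          pr r z r (Inc⁻≢r i′) (lift-Inc i′) (p , edge⁺ , inj₁ refl)
            (trans (sym (unch ¬c (lift-Inc i′) z≢w)) (trans e (un-w x)))
        proper : Proper S⁻ y
        proper u z z′ z≢z′ i i′ with chain? acyclic⁺ w (lookup x w) (lookup x r) x u
        ... | yes c = kempe-distinct acyclic⁺ w (lookup x w) (lookup x r) x c (lift-Inc i) (lift-Inc i′) (pr u z z′ z≢z′ (lift-Inc i) (lift-Inc i′))
        ... | no ¬c with z Fin.≟ w | z′ Fin.≟ w
        ...   | yes refl | yes refl = contradiction refl z≢z′
        ...   | yes refl | no z′≢w = ≢-sym (at-w ¬c z′≢w i i′)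
        ...   | no z≢w | yes refl = at-w ¬c z≢w i′ i
        ...   | no z≢w | no z′≢w = λ e → pr u z z′ z≢z′ (lift-Inc i) (lift-Inc i′)
          (trans (sym (unch ¬c (lift-Inc i) z≢w)) (trans e (unch ¬c (lift-Inc i′) z′≢w)))
        free-p : Free S⁻ y p (lookup y r)
        free-p z i e = pr p z r (Inc⁻≢r i) (lift-Inc i) (p , edge⁺ , inj₂ refl)
          (trans (sym (unch ¬chain-p (lift-Inc i) (λ { refl → ¬w-p i }))) (trans e (un-r x)))
          where
          ¬w-p : ¬ Inc S⁻ w p
          ¬w-p (_ , e , inj₁ refl) = ¬chain-p {ok = λ _ → p ≡ p} here
          ¬w-p (_ , e , inj₂ refl) = p≢r (just-injective (trans (sym e) wr))
        free-r : Free S⁺ y r (lookup x w)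
        free-r z i e with z Fin.≟ w
        ... | yes refl = pr r r w (≢-sym w≢r) (p , edge⁺ , inj₁ refl) (r , lift wr , inj₂ refl) (trans (sym (un-w x)) e)
        ... | no z≢w = pr r z w z≢w i (r , lift wr , inj₂ refl) (trans (sym (unch ¬chain-r i z≢w)) e)

-- Expectations

inv : ℕ → ℚ
inv zero = 0ℚ
inv (suc k) = + 1 ℚ./ suc k

E-sumL : (d : Dist A) (g : A → ℚ) → E d g ≡ sumL d (λ pa → proj₁ pa ⊛ g (proj₂ pa))
E-sumL [] g = refl
E-sumL ((p , a) ∷ d) g = cong (p ⊛ g a ⊕_) (E-sumL d g)

E-++ : (d e : Dist A) (g : A → ℚ) → E (d ++ e) g ≡ E d g ⊕ E e g
E-++ [] e g = sym (ℚₚ.+-identityˡ _)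
E-++ ((p , a) ∷ d) e g = trans (cong (p ⊛ g a ⊕_) (E-++ d e g)) (sym (ℚₚ.+-assoc (p ⊛ g a) _ _))

E-scale : (p : ℚ) (d : Dist A) (g : A → ℚ) → E (scale p d) g ≡ p ⊛ E d g
E-scale p [] g = sym (ℚₚ.*-zeroʳ p)
E-scale p ((q , a) ∷ d) g = trans (cong₂ _⊕_ (ℚₚ.*-assoc p q (g a)) (E-scale p d g)) (sym (ℚₚ.*-distribˡ-+ p _ _))

E-return : (a : A) (g : A → ℚ) → E (return a) g ≡ g a
E-return a g = trans (ℚₚ.+-identityʳ _) (ℚₚ.*-identityˡ (g a))

E-bind : (d : Dist A) (f : A → Dist B) (g : B → ℚ) → E (bind d f) g ≡ E d (λ a → E (f a) g)
E-bind [] f g = refl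
E-bind ((p , a) ∷ d) f g = trans (E-++ (scale p (f a)) (bind d f) g) (cong₂ _⊕_ (E-scale p (f a) g) (E-bind d f g))

E-choice : (p : ℚ) (d e : Dist A) (g : A → ℚ) → E (choice p d e) g ≡ p ⊛ E d g ⊕ (1ℚ ℚ.- p) ⊛ E e g
E-choice p d e g = trans (E-++ (scale p d) _ g) (cong₂ _⊕_ (E-scale p d g) (E-scale (1ℚ ℚ.- p) e g))

E-uniform : (xs : List A) (g : A → ℚ) → E (uniform xs) g ≡ inv (length xs) ⊛ sumL xs g
E-uniform [] g = sym (ℚₚ.*-zeroˡ 0ℚ)
E-uniform {A} (x ∷ xs) g = trans (E-sumL (uniform (x ∷ xs)) g)
  (trans (sumL-map (c ,_) (x ∷ xs) (λ pa → proj₁ pa ⊛ g (proj₂ pa))) (sumL-⊛ (x ∷ xs) c g))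
  where
  c = + 1 ℚ./ suc (length xs)

bind-cong-≡ : (d : Dist A) {f f′ : A → Dist B} → (∀ a → f a ≡ f′ a) → bind d f ≡ bind d f′
bind-cong-≡ d h = Listₚ.concatMap-cong (λ pa → cong (scale (proj₁ pa)) (h (proj₂ pa))) d

-- States up to pointwise equality

module _ {n κ : ℕ} where

  -- States are functions and are compared pointwise. Matching distributions entry by entry, with
  -- equal weights, transports expectations as well as the support on which the validity of later
  -- updates is quantified.
  _≈ᵈ_ : Dist (State n κ) → Dist (State n κ) → Set
  _≈ᵈ_ = Pointwise (λ a b → proj₁ a ≡ proj₁ b × (proj₂ a ≗ proj₂ b))

  scale-cong : ∀ p {d d′} → d ≈ᵈ d′ → scale p d ≈ᵈ scale p d′
  scale-cong p [] = []
  scale-cong p ((e , h) ∷ r) = (cong (p ⊛_) e , h) ∷ scale-cong p r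

  bind-cong : (d : Dist A) {f f′ : A → Dist (State n κ)} → (∀ a → f a ≈ᵈ f′ a) → bind d f ≈ᵈ bind d f′
  bind-cong [] h = []
  bind-cong ((p , a) ∷ d) h = PW.++⁺ (scale-cong p (h a)) (bind-cong d h)

  return-cong : {s s′ : State n κ} → s ≗ s′ → return s ≈ᵈ return s′
  return-cong h = (refl , h) ∷ []

  E-cong : ∀ {d d′} → d ≈ᵈ d′ → {g g′ : State n κ → ℚ} → (∀ {s s′} → s ≗ s′ → g s ≡ g′ s′) → E d g ≡ E d′ g′
  E-cong [] h = refl
  E-cong (_∷_ {x = p , _} (refl , e) r) h = cong₂ _⊕_ (cong (p ⊛_) (h e)) (E-cong r h)

  ≈ᵈ-∈ : ∀ {d d′ p s} → d ≈ᵈ d′ → (p , s) ∈ d′ → ∃[ s′ ] ((s′ ≗ s) × (p , s′) ∈ d)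
  ≈ᵈ-∈ ((refl , e) ∷ r) (here refl) = _ , e , here refl
  ≈ᵈ-∈ (_ ∷ r) (there m) with ≈ᵈ-∈ r m
  ... | s′ , e , m′ = s′ , e , there m′

  ≈ᵈ-refl : ∀ {d} → d ≈ᵈ d
  ≈ᵈ-refl = PW.refl (refl , λ _ → refl)

filterᵇ-cong : {p q : A → Bool} → p ≗ q → (xs : List A) → filterᵇ p xs ≡ filterᵇ q xs
filterᵇ-cong h [] = refl
filterᵇ-cong {p = p} {q} h (x ∷ xs) with p x | q x | h x
... | true | _ | refl = cong (x ∷_) (filterᵇ-cong h xs)
... | false | _ | refl = filterᵇ-cong h xs

module _ {n κ : ℕ} where

  insertStep : Fin n → Fin κ → State n κ → Maybe (Fin n) → Dist (State n κ)
  insertStep r β s₁ nothing = return s₁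
  insertStep r β s₁ (just w) = bind (uniform (avail s₁ r)) λ α → return (fixForbidden (set s₁ w (just (r , α))) w β α)

  -- The step functions of Defs are local to their definitions: the left-hand side _ of
  -- insertStep-eq (and of its analogues below) is solved by its use in the first lemma.
  mutual
    rootedInsert-unfold : (s : State n κ) (p r : Fin n) → rootedInsert s p r ≡
      bind (uniform (avail s p)) (λ β → insertStep r β (set s r (just (p , β))) (childWithColor (set s r (just (p , β))) r β))
    rootedInsert-unfold s p r = bind-cong-≡ (uniform (avail s p)) (insertStep-eq s p r)

    insertStep-eq : ∀ s p r β → _ ≡ insertStep r β (set s r (just (p , β))) (childWithColor (set s r (just (p , β))) r β)
    insertStep-eq s p r β with childWithColor (set s r (just (p , β))) r β
    ... | nothing = refl
    ... | just w = refl

  deleteStep : State n κ → Fin n → Fin κ → Fin n → Maybe (Fin n × Fin κ) → Dist (State n κ)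
  deleteStep s₁ r α w nothing = return s₁
  deleteStep s₁ r α w (just (_ , β)) = return (fixForbidden (set s₁ w (just (r , α))) w β α)

  mutual
    deletion-unfold : (s : State n κ) (p r : Fin n) {q : Fin n} {α : Fin κ} → s r ≡ just (q , α) →
      let s₁ = set s r nothing in
      deletion s p r ≡ choice (frac (κ ∸ length (children s₁ r)) κ) (return s₁)
        (bind (uniform (children s₁ r)) (λ w → deleteStep s₁ r α w (s₁ w)))
    deletion-unfold s p r {q} {α} e with s r | e
    ... | just (_ , _) | refl = cong (choice (frac (κ ∸ length (children s₁ r)) κ) (return s₁))
        (bind-cong-≡ (uniform (children s₁ r)) (deleteStep-eq s p r q α))
      where
      s₁ = set s r nothing

    deleteStep-eq : ∀ s (p r q : Fin n) α w → _ ≡ deleteStep (set s r nothing) r α w (set s r nothing w)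
    deleteStep-eq s p r q α w with set s r nothing w
    ... | nothing = refl
    ... | just _ = refl

  deletion-root : (s : State n κ) (p r : Fin n) → s r ≡ nothing → deletion s p r ≡ return s
  deletion-root s p r e with s r | e
  ... | nothing | refl = refl

  isChildOf-cong : {s s′ : State n κ} → s ≗ s′ → ∀ v → isChildOf s v ≗ isChildOf s′ v
  isChildOf-cong {s} {s′} h v w with s w | s′ w | h w
  ... | nothing | _ | refl = refl
  ... | just _ | _ | refl = refl

  children-cong : {s s′ : State n κ} → s ≗ s′ → ∀ v → children s v ≡ children s′ v
  children-cong {s} {s′} h v = filterᵇ-cong (isChildOf-cong {s} {s′} h v) (allFin n)

  set-cong : {s s′ : State n κ} → s ≗ s′ → ∀ v m → set s v m ≗ set s′ v m
  set-cong h v m w with w == v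
  ... | true = refl
  ... | false = h w

  mutual
    childWithColor-cong : {s s′ : State n κ} → s ≗ s′ → ∀ v β → childWithColor s v β ≡ childWithColor s′ v β
    childWithColor-cong {s} {s′} h v β = cong List.head (filterᵇ-cong (hasColor-cong h v β) (allFin n))

    hasColor-cong : {s s′ : State n κ} → s ≗ s′ → ∀ v β w → _ ≡ _
    hasColor-cong {s} {s′} h v β w with s w | s′ w | h w
    ... | nothing | _ | refl = refl
    ... | just _ | _ | refl = refl

  usedAt-cong : {s s′ : State n κ} → s ≗ s′ → ∀ v → usedAt s v ≡ usedAt s′ v
  usedAt-cong {s} {s′} h v = cong₂ _++_ (cong (Maybe.maybe _ []) (h v))
    (trans (Listₚ.concatMap-cong (λ w → cong (Maybe.maybe _ []) (h w)) (children s v))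
           (cong (concatMap _) (children-cong h v)))

  deg-cong : {s s′ : State n κ} → s ≗ s′ → ∀ v → deg s v ≡ deg s′ v
  deg-cong h v = cong length (usedAt-cong h v)

  avail-cong : {s s′ : State n κ} → s ≗ s′ → ∀ v → avail s v ≡ avail s′ v
  avail-cong {s} {s′} h v = cong (λ u → filterᵇ (λ col → not (any (λ d → d ==ᶜ col) u)) (allFin κ)) (usedAt-cong h v)

  rootOf′-cong : {s s′ : State n κ} → s ≗ s′ → ∀ f v → rootOf′ f s v ≡ rootOf′ f s′ v
  rootOf′-cong h zero v = refl
  rootOf′-cong {s} {s′} h (suc f) v with s v | s′ v | h v
  ... | nothing | _ | refl = refl
  ... | just (p , _) | _ | refl = rootOf′-cong h f p

  rootOf-cong : {s s′ : State n κ} → s ≗ s′ → ∀ v → rootOf s v ≡ rootOf s′ v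
  rootOf-cong h = rootOf′-cong h n

  mutual
    treeEdges-cong : {s s′ : State n κ} → s ≗ s′ → ∀ v → treeEdges s v ≡ treeEdges s′ v
    treeEdges-cong {s} {s′} h v = cong length (filterᵇ-cong (inTree-cong h v) (allFin n))

    inTree-cong : {s s′ : State n κ} → s ≗ s′ → ∀ v w → _ ≡ _
    inTree-cong {s} {s′} h v w with s w | s′ w | h w
    ... | nothing | _ | refl = refl
    ... | just _ | _ | refl = cong₂ _==_ (rootOf-cong {s} {s′} h w) (rootOf-cong {s} {s′} h v)

  reroot′-cong : {s s′ : State n κ} → s ≗ s′ → ∀ f v m → reroot′ f s v m ≗ reroot′ f s′ v m
  reroot′-cong h zero v m = set-cong h v m
  reroot′-cong {s} {s′} h (suc f) v m with s v | s′ v | h v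
  ... | nothing | _ | refl = set-cong h v m
  ... | just (y , col) | _ | refl = reroot′-cong (set-cong h v m) f y (just (v , col))

  reroot-cong : {s s′ : State n κ} → s ≗ s′ → ∀ v → reroot s v ≗ reroot s′ v
  reroot-cong h v = reroot′-cong h n v nothing

  fixForbidden′-cong : {s s′ : State n κ} → s ≗ s′ → ∀ f v α β → fixForbidden′ f s v α β ≗ fixForbidden′ f s′ v α β
  fixForbidden′-cong h zero v α β = h
  fixForbidden′-cong {s} {s′} h (suc f) v α β
    with childWithColor s v β | childWithColor s′ v β | childWithColor-cong {s} {s′} h v β
  ... | nothing | _ | refl = h
  ... | just w | _ | refl = fixForbidden′-cong (set-cong h w _) f w β α

  fixForbidden-cong : {s s′ : State n κ} → s ≗ s′ → ∀ v α β → fixForbidden s v α β ≗ fixForbidden s′ v α β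
  fixForbidden-cong h = fixForbidden′-cong h n

  insertStep-cong : {s s′ : State n κ} → s ≗ s′ → ∀ r β m → insertStep r β s m ≈ᵈ insertStep r β s′ m
  insertStep-cong h r β nothing = return-cong h
  insertStep-cong {s} {s′} h r β (just w) rewrite avail-cong {s} {s′} h r =
    bind-cong (uniform (avail s′ r)) (λ α → return-cong (fixForbidden-cong (set-cong h w _) w β α))

  rootedInsert-cong : {s s′ : State n κ} → s ≗ s′ → ∀ p r → rootedInsert s p r ≈ᵈ rootedInsert s′ p r
  rootedInsert-cong {s} {s′} h p r rewrite rootedInsert-unfold s p r | rootedInsert-unfold s′ p r | avail-cong {s} {s′} h p =
    bind-cong (uniform (avail s′ p)) eq
    where
    eq : ∀ β → insertStep r β (set s r (just (p , β))) (childWithColor (set s r (just (p , β))) r β)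
             ≈ᵈ insertStep r β (set s′ r (just (p , β))) (childWithColor (set s′ r (just (p , β))) r β)
    eq β rewrite childWithColor-cong (set-cong h r (just (p , β))) r β = insertStep-cong (set-cong h r (just (p , β))) r β (childWithColor (set s′ r (just (p , β))) r β)

  deleteStep-cong : {s s′ : State n κ} → s ≗ s′ → ∀ r α w m → deleteStep s r α w m ≈ᵈ deleteStep s′ r α w m
  deleteStep-cong h r α w nothing = return-cong h
  deleteStep-cong h r α w (just (_ , β)) = return-cong (fixForbidden-cong (set-cong h w _) w β α)

  deletion-cong : {s s′ : State n κ} → s ≗ s′ → ∀ p r → deletion s p r ≈ᵈ deletion s′ p r
  deletion-cong {s} {s′} h p r = cases (s r) (s′ r) refl refl
    where
    cases : ∀ m m′ → s r ≡ m → s′ r ≡ m′ → deletion s p r ≈ᵈ deletion s′ p r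
    cases nothing nothing e e′ rewrite deletion-root s p r e | deletion-root s′ p r e′ = return-cong h
    cases (just (q , α)) (just (q′ , α′)) e e′ with refl ← trans (sym e) (trans (h r) e′)
      rewrite deletion-unfold s p r e | deletion-unfold s′ p r e′ | children-cong (set-cong h r nothing) r =
      PW.++⁺ (scale-cong ρ (return-cong (set-cong h r nothing)))
        (scale-cong (1ℚ ℚ.- ρ) (bind-cong (uniform (children (set s′ r nothing) r)) eq))
      where
      ρ = frac (κ ∸ length (children (set s′ r nothing) r)) κ
      eq : ∀ w → deleteStep (set s r nothing) r α w (set s r nothing w) ≈ᵈ deleteStep (set s′ r nothing) r α w (set s′ r nothing w)
      eq w rewrite set-cong h r nothing w = deleteStep-cong (set-cong h r nothing) r α w _
    cases nothing (just _) e e′ with () ← trans (sym e) (trans (h r) e′)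
    cases (just _) nothing e e′ with () ← trans (sym e) (trans (h r) e′)

  rootedStep-cong : ∀ Δ {s s′ : State n κ} → s ≗ s′ → ∀ u → rootedStep Δ s u ≈ᵈ rootedStep Δ s′ u
  rootedStep-cong Δ h (ins p r) = rootedInsert-cong h p r
  rootedStep-cong Δ h (del p r) = deletion-cong h p r

  unrootedStep-cong : ∀ Δ {s s′ : State n κ} → s ≗ s′ → ∀ u → unrootedStep Δ s u ≈ᵈ unrootedStep Δ s′ u
  unrootedStep-cong Δ {s} {s′} h (ins a b)
    rewrite treeEdges-cong {s} {s′} h a | treeEdges-cong {s} {s′} h b | deg-cong {s} {s′} h a | deg-cong {s} {s′} h b
    with if (treeEdges s′ a ≤ᵇ Δ) ∧ (treeEdges s′ b ≤ᵇ Δ) then deg s′ b ≤ᵇ deg s′ a else (treeEdges s′ b ≤ᵇ treeEdges s′ a)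
  ... | true = rootedInsert-cong (reroot-cong h b) a b
  ... | false = rootedInsert-cong (reroot-cong h a) b a
  unrootedStep-cong Δ {s} {s′} h (del a b)
    rewrite isChildOf-cong {s} {s′} h a b | isChildOf-cong {s} {s′} h b a
    with isChildOf s′ a b | isChildOf s′ b a
  ... | true | _ = deletion-cong h a b
  ... | false | true = deletion-cong h b a
  ... | false | false = return-cong h

  rootedValid-cong : ∀ Δ {s s′ : State n κ} → s ≗ s′ → ∀ u → RootedValid Δ s u → RootedValid Δ s′ u
  rootedValid-cong Δ {s} {s′} h (ins p r) (e , ne , dp , dr) =
    trans (sym (h r)) e , (λ e′ → ne (trans (rootOf-cong {s} {s′} h p) e′)) ,
    subst (_< Δ) (deg-cong {s} {s′} h p) dp , subst (_< Δ) (deg-cong {s} {s′} h r) dr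
  rootedValid-cong Δ h (del p r) (α , e) = α , trans (sym (h r)) e

  unrootedValid-cong : ∀ Δ {s s′ : State n κ} → s ≗ s′ → ∀ u → UnrootedValid Δ s u → UnrootedValid Δ s′ u
  unrootedValid-cong Δ {s} {s′} h (ins a b) (ne , da , db) =
    (λ e → ne (trans (rootOf-cong {s} {s′} h a) (trans e (sym (rootOf-cong {s} {s′} h b))))) ,
    subst (_< Δ) (deg-cong {s} {s′} h a) da , subst (_< Δ) (deg-cong {s} {s′} h b) db
  unrootedValid-cong Δ h (del a b) = Sum.map (trans (cong (Maybe.map proj₁) (sym (h b)))) (trans (cong (Maybe.map proj₁) (sym (h a))))

module _ {n κ : ℕ} (step : State n κ → Upd n → Dist (State n κ)) (valid : State n κ → Upd n → Set) where

  colorOf-cong : {s s′ : State n κ} → s ≗ s′ → ∀ u v → colorOf step valid s u v ≡ colorOf step valid s′ u v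
  colorOf-cong {s} {s′} h u v with s u | s′ u | h u
  colorOf-cong {s} {s′} h u v | nothing | _ | refl with s v | s′ v | h v
  ... | nothing | _ | refl = refl
  ... | just _ | _ | refl = refl
  colorOf-cong {s} {s′} h u v | just (p , c) | _ | refl with p == v
  ... | true = refl
  ... | false with s v | s′ v | h v
  ...   | nothing | _ | refl = refl
  ...   | just _ | _ | refl = refl

  recourse-colorOf : ∀ {s s′ t t′} → (∀ u v → colorOf step valid s u v ≡ colorOf step valid s′ u v) →
    (∀ u v → colorOf step valid t u v ≡ colorOf step valid t′ u v) →
    recourse step valid s t ≡ recourse step valid s′ t′
  recourse-colorOf h k = cong length (filterᵇ-cong
    (λ uv → cong ((toℕ (proj₁ uv) ℕ.<ᵇ toℕ (proj₂ uv)) ∧_) (cong₂ (changed step valid) (h (proj₁ uv) (proj₂ uv)) (k (proj₁ uv) (proj₂ uv))))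
    (List.cartesianProduct (allFin n) (allFin n)))

  recourse-cong : ∀ {s s′ t t′} → s ≗ s′ → t ≗ t′ → recourse step valid s t ≡ recourse step valid s′ t′
  recourse-cong {s} {s′} {t} {t′} h k = recourse-colorOf {s} {s′} {t} {t′} (colorOf-cong h) (colorOf-cong k)

  module _ (step-cong : ∀ {s s′} → s ≗ s′ → ∀ u → step s u ≈ᵈ step s′ u)
           (valid-cong : ∀ {s s′} → s ≗ s′ → ∀ u → valid s u → valid s′ u) where

    ValidSeq-cong : ∀ {s s′} → s ≗ s′ → ∀ us → ValidSeq step valid s us → ValidSeq step valid s′ us
    ValidSeq-cong h [] _ = tt
    ValidSeq-cong h (u ∷ us) (v , k) = valid-cong h u v , λ m →
      let (t , e , m′) = ≈ᵈ-∈ (step-cong h u) m in ValidSeq-cong e us (k m′)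

    expRecourse-cong : ∀ {s s′} → s ≗ s′ → ∀ us t → expRecourse step valid s us t ≡ expRecourse step valid s′ us t
    expRecourse-cong h [] t = refl
    expRecourse-cong h (u ∷ us) zero = E-cong (step-cong h u) (λ e → cong fromℕ (recourse-cong h e))
    expRecourse-cong h (u ∷ us) (suc t) = E-cong (step-cong h u) (λ e → expRecourse-cong e us t)

-- The algorithm on a shape with a vector of colours

does-iff : {P : Set} (b : Bool) (d : Dec P) → (b ≡ true → P) → (P → b ≡ true) → b ≡ does d
does-iff true d f g = sym (dec-true d (f refl))
does-iff false d f g = sym (dec-false d (λ p → contradiction (g p) λ ()))

does-true : {P : Set} (d : Dec P) → does d ≡ true → P
does-true (yes p) _ = p

==-refl : ∀ {m} (v : Fin m) → (v == v) ≡ true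
==-refl v = trans (isYes≗does (v Fin.≟ v)) (dec-true (v Fin.≟ v) refl)

==-≢ : ∀ {m} {v w : Fin m} → v ≢ w → (v == w) ≡ false
==-≢ {v = v} {w} ne = trans (isYes≗does (v Fin.≟ w)) (dec-false (v Fin.≟ w) ne)

head-filterᵇ-just : (p : A → Bool) (xs : List A) {w : A} → List.head (filterᵇ p xs) ≡ just w → p w ≡ true
head-filterᵇ-just p (x ∷ xs) e with p x in eq
... | true with refl ← e = eq
... | false = head-filterᵇ-just p xs e

head-filterᵇ-nothing : (p : A → Bool) (xs : List A) → List.head (filterᵇ p xs) ≡ nothing → ∀ {w} → w ∈ xs → p w ≡ false
head-filterᵇ-nothing p (x ∷ xs) e m with p x in eq
head-filterᵇ-nothing p (x ∷ xs) e (here refl) | false = eq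
head-filterᵇ-nothing p (x ∷ xs) e (there m) | false = head-filterᵇ-nothing p xs e m

any-true : (p : A → Bool) (xs : List A) → any p xs ≡ true → ∃[ x ] (x ∈ xs × p x ≡ true)
any-true p (x ∷ xs) e with p x in eq
... | true = x , here refl , eq
... | false with any-true p xs e
...   | y , m , h = y , there m , h

true-any : (p : A → Bool) (xs : List A) {x : A} → x ∈ xs → p x ≡ true → any p xs ≡ true
true-any p (x ∷ xs) (here refl) h rewrite h = refl
true-any p (x ∷ xs) (there m) h with p x
... | true = refl
... | false = true-any p xs m h

module _ {n : ℕ} where

  child? : ∀ (S : Str n) v w → Dec (S w ≡ just v)
  child? S v w = Maybeₚ.≡-dec Fin._≟_ (S w) (just v)

  kids : Str n → Fin n → List (Fin n)
  kids S v = filterᵇ (does ∘ child? S v) (allFin n)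

  parentCount : Maybe (Fin n) → ℕ
  parentCount = Maybe.maybe (λ _ → 1) 0

  degree : Str n → Fin n → ℕ
  degree S u = parentCount (S u) + length (kids S u)

module _ {n κ : ℕ} where

  -- A colouring has a coordinate for every vertex, naming the edge to its parent. The
  -- coordinate of a root is a dummy; linking r below p turns the dummy at r into the colour
  -- of the new edge.
  st : Str n → Vec (Fin κ) n → State n κ
  st S x v = Maybe.map (λ q → q , lookup x v) (S v)

  module _ (S : Str n) (x : Vec (Fin κ) n) where

    isChildOf-st : ∀ v w → isChildOf (st S x) v w ≡ does (child? S v w)
    isChildOf-st v w with S w
    ... | nothing = refl
    ... | just q = isYes≗does (q Fin.≟ v)

    children-st : ∀ v → children (st S x) v ≡ kids S v
    children-st v = filterᵇ-cong (isChildOf-st v) (allFin n)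

    hasColor? : ∀ v β w → Dec (S w ≡ just v × lookup x w ≡ β)
    hasColor? v β w = child? S v w ×-dec (lookup x w Fin.≟ β)

    parentOf-st : ∀ v → parentOf (st S x) v ≡ S v
    parentOf-st v with S v
    ... | nothing = refl
    ... | just q = refl

    st-just : ∀ {v q} → S v ≡ just q → st S x v ≡ just (q , lookup x v)
    st-just {v} e = cong (Maybe.map (λ q → q , lookup x v)) e

    st-nothing : ∀ {v} → S v ≡ nothing → st S x v ≡ nothing
    st-nothing {v} e = cong (Maybe.map (λ q → q , lookup x v)) e

    st-just⁻ : ∀ {v q α} → st S x v ≡ just (q , α) → S v ≡ just q
    st-just⁻ {v} e with S v
    ... | just q with refl ← e = refl

    st-nothing⁻ : ∀ {v} → st S x v ≡ nothing → S v ≡ nothing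
    st-nothing⁻ {v} e with S v
    ... | nothing = refl

  mutual
    childWithColor-st : ∀ S x v β → childWithColor (st S x) v β ≡ List.head (filterᵇ (does ∘ hasColor? S x v β) (allFin n))
    childWithColor-st S x v β = cong List.head (filterᵇ-cong (hasColor-eq S x v β) (allFin n))

    hasColor-eq : ∀ S x v β w → _ ≡ does (hasColor? S x v β w)
    hasColor-eq S x v β w with S w
    ... | nothing = refl
    ... | just q = cong₂ _∧_ (isYes≗does (q Fin.≟ v)) (isYes≗does (lookup x w Fin.≟ β))

  module _ (S : Str n) (x : Vec (Fin κ) n) where

    childWithColor-just : ∀ {v β w} → childWithColor (st S x) v β ≡ just w → S w ≡ just v × lookup x w ≡ β
    childWithColor-just {v} {β} {w} e = does-true (hasColor? S x v β w)
      (head-filterᵇ-just (does ∘ hasColor? S x v β) (allFin n) (trans (sym (childWithColor-st S x v β)) e))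

    childWithColor-nothing : ∀ {v β} → childWithColor (st S x) v β ≡ nothing → ∀ {w} → S w ≡ just v → lookup x w ≢ β
    childWithColor-nothing {v} {β} e {w} c h = contradiction (trans (sym (dec-true (hasColor? S x v β w) (c , h)))
      (head-filterᵇ-nothing (does ∘ hasColor? S x v β) (allFin n) (trans (sym (childWithColor-st S x v β)) e) (∈ₚ.∈-allFin w))) λ ()

    private
      color : Maybe (Fin n × Fin κ) → List (Fin κ)
      color = Maybe.maybe (λ pc → proj₂ pc ∷ []) []

      ∈-color : ∀ w {γ} → γ ∈ color (st S x w) → ∃[ q ] (S w ≡ just q × lookup x w ≡ γ)
      ∈-color w m with S w
      ∈-color w (here refl) | just q = q , refl , refl

      color-∈ : ∀ {w q} → S w ≡ just q → lookup x w ∈ color (st S x w)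
      color-∈ e rewrite e = here refl

      ∈-kids⁻ : ∀ {v w} → w ∈ kids S v → S w ≡ just v
      ∈-kids⁻ {v} {w} m with child? S v w | proj₂ (∈ₚ.∈-filter⁻ (λ w → T? (does (child? S v w))) {xs = allFin n} m)
      ... | yes e | _ = e

      ∈-kids : ∀ {v w} → S w ≡ just v → w ∈ kids S v
      ∈-kids {v} {w} e = ∈ₚ.∈-filter⁺ (λ w → T? (does (child? S v w))) (∈ₚ.∈-allFin w)
        (subst T (sym (dec-true (child? S v w) e)) tt)

    usedAt-⇒ : ∀ {u γ} → γ ∈ usedAt (st S x) u → ∃[ z ] (Inc S z u × lookup x z ≡ γ)
    usedAt-⇒ {u} m with ∈ₚ.∈-++⁻ (color (st S x u)) m
    ... | inj₁ m₁ = let (q , e , h) = ∈-color u m₁ in u , (q , e , inj₁ refl) , h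
    ... | inj₂ m₂ with ∈ₚ.∈-concatMap⁻ (λ w → color (st S x w)) {xs = children (st S x) u} m₂
    ...   | a with find a
    ...     | w , w∈ , m₃ = let (q , e , h) = ∈-color w m₃ in
      w , (u , ∈-kids⁻ (subst (w ∈_) (children-st S x u) w∈) , inj₂ refl) , h

    usedAt-⇐ : ∀ {u z} → Inc S z u → lookup x z ∈ usedAt (st S x) u
    usedAt-⇐ {u} (q , e , inj₁ refl) = ∈ₚ.∈-++⁺ˡ (color-∈ e)
    usedAt-⇐ {u} {z} (q , e , inj₂ refl) = ∈ₚ.∈-++⁺ʳ (color (st S x u))
      (∈ₚ.∈-concatMap⁺ (λ w → color (st S x w))
        (lose (subst (z ∈_) (sym (children-st S x u)) (∈-kids e)) (color-∈ e)))

    avail-st : ∀ u → avail (st S x) u ≡ filterᵇ (does ∘ free? S x u) (allFin κ)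
    avail-st u = filterᵇ-cong eq (allFin κ)
      where
      ==-true : ∀ {a b : Fin κ} → (a ==ᶜ b) ≡ true → a ≡ b
      ==-true {a} {b} h with a Fin.≟ b
      ... | yes e = e
      eq : ∀ γ → not (any (λ d → d ==ᶜ γ) (usedAt (st S x) u)) ≡ does (free? S x u γ)
      eq γ = does-iff _ (free? S x u γ)
        (λ h z i e → contradiction (trans (sym h) (cong not (true-any (λ d → d ==ᶜ γ) (usedAt (st S x) u) (usedAt-⇐ i)
          (trans (cong (_==ᶜ γ) e) (==-refl γ))))) λ ())
        (λ fr → f fr (any (λ d → d ==ᶜ γ) (usedAt (st S x) u)) refl)
        where
        f : Free S x u γ → ∀ b → any (λ d → d ==ᶜ γ) (usedAt (st S x) u) ≡ b → not b ≡ true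
        f fr false e = refl
        f fr true e =
          let (d , m , h) = any-true (λ d → d ==ᶜ γ) (usedAt (st S x) u) e
              (z , i , h′) = usedAt-⇒ m
          in contradiction (trans h′ (==-true h)) (fr z i)

    deg-st : ∀ u → deg (st S x) u ≡ degree S u
    deg-st u = trans (Listₚ.length-++ (color (st S x u)))
      (cong₂ _+_ (len-color u)
        (trans (cong (λ l → length (concatMap (λ w → color (st S x w)) l)) (children-st S x u))
               (len-kids (kids S u) ∈-kids⁻)))
      where
      len-color : ∀ w → length (color (st S x w)) ≡ parentCount (S w)
      len-color w with S w
      ... | nothing = refl
      ... | just _ = refl
      len-kids : ∀ ws → (∀ {w} → w ∈ ws → S w ≡ just u) → length (concatMap (λ w → color (st S x w)) ws) ≡ length ws
      len-kids [] h = refl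
      len-kids (w ∷ ws) h = trans (Listₚ.length-++ (color (st S x w)))
        (cong₂ _+_ (trans (len-color w) (cong parentCount (h (here refl)))) (len-kids ws (h ∘ there)))

    set-recolor : ∀ {v w} α → S w ≡ just v → set (st S x) w (just (v , α)) ≗ st S (x [ w ]≔ α)
    set-recolor {v} {w} α e z with z Fin.≟ w
    ... | yes refl = sym (trans (cong (Maybe.map _) e) (cong (λ c → just (v , c)) (Vecₚ.lookup∘update w x α)))
    ... | no z≢w = cong (λ c → Maybe.map (λ q → q , c) (S z)) (sym (Vecₚ.lookup∘update′ z≢w x α))

  st-update-root : ∀ S x {r} β → S r ≡ nothing → st S (x [ r ]≔ β) ≗ st S x
  st-update-root S x {r} β e z with z Fin.≟ r
  ... | yes refl rewrite e = refl
  ... | no z≢r = cong (λ c → Maybe.map (λ q → q , c) (S z)) (Vecₚ.lookup∘update′ z≢r x β)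

  module _ {S⁻ S⁺ : Str n} {p r : Fin n} (L : Link S⁻ S⁺ p r) where
    open Link L

    set-link : ∀ x β → set (st S⁻ x) r (just (p , β)) ≗ st S⁺ (x [ r ]≔ β)
    set-link x β z with z Fin.≟ r
    ... | yes refl = sym (trans (st-just S⁺ (x [ r ]≔ β) edge⁺) (cong (λ c → just (p , c)) (Vecₚ.lookup∘update r x β)))
    ... | no z≢r = trans (cong (Maybe.map _) (same z≢r)) (cong (λ c → Maybe.map (λ q → q , c) (S⁺ z)) (sym (Vecₚ.lookup∘update′ z≢r x β)))

    set-cut : ∀ x → set (st S⁺ x) r nothing ≗ st S⁻ x
    set-cut x z with z Fin.≟ r
    ... | yes refl = sym (st-nothing S⁻ x root⁻)
    ... | no z≢r = cong (Maybe.map _) (sym (same z≢r))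

  -- When an insertion calls `fixForbidden`, the colouring still clashes at r in the forest with (p,
  -- r). Properness can be demanded only at v and below it, and this is all that the recursion
  -- inspects.
  LocallyProper : Str n → Vec (Fin κ) n → Fin n → Set
  LocallyProper S x v = ∀ {u z z′} → Reach S (λ _ → ⊤) v u → z ≢ z′ → Inc S z u → Inc S z′ u → lookup x z ≢ lookup x z′

  module _ {S : Str n} (a : Acyclic S) where

    -- Here x is the colouring before the edge above v was recoloured from α to β. At v the colour α
    -- belongs to that edge, so the chain can go on only through the child edge coloured β. If there
    -- is none, the chain is v alone; otherwise it is v followed by the chain of that child with the
    -- colours exchanged, which the recursive call handles. Every call goes one level down, so
    -- `depth<n` rules out running out of fuel.
    fixForbidden-kempe : ∀ f x v y α β → S v ≡ just y → lookup x v ≡ α → LocallyProper S x v → n ≤ f + depth a v →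
      fixForbidden′ f (st S (x [ v ]≔ β)) v α β ≗ st S (kempe a v α β x)
    fixForbidden-kempe zero x v y α β vy xv lp fuel = contradiction (depth<n a v) (ℕₚ.≤⇒≯ fuel)
    fixForbidden-kempe (suc f) x v y α β vy xv lp fuel with childWithColor (st S (x [ v ]≔ β)) v β in eq
    ... | nothing = λ z → cong (λ c → Maybe.map (λ q → q , c) (S z)) (agree z)
      where
      x₁ = x [ v ]≔ β
      only-v : ∀ {z} → Chain a v α β x z → z ≡ v
      only-v here = refl
      only-v (there {z} e o c) with refl ← only-v c with o
      ... | inj₁ xz≡α = contradiction (trans xz≡α (sym xv))
              (lp here (λ { refl → ℕₚ.<-irrefl refl (depth-< a e) }) (v , e , inj₂ refl) (y , vy , inj₁ refl))
      ... | inj₂ xz≡β = contradiction (trans (Vecₚ.lookup∘update′ (λ { refl → ℕₚ.<-irrefl refl (depth-< a e) }) x β) xz≡β)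
              (childWithColor-nothing S x₁ eq e)
      agree : ∀ z → lookup x₁ z ≡ lookup (kempe a v α β x) z
      agree z with z Fin.≟ v
      ... | yes refl = trans (Vecₚ.lookup∘update v x β)
              (sym (trans (kempe-in a v α β x here) (trans (cong (tr α β) xv) (tr-left α β))))
      ... | no z≢v = trans (Vecₚ.lookup∘update′ z≢v x β) (sym (kempe-out a v α β x (z≢v ∘ only-v)))
    ... | just c = λ z → trans (fixForbidden′-cong (set-recolor S x₁ α cv) f c β α z)
        (trans (fixForbidden-kempe f x₁ c v β α cv xc lp₁ fuel₁ z)
               (cong (λ c → Maybe.map (λ q → q , c) (S z)) (agree z)))
      where
      x₁ = x [ v ]≔ β
      cv : S c ≡ just v
      cv = proj₁ (childWithColor-just S x₁ eq)
      xc : lookup x₁ c ≡ β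
      xc = proj₂ (childWithColor-just S x₁ eq)
      fuel₁ : n ≤ f + depth a c
      fuel₁ = subst (n ≤_) (trans (sym (ℕₚ.+-suc f _)) (cong (f ℕ.+_) (sym (depth-child a cv)))) fuel
      below≢v : {ok : Fin n → Set} → ∀ {z} → Reach S ok c z → z ≢ v
      below≢v r refl = ¬Reach-above a (depth-< a cv) r
      x₁≡x : ∀ {z} → z ≢ v → lookup x₁ z ≡ lookup x z
      x₁≡x z≢v = Vecₚ.lookup∘update′ z≢v x β
      c≢v : c ≢ v
      c≢v = below≢v {ok = λ _ → ⊤} here
      extend : ∀ {u} → Reach S (λ _ → ⊤) c u → Reach S (λ _ → ⊤) v u
      extend here = there cv tt here
      extend (there e o r) = there e o (extend r)
      inc≢v : ∀ {u z} → Reach S (λ _ → ⊤) c u → Inc S z u → z ≢ v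
      inc≢v r (_ , e , inj₁ refl) = below≢v r
      inc≢v r (_ , e , inj₂ refl) = below≢v (there e tt r)
      lp₁ : LocallyProper S x₁ c
      lp₁ r ne i i′ h = lp (extend r) ne i i′ (trans (sym (x₁≡x (inc≢v r i))) (trans h (x₁≡x (inc≢v r i′))))
      to : ∀ {z} → z ≢ v → Chain a v α β x z → Chain a c β α x₁ z
      to z≢v here = contradiction refl z≢v
      to {z} z≢v (there {q = q} e o r) with q Fin.≟ v
      ... | no q≢v = there e (Sum.swap (subst (OneOf α β) (sym (x₁≡x z≢v)) o)) (to q≢v r)
      ... | yes refl with o
      ...   | inj₁ xz≡α = contradiction (trans xz≡α (sym xv)) (lp here z≢v (v , e , inj₂ refl) (y , vy , inj₁ refl))
      ...   | inj₂ xz≡β with z Fin.≟ c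
      ...     | yes refl = here
      ...     | no z≢c = contradiction (trans xz≡β (trans (sym xc) (x₁≡x c≢v))) (lp here z≢c (v , e , inj₂ refl) (v , cv , inj₂ refl))
      from : ∀ {z} → Chain a c β α x₁ z → Chain a v α β x z
      from here = there cv (inj₂ (trans (sym (x₁≡x c≢v)) xc)) here
      from r@(there e o r′) = there e (Sum.swap (subst (OneOf β α) (x₁≡x (below≢v r)) o)) (from r′)
      agree : ∀ z → lookup (kempe a c β α x₁) z ≡ lookup (kempe a v α β x) z
      agree z with z Fin.≟ v
      ... | yes refl = trans (kempe-out a c β α x₁ (λ r → below≢v r refl)) (trans (Vecₚ.lookup∘update v x β)
              (sym (trans (kempe-in a v α β x here) (trans (cong (tr α β) xv) (tr-left α β)))))
      ... | no z≢v with chain? a v α β x z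
      ...   | yes r = trans (kempe-in a c β α x₁ (to z≢v r))
              (trans (cong (tr β α) (x₁≡x z≢v)) (trans (tr-sym β α (lookup x z)) (sym (kempe-in a v α β x r))))
      ...   | no ¬r = trans (kempe-out a c β α x₁ (¬r ∘ from)) (trans (x₁≡x z≢v) (sym (kempe-out a v α β x ¬r)))

-- Counting free colours and averaging over one coordinate

𝟙-×-⊛ : {P Q : Set} (d : Dec P) (e : Dec Q) (a : ℚ) → 𝟙 (d ×-dec e) ⊛ a ≡ 𝟙 d ⊛ (𝟙 e ⊛ a)
𝟙-×-⊛ d e a = trans (cong (_⊛ a) (𝟙-× d e)) (ℚₚ.*-assoc (𝟙 d) (𝟙 e) a)

𝟙-congʳ : {P : Set} (d : Dec P) {a b : ℚ} → (P → a ≡ b) → 𝟙 d ⊛ a ≡ 𝟙 d ⊛ b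
𝟙-congʳ d h = 𝟙-guard d d _ _ id id h

∑-unique : (F : Finite A) {P : A → Set} (P? : ∀ a → Dec (P a)) (f : A → ℚ) {a₀ : A} → P a₀ →
  (∀ a → P a → a ≡ a₀) → ∑ F (λ a → 𝟙 (P? a) ⊛ f a) ≡ f a₀
∑-unique F P? f {a₀} p u = trans
  (sumL-cong (enum F) (λ a → 𝟙-guard (P? a) (eq? F a a₀) (f a) (f a) (u a) (λ { refl → p }) (λ _ → refl)))
  (∑-δ F a₀ f)

∑-none : (F : Finite A) {P : A → Set} (P? : ∀ a → Dec (P a)) (f : A → ℚ) → (∀ a → ¬ P a) →
  ∑ F (λ a → 𝟙 (P? a) ⊛ f a) ≡ 0ℚ
∑-none F P? f h = trans (sumL-cong (enum F) (λ a → trans (cong (_⊛ f a) (𝟙-no (P? a) (h a))) (ℚₚ.*-zeroˡ (f a)))) (sumL-zero (enum F))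

length-allFin : ∀ k → length (allFin k) ≡ k
length-allFin k = Listₚ.length-tabulate id

fromℕ-mono-< : ∀ {a b} → a < b → fromℕ a ℚ.< fromℕ b
fromℕ-mono-< {a} {b} a<b = begin-strict
  fromℕ a            ≡⟨ ℚₚ.+-identityˡ (fromℕ a) ⟨
  0ℚ ⊕ fromℕ a       <⟨ ℚₚ.+-monoˡ-< (fromℕ a) (ℚₚ.positive⁻¹ 1ℚ) ⟩
  1ℚ ⊕ fromℕ a       ≡⟨ fromℕ-suc a ⟨
  fromℕ (suc a)      ≤⟨ fromℕ-mono a<b ⟩
  fromℕ b            ∎
  where open ℚₚ.≤-Reasoning

fromℕ-injective : ∀ {a b} → fromℕ a ≡ fromℕ b → a ≡ b
fromℕ-injective {a} {b} e with ℕₚ.<-cmp a b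
... | tri≈ _ a≡b _ = a≡b
... | tri< a<b _ _ = contradiction (fromℕ-mono-< a<b) (ℚₚ.<-irrefl e)
... | tri> _ _ b<a = contradiction (fromℕ-mono-< b<a) (ℚₚ.<-irrefl (sym e))

inv-fromℕ : ∀ {k} → 0 < k → inv k ⊛ fromℕ k ≡ 1ℚ
inv-fromℕ {suc k} _ = /-fromℕ 1 k

0≤inv : ∀ k → 0ℚ ≼ inv k
0≤inv zero = ℚₚ.≤-refl
0≤inv (suc k) = ℚₚ.nonNegative⁻¹ (inv (suc k)) {{ℚₚ.normalize-nonNeg 1 (suc k)}}

/-inv : ∀ a b → (+ a ℚ./ suc b) ≡ inv (suc b) ⊛ fromℕ a
/-inv a b = begin
  q                                      ≡⟨ ℚₚ.*-identityʳ q ⟨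
  q ⊛ 1ℚ                                 ≡⟨ cong (q ⊛_) (inv-fromℕ {suc b} (ℕ.s≤s ℕ.z≤n)) ⟨
  q ⊛ (inv (suc b) ⊛ fromℕ (suc b))      ≡⟨ ⊛-swap q (inv (suc b)) (fromℕ (suc b)) ⟩
  inv (suc b) ⊛ (q ⊛ fromℕ (suc b))      ≡⟨ cong (inv (suc b) ⊛_) (/-fromℕ a b) ⟩
  inv (suc b) ⊛ fromℕ a                  ∎
  where
  open ≡-Reasoning
  q = + a ℚ./ suc b

length-filterᵇ : (p : A → Bool) (xs : List A) → fromℕ (length (filterᵇ p xs)) ≡ sumL xs (𝟙ᵇ ∘ p)
length-filterᵇ p xs = trans (length-sumL (filterᵇ p xs))
  (trans (sumL-filterᵇ p xs (λ _ → 1ℚ)) (sumL-cong xs (λ a → ℚₚ.*-identityʳ (𝟙ᵇ (p a)))))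

module _ {n : ℕ} {S : Str n} (a : Acyclic S) where

  -- As a count of edge names, the degree changes by a plain rearrangement of the sum when an edge
  -- is linked, cut or turned. Acyclicity keeps the parent edge of u apart from its child edges.
  degree-inc : ∀ u → sumL (allFin n) (λ z → 𝟙 (inc? S z u)) ≡ fromℕ (degree S u)
  degree-inc u = begin
    sumL (allFin n) (λ z → 𝟙 (inc? S z u))
      ≡⟨ sumL-cong (allFin n) split ⟩
    sumL (allFin n) (λ z → 𝟙 (z Fin.≟ u) ⊛ fromℕ (parentCount (S z)) ⊕ 𝟙 (child? S u z))
      ≡⟨ sumL-⊕ (allFin n) _ _ ⟩
    sumL (allFin n) (λ z → 𝟙 (z Fin.≟ u) ⊛ fromℕ (parentCount (S z))) ⊕ sumL (allFin n) (λ z → 𝟙 (child? S u z))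
      ≡⟨ cong₂ _⊕_ (∑-δ (finFinite n) u (λ z → fromℕ (parentCount (S z)))) (sym (length-filterᵇ (does ∘ child? S u) (allFin n))) ⟩
    fromℕ (parentCount (S u)) ⊕ fromℕ (length (kids S u))
      ≡⟨ fromℕ-homo-+ (parentCount (S u)) (length (kids S u)) ⟨
    fromℕ (degree S u) ∎
    where
    open ≡-Reasoning
    split : ∀ z → 𝟙 (inc? S z u) ≡ 𝟙 (z Fin.≟ u) ⊛ fromℕ (parentCount (S z)) ⊕ 𝟙 (child? S u z)
    split z = go (S z) refl
      where
      go : ∀ m → S z ≡ m → 𝟙 (inc? S z u) ≡ 𝟙 (z Fin.≟ u) ⊛ fromℕ (parentCount m) ⊕ 𝟙 (Maybeₚ.≡-dec Fin._≟_ m (just u))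
      go nothing e = trans (𝟙-no (inc? S z u) (λ (_ , e′ , _) → just≢nothing e′ e))
        (sym (trans (ℚₚ.+-identityʳ _) (ℚₚ.*-zeroʳ (𝟙 (z Fin.≟ u)))))
      go (just q) e = trans (𝟙-cong (inc? S z u) ((z Fin.≟ u) ⊎-dec (q Fin.≟ u))
          (λ (q′ , e′ , d) → subst (λ q → z ≡ u ⊎ q ≡ u) (just-injective (trans (sym e′) e)) d) (λ d → q , e , d)) disjoint
        where
        disjoint : 𝟙 ((z Fin.≟ u) ⊎-dec (q Fin.≟ u)) ≡ 𝟙 (z Fin.≟ u) ⊛ 1ℚ ⊕ 𝟙 (q Fin.≟ u)
        disjoint with z Fin.≟ u | q Fin.≟ u
        ... | yes refl | yes refl = contradiction (depth-< a e) (ℕₚ.<-irrefl refl)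
        ... | yes _ | no _ = refl
        ... | no _ | yes _ = refl
        ... | no _ | no _ = refl

  module _ {κ : ℕ} {x : Vec (Fin κ) n} (pr : Proper S x) where

    -- In a proper colouring each colour is either free at u or carried by exactly one edge at u;
    -- sum over the colours. The additive form avoids truncated subtraction.
    free-count-ℚ : ∀ u → sumL (allFin κ) (λ γ → 𝟙 (free? S x u γ)) ⊕ fromℕ (degree S u) ≡ fromℕ κ
    free-count-ℚ u = begin
      sumL (allFin κ) (λ γ → 𝟙 (free? S x u γ)) ⊕ fromℕ (degree S u)
        ≡⟨ cong (sumL (allFin κ) (λ γ → 𝟙 (free? S x u γ)) ⊕_) used ⟨
      sumL (allFin κ) (λ γ → 𝟙 (free? S x u γ)) ⊕ sumL (allFin κ) (λ γ → hits γ)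
        ≡⟨ sumL-⊕ (allFin κ) _ _ ⟨
      sumL (allFin κ) (λ γ → 𝟙 (free? S x u γ) ⊕ hits γ)
        ≡⟨ sumL-cong (allFin κ) one ⟩
      sumL (allFin κ) (λ γ → 1ℚ)
        ≡⟨ length-sumL (allFin κ) ⟨
      fromℕ (length (allFin κ))
        ≡⟨ cong fromℕ (length-allFin κ) ⟩
      fromℕ κ ∎
      where
      open ≡-Reasoning
      hit? : ∀ γ z → Dec (Inc S z u × γ ≡ lookup x z)
      hit? γ z = inc? S z u ×-dec (γ Fin.≟ lookup x z)
      hits : Fin κ → ℚ
      hits γ = sumL (allFin n) (λ z → 𝟙 (hit? γ z) ⊛ 1ℚ)
      used : sumL (allFin κ) hits ≡ fromℕ (degree S u)
      used = trans (sumL-swap (allFin κ) (allFin n) _)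
        (trans (sumL-cong (allFin n) (λ z → trans (sumL-cong (allFin κ) (λ γ → trans (ℚₚ.*-identityʳ _) (𝟙-× (inc? S z u) (γ Fin.≟ lookup x z))))
                 (trans (sumL-⊛ (allFin κ) (𝟙 (inc? S z u)) (λ γ → 𝟙 (γ Fin.≟ lookup x z)))
                        (trans (cong (𝟙 (inc? S z u) ⊛_) (enum-once (finFinite κ) (lookup x z))) (ℚₚ.*-identityʳ _)))))
               (degree-inc u))
      one : ∀ γ → 𝟙 (free? S x u γ) ⊕ hits γ ≡ 1ℚ
      one γ with free? S x u γ
      ... | yes fr = trans (cong (1ℚ ⊕_) (∑-none (finFinite n) (hit? γ) (λ _ → 1ℚ) (λ z (i , e) → fr z i (sym e)))) (ℚₚ.+-identityʳ 1ℚ)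
      ... | no ¬fr with Finₚ.any? (hit? γ)
      ...   | yes (z , i , e) = trans (ℚₚ.+-identityˡ _) (∑-unique (finFinite n) (hit? γ) (λ _ → 1ℚ) (i , e) uniq)
        where
        uniq : ∀ z′ → Inc S z′ u × γ ≡ lookup x z′ → z′ ≡ z
        uniq z′ (i′ , e′) with z′ Fin.≟ z
        ... | yes h = h
        ... | no ne = contradiction (trans (sym e′) e) (pr u z′ z ne i′ i)
      ...   | no none = contradiction (λ z i e → none (z , i , sym e)) ¬fr

    avail-count : ∀ u → length (avail (st S x) u) + degree S u ≡ κ
    avail-count u = fromℕ-injective (trans (fromℕ-homo-+ (length (avail (st S x) u)) (degree S u))
      (trans (cong (_⊕ fromℕ (degree S u)) (trans (cong (fromℕ ∘ length) (avail-st S x u)) (length-filterᵇ (does ∘ free? S x u) (allFin κ))))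
             (free-count-ℚ u)))

    avail-length : ∀ u → length (avail (st S x) u) ≡ κ ∸ degree S u
    avail-length u = trans (sym (ℕₚ.m+n∸n≡m (length (avail (st S x) u)) (degree S u))) (cong (_∸ degree S u) (avail-count u))

    free-count : ∀ u → sumL (allFin κ) (λ γ → 𝟙 (free? S x u γ)) ≡ fromℕ (κ ∸ degree S u)
    free-count u = trans (sym (length-filterᵇ (does ∘ free? S x u) (allFin κ)))
      (cong fromℕ (trans (cong length (sym (avail-st S x u))) (avail-length u)))

-- The map (x, β) ↦ (x with β at r, old coordinate at r) is an involution on pairs. It allows the
-- colour drawn by an insertion to be identified with the dummy coordinate of r.
∑-update : ∀ κ n (r : Fin n) (F : Vec (Fin κ) n → ℚ) →
  ∑ (vecFinite κ n) (λ x → sumL (allFin κ) (λ β → F (x [ r ]≔ β))) ≡ fromℕ κ ⊛ ∑ (vecFinite κ n) F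
∑-update κ n r F = begin
  ∑ V (λ x → ∑ C (λ β → F (x [ r ]≔ β)))                     ≡⟨ ∑-× V C (λ (x , β) → F (x [ r ]≔ β)) ⟨
  ∑ (V ×-finite C) (λ (x , β) → F (x [ r ]≔ β))              ≡⟨ sumL-cong (enum (V ×-finite C)) (λ _ → ℚₚ.*-identityˡ _) ⟨
  ∑ (V ×-finite C) (λ (x , β) → 1ℚ ⊛ F (x [ r ]≔ β))         ≡⟨ reindex (V ×-finite C) (V ×-finite C) (λ _ → yes tt) (λ _ → yes tt) φ φ (λ a _ → tt , φφ a) (λ a _ → tt , φφ a) (λ (x , β) → F (x [ r ]≔ β)) ⟩
  ∑ (V ×-finite C) (λ (x , β) → 1ℚ ⊛ F ((x [ r ]≔ β) [ r ]≔ lookup x r)) ≡⟨ sumL-cong (enum (V ×-finite C)) (λ (x , β) → trans (ℚₚ.*-identityˡ _) (cong F (back x β))) ⟩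
  ∑ (V ×-finite C) (λ (x , β) → F x)                         ≡⟨ ∑-× V C (λ (x , β) → F x) ⟩
  ∑ V (λ x → ∑ C (λ β → F x))                                ≡⟨ sumL-cong (enum V) (λ x → trans (sumL-const (allFin κ) (F x)) (cong (λ k → fromℕ k ⊛ F x) (length-allFin κ))) ⟩
  ∑ V (λ x → fromℕ κ ⊛ F x)                                  ≡⟨ sumL-⊛ (enum V) (fromℕ κ) F ⟩
  fromℕ κ ⊛ ∑ V F                                            ∎
  where
  open ≡-Reasoning
  V = vecFinite κ n
  C = finFinite κ
  φ : Vec (Fin κ) n × Fin κ → Vec (Fin κ) n × Fin κ
  φ (x , β) = x [ r ]≔ β , lookup x r
  back : ∀ x β → (x [ r ]≔ β) [ r ]≔ lookup x r ≡ x
  back x β = trans (Vecₚ.[]≔-idempotent x r) (Vecₚ.[]≔-lookup x r)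
  φφ : ∀ a → φ (φ a) ≡ a
  φφ (x , β) = cong₂ _,_ (back x β) (Vecₚ.lookup∘update r x β)

Ext : ∀ {n κ} → (State n κ → ℚ) → Set
Ext g = ∀ {s s′} → s ≗ s′ → g s ≡ g s′

Ext₂ : ∀ {n κ} → (State n κ → State n κ → ℚ) → Set
Ext₂ G = ∀ {s s′ t t′} → s ≗ s′ → t ≗ t′ → G s t ≡ G s′ t′

sumL-cartesianProduct : (xs : List A) (ys : List B) (f : A × B → ℚ) →
  sumL (List.cartesianProduct xs ys) f ≡ sumL xs (λ a → sumL ys (λ b → f (a , b)))
sumL-cartesianProduct [] ys f = refl
sumL-cartesianProduct (x ∷ xs) ys f = trans (sumL-++ (map (x ,_) ys) _ f)
  (cong₂ _⊕_ (sumL-map (x ,_) ys f) (sumL-cartesianProduct xs ys f))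

frac-inv : ∀ a {b} → 0 < b → frac a b ≡ inv b ⊛ fromℕ a
frac-inv a {suc b} _ = /-inv a b

-- For the empty list both sides vanish, so a deletion that leaves r without children needs no
-- separate treatment.
mean-sum : (xs : List A) (f : A → ℚ) → fromℕ (length xs) ⊛ (inv (length xs) ⊛ sumL xs f) ≡ sumL xs f
mean-sum [] f = refl
mean-sum (x ∷ xs) f = trans (lem (fromℕ k) (inv k) (sumL (x ∷ xs) f))
  (trans (cong (_⊛ sumL (x ∷ xs) f) (inv-fromℕ {k} (ℕ.s≤s ℕ.z≤n))) (ℚₚ.*-identityˡ _))
  where
  k = suc (length xs)
  lem : ∀ a b c → a ⊛ (b ⊛ c) ≡ (b ⊛ a) ⊛ c
  lem = solve-∀ ℚ-ring

-- Recourse and Hamming distance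

module _ {n κ : ℕ} where

  hamming : Vec (Fin κ) n → Vec (Fin κ) n → ℚ
  hamming x y = sumL (allFin n) (λ z → 𝟙 (¬? (lookup x z Fin.≟ lookup y z)))

  module _ (step : State n κ → Upd n → Dist (State n κ)) (valid : State n κ → Upd n → Set) where

    colorOf-st : ∀ S (x : Vec (Fin κ) n) {u v γ} → colorOf step valid (st S x) u v ≡ just γ →
      (S u ≡ just v × lookup x u ≡ γ) ⊎ (S v ≡ just u × lookup x v ≡ γ)
    colorOf-st S x {u} {v} e with S u
    colorOf-st S x {u} {v} e | nothing with S v
    colorOf-st S x {u} {v} e | nothing | just q with q Fin.≟ u
    ... | yes refl with refl ← e = inj₂ (refl , refl)
    colorOf-st S x {u} {v} e | just p with p Fin.≟ v
    ... | yes refl with refl ← e = inj₁ (refl , refl)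
    ... | no _ with S v
    ...   | just q with q Fin.≟ u
    ...     | yes refl with refl ← e = inj₂ (refl , refl)

    changed-true : ∀ m m′ → changed step valid m m′ ≡ true → ∃[ γ ] ∃[ δ ] (m ≡ just γ × m′ ≡ just δ × γ ≢ δ)
    changed-true (just γ) (just δ) e with γ Fin.≟ δ
    ... | no γ≢δ = γ , δ , refl , refl , γ≢δ

    module _ {S S′ R : Str n} (a : Acyclic R) (sub : ∀ {z q} → S z ≡ just q → R z ≡ just q)
             (sub′ : ∀ {z q} → S′ z ≡ just q → R z ≡ just q) where

      changed-edge : ∀ x y {u v} → changed step valid (colorOf step valid (st S x) u v) (colorOf step valid (st S′ y) u v) ≡ true →
        (R u ≡ just v × lookup x u ≢ lookup y u) ⊎ (R v ≡ just u × lookup x v ≢ lookup y v)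
      changed-edge x y {u} {v} e with changed-true _ _ e
      ... | γ , δ , eγ , eδ , γ≢δ with colorOf-st S x eγ | colorOf-st S′ y eδ
      ...   | inj₁ (c , h) | inj₁ (_ , h′) = inj₁ (sub c , λ e → γ≢δ (trans (sym h) (trans e h′)))
      ...   | inj₂ (c , h) | inj₂ (_ , h′) = inj₂ (sub c , λ e → γ≢δ (trans (sym h) (trans e h′)))
      ...   | inj₁ (c , _) | inj₂ (c′ , _) = contradiction (depth-< a (sub c)) (ℕₚ.<-asym (depth-< a (sub′ c′)))
      ...   | inj₂ (c , _) | inj₁ (c′ , _) = contradiction (depth-< a (sub c)) (ℕₚ.<-asym (depth-< a (sub′ c′)))

      -- A pair whose colour changed is an edge of both shapes, and their common superforest R
      -- forces both to name it by the same endpoint. Charging the pair to that endpoint charges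
      -- every vertex at most once: it has one parent, and only the increasing order of each pair is
      -- counted.
      recourse-hamming : ∀ x y → fromℕ (recourse step valid (st S x) (st S′ y)) ≼ hamming x y
      recourse-hamming x y = begin
        fromℕ (recourse step valid (st S x) (st S′ y))
          ≡⟨ length-filterᵇ ch (List.cartesianProduct (allFin n) (allFin n)) ⟩
        sumL (List.cartesianProduct (allFin n) (allFin n)) (𝟙ᵇ ∘ ch)
          ≡⟨ sumL-cartesianProduct (allFin n) (allFin n) (𝟙ᵇ ∘ ch) ⟩
        sumL (allFin n) (λ u → sumL (allFin n) (λ v → 𝟙ᵇ (ch (u , v))))
          ≤⟨ sumL-mono (allFin n) (λ u → sumL-mono (allFin n) (λ v → point u v)) ⟩
        sumL (allFin n) (λ u → sumL (allFin n) (λ v → edge u v ⊕ edge′ u v))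
          ≡⟨ trans (sumL-cong (allFin n) (λ u → sumL-⊕ (allFin n) (edge u) (edge′ u))) (sumL-⊕ (allFin n) _ _) ⟩
        sumL (allFin n) (λ u → sumL (allFin n) (edge u)) ⊕ sumL (allFin n) (λ u → sumL (allFin n) (edge′ u))
          ≡⟨ cong (sumL (allFin n) (λ u → sumL (allFin n) (edge u)) ⊕_) (sumL-swap (allFin n) (allFin n) edge′) ⟩
        sumL (allFin n) (λ u → sumL (allFin n) (edge u)) ⊕ sumL (allFin n) (λ u → sumL (allFin n) (λ v → edge′ v u))
          ≡⟨ sumL-⊕ (allFin n) _ _ ⟨
        sumL (allFin n) (λ u → sumL (allFin n) (edge u) ⊕ sumL (allFin n) (λ v → edge′ v u))
          ≤⟨ sumL-mono (allFin n) row ⟩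
        hamming x y ∎
        where
        open ℚₚ.≤-Reasoning
        ch : Fin n × Fin n → Bool
        ch uv = (toℕ (proj₁ uv) ℕ.<ᵇ toℕ (proj₂ uv)) ∧
          changed step valid (colorOf step valid (st S x) (proj₁ uv) (proj₂ uv)) (colorOf step valid (st S′ y) (proj₁ uv) (proj₂ uv))
        diff? : ∀ z → Dec (lookup x z ≢ lookup y z)
        diff? z = ¬? (lookup x z Fin.≟ lookup y z)
        edge? : ∀ u v → Dec (R u ≡ just v × toℕ u < toℕ v × lookup x u ≢ lookup y u)
        edge? u v = child? R v u ×-dec (toℕ u ℕ.<? toℕ v) ×-dec diff? u
        edge′? : ∀ u v → Dec (R v ≡ just u × toℕ u < toℕ v × lookup x v ≢ lookup y v)
        edge′? u v = child? R u v ×-dec (toℕ u ℕ.<? toℕ v) ×-dec diff? v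
        edge edge′ : Fin n → Fin n → ℚ
        edge u v = 𝟙 (edge? u v)
        edge′ u v = 𝟙 (edge′? u v)
        point : ∀ u v → 𝟙ᵇ (ch (u , v)) ≼ edge u v ⊕ edge′ u v
        point u v = go (toℕ u ℕ.<ᵇ toℕ v) _ refl refl
          where
          go : ∀ b c → (toℕ u ℕ.<ᵇ toℕ v) ≡ b → changed step valid (colorOf step valid (st S x) u v) (colorOf step valid (st S′ y) u v) ≡ c →
            𝟙ᵇ (b ∧ c) ≼ edge u v ⊕ edge′ u v
          go false _ _ _ = ℚₚ.+-mono-≤ (𝟙-nonneg (edge? u v)) (𝟙-nonneg (edge′? u v))
          go true false _ _ = ℚₚ.+-mono-≤ (𝟙-nonneg (edge? u v)) (𝟙-nonneg (edge′? u v))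
          go true true lt eq with ℕₚ.<ᵇ⇒< (toℕ u) (toℕ v) (subst T (sym lt) tt) | changed-edge x y eq
          ... | u<v | inj₁ (c , d) = ℚₚ.+-mono-≤ (ℚₚ.≤-reflexive (sym (𝟙-yes (edge? u v) (c , u<v , d)))) (𝟙-nonneg (edge′? u v))
          ... | u<v | inj₂ (c , d) = ℚₚ.+-mono-≤ (𝟙-nonneg (edge? u v)) (ℚₚ.≤-reflexive (sym (𝟙-yes (edge′? u v) (c , u<v , d))))
        child-once : ∀ u → sumL (allFin n) (λ v → 𝟙 (child? R v u)) ≼ 1ℚ
        child-once u with R u in e
        ... | nothing = ℚₚ.≤-trans (ℚₚ.≤-reflexive (sumL-zero (allFin n))) 0≤1
        ... | just q = ℚₚ.≤-reflexive (trans (sumL-cong (allFin n) (λ v → 𝟙-cong (q Fin.≟ v) (v Fin.≟ q) sym sym)) (enum-once (finFinite n) q))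
        row : ∀ u → sumL (allFin n) (edge u) ⊕ sumL (allFin n) (λ v → edge′ v u) ≼ 𝟙 (diff? u)
        row u = begin
          sumL (allFin n) (edge u) ⊕ sumL (allFin n) (λ v → edge′ v u)
            ≡⟨ sumL-⊕ (allFin n) (edge u) (λ v → edge′ v u) ⟨
          sumL (allFin n) (λ v → edge u v ⊕ edge′ v u)
            ≤⟨ sumL-mono (allFin n) cell ⟩
          sumL (allFin n) (λ v → 𝟙 (diff? u) ⊛ 𝟙 (child? R v u))
            ≡⟨ sumL-⊛ (allFin n) (𝟙 (diff? u)) (λ v → 𝟙 (child? R v u)) ⟩
          𝟙 (diff? u) ⊛ sumL (allFin n) (λ v → 𝟙 (child? R v u))
            ≤⟨ *-mono-≼ˡ (𝟙-nonneg (diff? u)) (child-once u) ⟩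
          𝟙 (diff? u) ⊛ 1ℚ
            ≡⟨ ℚₚ.*-identityʳ _ ⟩
          𝟙 (diff? u) ∎
          where
          both? : ∀ v → Dec (lookup x u ≢ lookup y u × R u ≡ just v)
          both? v = diff? u ×-dec child? R v u
          cell : ∀ v → edge u v ⊕ edge′ v u ≼ 𝟙 (diff? u) ⊛ 𝟙 (child? R v u)
          cell v with ℕₚ.<-cmp (toℕ u) (toℕ v)
          ... | tri< u<v _ v≮u = begin
            edge u v ⊕ edge′ v u ≡⟨ cong (edge u v ⊕_) (𝟙-no (edge′? v u) (λ (_ , l , _) → v≮u l)) ⟩
            edge u v ⊕ 0ℚ        ≡⟨ ℚₚ.+-identityʳ _ ⟩
            edge u v             ≤⟨ 𝟙-mono (edge? u v) (both? v) (λ (c , _ , d) → d , c) ⟩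
            𝟙 (both? v)          ≡⟨ 𝟙-× (diff? u) (child? R v u) ⟩
            𝟙 (diff? u) ⊛ 𝟙 (child? R v u) ∎
          ... | tri≈ u≮v _ v≮u = begin
            edge u v ⊕ edge′ v u ≡⟨ cong₂ _⊕_ (𝟙-no (edge? u v) (λ (_ , l , _) → u≮v l)) (𝟙-no (edge′? v u) (λ (_ , l , _) → v≮u l)) ⟩
            0ℚ ⊕ 0ℚ              ≤⟨ 𝟙-nonneg (both? v) ⟩
            𝟙 (both? v)          ≡⟨ 𝟙-× (diff? u) (child? R v u) ⟩
            𝟙 (diff? u) ⊛ 𝟙 (child? R v u) ∎
          ... | tri> u≮v _ v<u = begin
            edge u v ⊕ edge′ v u ≡⟨ cong (_⊕ edge′ v u) (𝟙-no (edge? u v) (λ (_ , l , _) → u≮v l)) ⟩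
            0ℚ ⊕ edge′ v u       ≡⟨ ℚₚ.+-identityˡ _ ⟩
            edge′ v u            ≤⟨ 𝟙-mono (edge′? v u) (both? v) (λ (c , _ , d) → d , c) ⟩
            𝟙 (both? v)          ≡⟨ 𝟙-× (diff? u) (child? R v u) ⟩
            𝟙 (diff? u) ⊛ 𝟙 (child? R v u) ∎

-- One insertion or deletion applied to a uniform colouring

module LinkStep {n κ : ℕ} {S⁻ S⁺ : Str n} {p r : Fin n} (L : Link S⁻ S⁺ p r)
  (dp : degree S⁻ p < κ) (dr : degree S⁻ r < κ) where
  open Link L

  V : Finite (Vec (Fin κ) n)
  V = vecFinite κ n

  -- The first two are the numbers of free colours at p and r in a proper colouring of `S⁻`. As r is
  -- a root there, aᵣ + ℓ = κ, which turns the stopping probability of a deletion into aᵣ/κ.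
  aₚ aᵣ ℓ : ℕ
  aₚ = κ ∸ degree S⁻ p
  aᵣ = κ ∸ degree S⁻ r
  ℓ = length (kids S⁻ r)

  degree-r : degree S⁻ r ≡ ℓ
  degree-r = cong (λ m → parentCount m + ℓ) root⁻

  aᵣ+ℓ : aᵣ + ℓ ≡ κ
  aᵣ+ℓ = trans (cong (_+_ aᵣ) (sym degree-r)) (ℕₚ.m∸n+n≡m (ℕₚ.<⇒≤ dr))

  0<aₚ : 0 < aₚ
  0<aₚ = ℕₚ.m<n⇒0<n∸m dp

  0<aᵣ : 0 < aᵣ
  0<aᵣ = ℕₚ.m<n⇒0<n∸m dr

  0<κ : 0 < κ
  0<κ = ℕₚ.≤-<-trans ℕ.z≤n dp

  -- The colouring from which an insertion that repaired the clash at w produced x, and equally the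
  -- one that a deletion choosing the child w makes of x.
  switch : Fin n → Vec (Fin κ) n → Vec (Fin κ) n
  switch w x = kempe acyclic⁺ w (lookup x w) (lookup x r) x

  free⁺⇒free⁻ : ∀ {y : Vec (Fin κ) n} {α} → Free S⁺ y r α → Free S⁻ y r α
  free⁺⇒free⁻ fr z i = fr z (lift-Inc i)

  free⁻⇒free⁺ : ∀ {y : Vec (Fin κ) n} {w α} → S⁻ w ≡ just r → lookup y w ≡ lookup y r → Free S⁻ y r α → Free S⁺ y r α
  free⁻⇒free⁺ wr e fr z i h with z Fin.≟ r
  ... | yes refl = fr _ (r , wr , inj₂ refl) (trans e h)
  ... | no z≢r = fr z (lower-Inc z≢r i) h

  -- The new edge uses up no further colour at r, since w has that colour already. So aᵣ choices of
  -- α remain, not aᵣ - 1.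
  clash-free-count : ∀ {y : Vec (Fin κ) n} {w} → Proper S⁻ y → S⁻ w ≡ just r → lookup y w ≡ lookup y r →
    sumL (allFin κ) (λ α → 𝟙 (free? S⁺ y r α)) ≡ fromℕ aᵣ
  clash-free-count {y} pr wr e = trans
    (sumL-cong (allFin κ) (λ α → 𝟙-cong (free? S⁺ y r α) (free? S⁻ y r α) (free⁺⇒free⁻ {y} {α}) (free⁻⇒free⁺ {y} wr e)))
    (free-count acyclic⁻ pr r)

  clash-avail-length : ∀ {y : Vec (Fin κ) n} {w} → Proper S⁻ y → S⁻ w ≡ just r → lookup y w ≡ lookup y r →
    length (avail (st S⁺ y) r) ≡ aᵣ
  clash-avail-length {y} pr wr e = fromℕ-injective (trans (cong (fromℕ ∘ length) (avail-st S⁺ y r))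
    (trans (length-filterᵇ (does ∘ free? S⁺ y r) (allFin κ)) (clash-free-count {y} pr wr e)))

  half-update : ∀ {x : Vec (Fin κ) n} {β} → Proper S⁻ x → Free S⁻ x p β → Half (x [ r ]≔ β)
  half-update {x} {β} pr fr = (λ u z z′ ne i i′ e → pr u z z′ ne i i′ (trans (sym (off i)) (trans e (off i′)))) ,
    λ z i e → fr z i (trans (sym (off i)) (trans e (Vecₚ.lookup∘update r x β)))
    where
    off : ∀ {z u} → Inc S⁻ z u → lookup (x [ r ]≔ β) z ≡ lookup x z
    off i = Vecₚ.lookup∘update′ (Inc⁻≢r i) x β

  half-update⁻ : ∀ {x : Vec (Fin κ) n} {β} → Half (x [ r ]≔ β) → Proper S⁻ x × Free S⁻ x p β
  half-update⁻ {x} {β} (pr , fr) = (λ u z z′ ne i i′ e → pr u z z′ ne i i′ (trans (off i) (trans e (sym (off i′))))) ,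
    λ z i e → fr z i (trans (off i) (trans e (sym (Vecₚ.lookup∘update r x β))))
    where
    off : ∀ {z u} → Inc S⁻ z u → lookup (x [ r ]≔ β) z ≡ lookup x z
    off i = Vecₚ.lookup∘update′ (Inc⁻≢r i) x β

  clashing? : ∀ (y : Vec (Fin κ) n) w → Dec (S⁻ w ≡ just r × lookup y w ≡ lookup y r)
  clashing? y w = child? S⁻ r w ×-dec (lookup y w Fin.≟ lookup y r)

  clashing-unique : ∀ {y : Vec (Fin κ) n} {w} → Half y → S⁻ w ≡ just r → lookup y w ≡ lookup y r →
    ∀ w′ → S⁻ w′ ≡ just r × lookup y w′ ≡ lookup y r → w′ ≡ w
  clashing-unique {y} {w} (pr , _) c e w′ (c′ , e′) with w′ Fin.≟ w
  ... | yes h = h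
  ... | no ne = contradiction (trans e′ (sym e)) (pr r w′ w ne (r , c′ , inj₂ refl) (r , c , inj₂ refl))

  clashing-improper : ∀ {y : Vec (Fin κ) n} {w} → S⁻ w ≡ just r → lookup y w ≡ lookup y r → ¬ Proper S⁺ y
  clashing-improper {w = w} c e pr = pr r w r (λ { refl → just≢nothing c root⁻ }) (r , lift c , inj₂ refl) (p , edge⁺ , inj₁ refl) e

  -- Either y is proper with (p, r) or exactly one child of r clashes, so exactly one indicator on
  -- the left is 1. Writing this case distinction as a sum allows it to be exchanged with the sum
  -- over y.
  half-split : ∀ (y : Vec (Fin κ) n) → Half y → (g₀ : ℚ) (g : Fin n → ℚ) (h : ℚ) →
    (Proper S⁺ y → g₀ ≡ h) → (∀ w → S⁻ w ≡ just r → lookup y w ≡ lookup y r → g w ≡ h) →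
    𝟙 (proper? S⁺ y) ⊛ g₀ ⊕ sumL (allFin n) (λ w → 𝟙 (clashing? y w) ⊛ g w) ≡ h
  half-split y hy g₀ g h e₀ e with Finₚ.any? (clashing? y)
  ... | yes (w , c , eq) = trans (cong₂ _⊕_ (trans (cong (_⊛ g₀) (𝟙-no (proper? S⁺ y) (clashing-improper {y} c eq))) (ℚₚ.*-zeroˡ g₀))
          (∑-unique (finFinite n) (clashing? y) g (c , eq) (clashing-unique {y} hy c eq)))
          (trans (ℚₚ.+-identityˡ (g w)) (e w c eq))
  ... | no none = trans (cong₂ _⊕_ (trans (cong (_⊛ g₀) (𝟙-yes (proper? S⁺ y) pr)) (ℚₚ.*-identityˡ g₀))
          (∑-none (finFinite n) (clashing? y) g (λ w c → none (w , c))))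
          (trans (ℚₚ.+-identityʳ g₀) (e₀ pr))
    where
    pr : Proper S⁺ y
    pr = half-proper {y = y} hy (λ w c eq → none (w , c , eq))

  -- Among the κ values of the dummy at r exactly aₚ are free at p, and g, which sees only the state
  -- on `S⁻`, does not notice the dummy.
  half-sum : (g : State n κ → ℚ) → Ext g → fromℕ κ ⊛ ∑ V (λ y → 𝟙 (half? y) ⊛ g (st S⁻ y)) ≡ fromℕ aₚ ⊛ ∑ V (λ x → 𝟙 (proper? S⁻ x) ⊛ g (st S⁻ x))
  half-sum g ext = begin
    fromℕ κ ⊛ ∑ V (λ y → 𝟙 (half? y) ⊛ g (st S⁻ y))
      ≡⟨ ∑-update κ n r (λ y → 𝟙 (half? y) ⊛ g (st S⁻ y)) ⟨
    ∑ V (λ x → sumL (allFin κ) (λ β → 𝟙 (half? (x [ r ]≔ β)) ⊛ g (st S⁻ (x [ r ]≔ β))))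
      ≡⟨ sumL-cong (enum V) row ⟩
    ∑ V (λ x → fromℕ aₚ ⊛ (𝟙 (proper? S⁻ x) ⊛ g (st S⁻ x)))
      ≡⟨ sumL-⊛ (enum V) (fromℕ aₚ) _ ⟩
    fromℕ aₚ ⊛ ∑ V (λ x → 𝟙 (proper? S⁻ x) ⊛ g (st S⁻ x)) ∎
    where
    open ≡-Reasoning
    row : ∀ x → sumL (allFin κ) (λ β → 𝟙 (half? (x [ r ]≔ β)) ⊛ g (st S⁻ (x [ r ]≔ β))) ≡ fromℕ aₚ ⊛ (𝟙 (proper? S⁻ x) ⊛ g (st S⁻ x))
    row x = begin
      sumL (allFin κ) (λ β → 𝟙 (half? (x [ r ]≔ β)) ⊛ g (st S⁻ (x [ r ]≔ β)))
        ≡⟨ sumL-cong (allFin κ) (λ β → trans (𝟙-guard (half? (x [ r ]≔ β)) (proper? S⁻ x ×-dec free? S⁻ x p β) _ (g (st S⁻ x))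
             (half-update⁻ {x} {β}) (λ (a , b) → half-update {x} {β} a b) (λ _ → ext (st-update-root S⁻ x β root⁻)))
             (trans (cong (_⊛ g (st S⁻ x)) (𝟙-× (proper? S⁻ x) (free? S⁻ x p β))) (rot (𝟙 (proper? S⁻ x)) (𝟙 (free? S⁻ x p β)) (g (st S⁻ x))))) ⟩
      sumL (allFin κ) (λ β → (𝟙 (proper? S⁻ x) ⊛ g (st S⁻ x)) ⊛ 𝟙 (free? S⁻ x p β))
        ≡⟨ sumL-⊛ (allFin κ) (𝟙 (proper? S⁻ x) ⊛ g (st S⁻ x)) (λ β → 𝟙 (free? S⁻ x p β)) ⟩
      (𝟙 (proper? S⁻ x) ⊛ g (st S⁻ x)) ⊛ sumL (allFin κ) (λ β → 𝟙 (free? S⁻ x p β))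
        ≡⟨ ℚₚ.*-assoc (𝟙 (proper? S⁻ x)) (g (st S⁻ x)) _ ⟩
      𝟙 (proper? S⁻ x) ⊛ (g (st S⁻ x) ⊛ sumL (allFin κ) (λ β → 𝟙 (free? S⁻ x p β)))
        ≡⟨ 𝟙-congʳ (proper? S⁻ x) (λ pr → cong (g (st S⁻ x) ⊛_) (free-count acyclic⁻ pr p)) ⟩
      𝟙 (proper? S⁻ x) ⊛ (g (st S⁻ x) ⊛ fromℕ aₚ)
        ≡⟨ rot′ (𝟙 (proper? S⁻ x)) (g (st S⁻ x)) (fromℕ aₚ) ⟩
      fromℕ aₚ ⊛ (𝟙 (proper? S⁻ x) ⊛ g (st S⁻ x)) ∎
      where
      rot : ∀ a b c → a ⊛ b ⊛ c ≡ (a ⊛ c) ⊛ b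
      rot = solve-∀ ℚ-ring
      rot′ : ∀ a b c → a ⊛ (b ⊛ c) ≡ c ⊛ (a ⊛ b)
      rot′ = solve-∀ ℚ-ring

  locallyProper⁺ : ∀ {y : Vec (Fin κ) n} {w} → Proper S⁻ y → S⁻ w ≡ just r → LocallyProper S⁺ y w
  locallyProper⁺ {y} {w} pr wr {u} c ne i i′ = pr u _ _ ne (lower-Inc (≢r i) i) (lower-Inc (≢r i′) i′)
    where
    open Switch {κ} wr
    ≢r : ∀ {z} → Inc S⁺ z u → z ≢ r
    ≢r (_ , e , inj₁ refl) refl = ¬chain-r c
    ≢r (_ , e , inj₂ refl) refl with refl ← just-injective (trans (sym e) edge⁺) = ¬chain-p c

  fixForbidden-link : ∀ {y : Vec (Fin κ) n} {w} α → Half y → S⁻ w ≡ just r → lookup y w ≡ lookup y r →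
    fixForbidden (set (st S⁺ y) w (just (r , α))) w (lookup y r) α ≗ st S⁺ (kempe acyclic⁺ w α (lookup y r) y)
  fixForbidden-link {y} {w} α (pr , _) wr e z = begin
    fixForbidden (set (st S⁺ y) w (just (r , α))) w (lookup y r) α z ≡⟨ fixForbidden-cong (set-recolor S⁺ y α (lift wr)) w (lookup y r) α z ⟩
    fixForbidden (st S⁺ (y [ w ]≔ α)) w (lookup y r) α z ≡⟨ fixForbidden-kempe acyclic⁺ n y w r (lookup y r) α (lift wr) e (locallyProper⁺ {y} pr wr) (ℕₚ.m≤m+n n _) z ⟩
    st S⁺ (kempe acyclic⁺ w (lookup y r) α y) z ≡⟨ cong (λ v → st S⁺ v z) (kempe-sym acyclic⁺ w (lookup y r) α y) ⟩
    st S⁺ (kempe acyclic⁺ w α (lookup y r) y) z ∎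
    where open ≡-Reasoning

  childWithColor-proper : ∀ {y : Vec (Fin κ) n} → Proper S⁺ y → childWithColor (st S⁺ y) r (lookup y r) ≡ nothing
  childWithColor-proper {y} pr with childWithColor (st S⁺ y) r (lookup y r) in eq
  ... | nothing = refl
  ... | just w = let (c , e) = childWithColor-just S⁺ y eq in
    contradiction e (pr r w r (λ { refl → p≢r (just-injective (trans (sym edge⁺) c)) }) (r , c , inj₂ refl) (p , edge⁺ , inj₁ refl))

  childWithColor-clash : ∀ {y : Vec (Fin κ) n} {w} → Half y → S⁻ w ≡ just r → lookup y w ≡ lookup y r →
    childWithColor (st S⁺ y) r (lookup y r) ≡ just w
  childWithColor-clash {y} {w} hy wr e with childWithColor (st S⁺ y) r (lookup y r) in eq
  ... | nothing = contradiction e (childWithColor-nothing S⁺ y eq (lift wr))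
  ... | just w′ = let (c , e′) = childWithColor-just S⁺ y eq in
    cong just (clashing-unique {y} hy wr e w′ (lower (λ { refl → p≢r (just-injective (trans (sym edge⁺) c)) }) c , e′))

  afterInsert : (State n κ → ℚ) → Vec (Fin κ) n → ℚ
  afterInsert g y = 𝟙 (proper? S⁺ y) ⊛ g (st S⁺ y) ⊕ sumL (allFin n) (λ w → 𝟙 (clashing? y w) ⊛
    (inv aᵣ ⊛ sumL (allFin κ) (λ α → 𝟙 (free? S⁺ y r α) ⊛ g (st S⁺ (kempe acyclic⁺ w α (lookup y r) y)))))

  insertStep-E : ∀ {g} → Ext g → ∀ y → Half y →
    E (insertStep r (lookup y r) (st S⁺ y) (childWithColor (st S⁺ y) r (lookup y r))) g ≡ afterInsert g y
  insertStep-E {g} ext y hy = sym (half-split y hy _ _ _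
    (λ pr → sym (trans (cong (λ m → E (insertStep r (lookup y r) (st S⁺ y) m) g) (childWithColor-proper {y} pr)) (E-return (st S⁺ y) g)))
    (λ w wr e → sym (clash w wr e)))
    where
    clash : ∀ w → S⁻ w ≡ just r → lookup y w ≡ lookup y r →
      E (insertStep r (lookup y r) (st S⁺ y) (childWithColor (st S⁺ y) r (lookup y r))) g ≡
      inv aᵣ ⊛ sumL (allFin κ) (λ α → 𝟙 (free? S⁺ y r α) ⊛ g (st S⁺ (kempe acyclic⁺ w α (lookup y r) y)))
    clash w wr e = begin
      E (insertStep r (lookup y r) (st S⁺ y) (childWithColor (st S⁺ y) r (lookup y r))) g
        ≡⟨ cong (λ m → E (insertStep r (lookup y r) (st S⁺ y) m) g) (childWithColor-clash {y} hy wr e) ⟩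
      E (bind (uniform (avail (st S⁺ y) r)) (λ α → return (fix α))) g
        ≡⟨ E-bind (uniform (avail (st S⁺ y) r)) (λ α → return (fix α)) g ⟩
      E (uniform (avail (st S⁺ y) r)) (λ α → E (return (fix α)) g)
        ≡⟨ E-uniform (avail (st S⁺ y) r) _ ⟩
      inv (length (avail (st S⁺ y) r)) ⊛ sumL (avail (st S⁺ y) r) (λ α → E (return (fix α)) g)
        ≡⟨ cong₂ (λ k s → inv k ⊛ s) (clash-avail-length {y} (proj₁ hy) wr e)
             (trans (cong (λ l → sumL l (λ α → E (return (fix α)) g)) (avail-st S⁺ y r)) (sumL-filterᵇ (does ∘ free? S⁺ y r) (allFin κ) _)) ⟩
      inv aᵣ ⊛ sumL (allFin κ) (λ α → 𝟙 (free? S⁺ y r α) ⊛ E (return (fix α)) g)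
        ≡⟨ cong (inv aᵣ ⊛_) (sumL-cong (allFin κ) (λ α → cong (𝟙 (free? S⁺ y r α) ⊛_)
             (trans (E-return (fix α) g) (ext (fixForbidden-link {y} α hy wr e))))) ⟩
      inv aᵣ ⊛ sumL (allFin κ) (λ α → 𝟙 (free? S⁺ y r α) ⊛ g (st S⁺ (kempe acyclic⁺ w α (lookup y r) y))) ∎
      where
      open ≡-Reasoning
      fix : Fin κ → State n κ
      fix α = fixForbidden (set (st S⁺ y) w (just (r , α))) w (lookup y r) α

  insertBranch : Vec (Fin κ) n → Fin κ → Dist (State n κ)
  insertBranch x β = insertStep r β (set (st S⁻ x) r (just (p , β))) (childWithColor (set (st S⁻ x) r (just (p , β))) r β)

  insertBranch-≈ : ∀ x β → let y = x [ r ]≔ β in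
    insertBranch x β ≈ᵈ insertStep r (lookup y r) (st S⁺ y) (childWithColor (st S⁺ y) r (lookup y r))
  insertBranch-≈ x β rewrite Vecₚ.lookup∘update r x β | childWithColor-cong (set-link L x β) r β =
    insertStep-cong (set-link L x β) r β (childWithColor (st S⁺ (x [ r ]≔ β)) r β)

  rootedInsert-E : ∀ {g} → Ext g → ∀ x → Proper S⁻ x → E (rootedInsert (st S⁻ x) p r) g ≡
    inv aₚ ⊛ sumL (allFin κ) (λ β → 𝟙 (free? S⁻ x p β) ⊛ afterInsert g (x [ r ]≔ β))
  rootedInsert-E {g} ext x pr = begin
    E (rootedInsert (st S⁻ x) p r) g
      ≡⟨ cong (λ d → E d g) (rootedInsert-unfold (st S⁻ x) p r) ⟩
    E (bind (uniform (avail (st S⁻ x) p)) (insertBranch x)) g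
      ≡⟨ E-bind (uniform (avail (st S⁻ x) p)) (insertBranch x) g ⟩
    E (uniform (avail (st S⁻ x) p)) (λ β → E (insertBranch x β) g)
      ≡⟨ E-uniform (avail (st S⁻ x) p) _ ⟩
    inv (length (avail (st S⁻ x) p)) ⊛ sumL (avail (st S⁻ x) p) (λ β → E (insertBranch x β) g)
      ≡⟨ cong₂ (λ k s → inv k ⊛ s) (avail-length acyclic⁻ {x = x} pr p)
           (trans (cong (λ l → sumL l (λ β → E (insertBranch x β) g)) (avail-st S⁻ x p)) (sumL-filterᵇ (does ∘ free? S⁻ x p) (allFin κ) _)) ⟩
    inv aₚ ⊛ sumL (allFin κ) (λ β → 𝟙 (free? S⁻ x p β) ⊛ E (insertBranch x β) g)
      ≡⟨ cong (inv aₚ ⊛_) (sumL-cong (allFin κ) (λ β → 𝟙-congʳ (free? S⁻ x p β) (λ fr →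
           trans (E-cong (insertBranch-≈ x β) (λ {s} {s′} → ext {s} {s′})) (insertStep-E ext (x [ r ]≔ β) (half-update {x} {β} pr fr))))) ⟩
    inv aₚ ⊛ sumL (allFin κ) (λ β → 𝟙 (free? S⁻ x p β) ⊛ afterInsert g (x [ r ]≔ β)) ∎
    where open ≡-Reasoning

  -- By the bijection `resolve`, clashing pairs are indexed by the colourings that their repair
  -- produces; on the right, the pair is expressed through its outcome x.
  clash-reindex : ∀ {w} → S⁻ w ≡ just r → (f : Vec (Fin κ) n × Fin κ → ℚ) →
    ∑ V (λ y → 𝟙 (half? y) ⊛ (𝟙 (lookup y w Fin.≟ lookup y r) ⊛ sumL (allFin κ) (λ α → 𝟙 (free? S⁺ y r α) ⊛ f (y , α)))) ≡
    ∑ V (λ x → 𝟙 (proper? S⁺ x) ⊛ f (switch w x , lookup x w))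
  clash-reindex {w} wr f = begin
    ∑ V (λ y → 𝟙 (half? y) ⊛ (𝟙 (lookup y w Fin.≟ lookup y r) ⊛ sumL (allFin κ) (λ α → 𝟙 (free? S⁺ y r α) ⊛ f (y , α))))
      ≡⟨ sumL-cong (enum V) inner ⟩
    ∑ V (λ y → sumL (allFin κ) (λ α → 𝟙 (clash? (y , α)) ⊛ f (y , α)))
      ≡⟨ ∑-× V (finFinite κ) (λ yα → 𝟙 (clash? yα) ⊛ f yα) ⟨
    ∑ (V ×-finite finFinite κ) (λ yα → 𝟙 (clash? yα) ⊛ f yα)
      ≡⟨ reindex (V ×-finite finFinite κ) V clash? (proper? S⁺) resolve unresolve
           (λ (y , α) c → resolve-proper (y , α) c , unresolve-resolve y α (proj₁ (proj₂ c)))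
           (λ x pr → unresolve-clash x pr , resolve-unresolve x) f ⟩
    ∑ V (λ x → 𝟙 (proper? S⁺ x) ⊛ f (switch w x , lookup x w)) ∎
    where
    open ≡-Reasoning
    open Switch {κ} wr
    inner : ∀ y → 𝟙 (half? y) ⊛ (𝟙 (lookup y w Fin.≟ lookup y r) ⊛ sumL (allFin κ) (λ α → 𝟙 (free? S⁺ y r α) ⊛ f (y , α))) ≡
      sumL (allFin κ) (λ α → 𝟙 (clash? (y , α)) ⊛ f (y , α))
    inner y = begin
      𝟙 (half? y) ⊛ (𝟙 e? ⊛ sumL (allFin κ) (λ α → 𝟙 (free? S⁺ y r α) ⊛ f (y , α)))
        ≡⟨ cong (𝟙 (half? y) ⊛_) (sumL-⊛ (allFin κ) (𝟙 e?) _) ⟨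
      𝟙 (half? y) ⊛ sumL (allFin κ) (λ α → 𝟙 e? ⊛ (𝟙 (free? S⁺ y r α) ⊛ f (y , α)))
        ≡⟨ sumL-⊛ (allFin κ) (𝟙 (half? y)) _ ⟨
      sumL (allFin κ) (λ α → 𝟙 (half? y) ⊛ (𝟙 e? ⊛ (𝟙 (free? S⁺ y r α) ⊛ f (y , α))))
        ≡⟨ sumL-cong (allFin κ) (λ α → trans (cong (𝟙 (half? y) ⊛_) (sym (𝟙-×-⊛ e? (free? S⁺ y r α) (f (y , α)))))
             (sym (𝟙-×-⊛ (half? y) (e? ×-dec free? S⁺ y r α) (f (y , α))))) ⟩
      sumL (allFin κ) (λ α → 𝟙 (clash? (y , α)) ⊛ f (y , α)) ∎
      where
      e? = lookup y w Fin.≟ lookup y r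

  -- G sees the states before and after the step: if it ignores the first, this is the law of the
  -- outcome, and with G the recourse it is the cost. Half colourings without a clash are themselves
  -- the outcome, the others are summed by outcome.
  insert-sum : ∀ {G} → Ext₂ G →
    ∑ V (λ x → 𝟙 (proper? S⁻ x) ⊛ E (rootedInsert (st S⁻ x) p r) (G (st S⁻ x))) ≡
    inv aₚ ⊛ (fromℕ κ ⊛ (∑ V (λ x → 𝟙 (proper? S⁺ x) ⊛ G (st S⁻ x) (st S⁺ x)) ⊕
      sumL (allFin n) (λ w → 𝟙 (child? S⁻ r w) ⊛ (inv aᵣ ⊛ ∑ V (λ x → 𝟙 (proper? S⁺ x) ⊛ G (st S⁻ (switch w x)) (st S⁺ x))))))
  insert-sum {G} ext = begin
    ∑ V (λ x → 𝟙 (proper? S⁻ x) ⊛ E (rootedInsert (st S⁻ x) p r) (G (st S⁻ x)))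
      ≡⟨ sumL-cong (enum V) row ⟩
    ∑ V (λ x → inv aₚ ⊛ sumL (allFin κ) (λ β → F (x [ r ]≔ β)))
      ≡⟨ sumL-⊛ (enum V) (inv aₚ) _ ⟩
    inv aₚ ⊛ ∑ V (λ x → sumL (allFin κ) (λ β → F (x [ r ]≔ β)))
      ≡⟨ cong (inv aₚ ⊛_) (∑-update κ n r F) ⟩
    inv aₚ ⊛ (fromℕ κ ⊛ ∑ V F)
      ≡⟨ cong (λ s → inv aₚ ⊛ (fromℕ κ ⊛ s)) total ⟩
    inv aₚ ⊛ (fromℕ κ ⊛ (∑ V (λ x → 𝟙 (proper? S⁺ x) ⊛ G (st S⁻ x) (st S⁺ x)) ⊕
      sumL (allFin n) (λ w → 𝟙 (child? S⁻ r w) ⊛ (inv aᵣ ⊛ ∑ V (λ x → 𝟙 (proper? S⁺ x) ⊛ G (st S⁻ (switch w x)) (st S⁺ x)))))) ∎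
    where
    open ≡-Reasoning
    F : Vec (Fin κ) n → ℚ
    F y = 𝟙 (half? y) ⊛ afterInsert (G (st S⁻ y)) y
    afterInsert-cong : ∀ {g g′ : State n κ → ℚ} y → (∀ s → g s ≡ g′ s) → afterInsert g y ≡ afterInsert g′ y
    afterInsert-cong y h = cong₂ _⊕_ (cong (𝟙 (proper? S⁺ y) ⊛_) (h _)) (sumL-cong (allFin n) (λ w →
      cong (λ s → 𝟙 (clashing? y w) ⊛ (inv aᵣ ⊛ s)) (sumL-cong (allFin κ) (λ α → cong (𝟙 (free? S⁺ y r α) ⊛_) (h _)))))
    row : ∀ x → 𝟙 (proper? S⁻ x) ⊛ E (rootedInsert (st S⁻ x) p r) (G (st S⁻ x)) ≡ inv aₚ ⊛ sumL (allFin κ) (λ β → F (x [ r ]≔ β))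
    row x = begin
      𝟙 (proper? S⁻ x) ⊛ E (rootedInsert (st S⁻ x) p r) (G (st S⁻ x))
        ≡⟨ 𝟙-congʳ (proper? S⁻ x) (rootedInsert-E (ext (λ _ → refl)) x) ⟩
      𝟙 (proper? S⁻ x) ⊛ (inv aₚ ⊛ sumL (allFin κ) (λ β → 𝟙 (free? S⁻ x p β) ⊛ afterInsert (G (st S⁻ x)) (x [ r ]≔ β)))
        ≡⟨ ⊛-swap (𝟙 (proper? S⁻ x)) (inv aₚ) _ ⟩
      inv aₚ ⊛ (𝟙 (proper? S⁻ x) ⊛ sumL (allFin κ) (λ β → 𝟙 (free? S⁻ x p β) ⊛ afterInsert (G (st S⁻ x)) (x [ r ]≔ β)))
        ≡⟨ cong (inv aₚ ⊛_) (sumL-⊛ (allFin κ) (𝟙 (proper? S⁻ x)) _) ⟨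
      inv aₚ ⊛ sumL (allFin κ) (λ β → 𝟙 (proper? S⁻ x) ⊛ (𝟙 (free? S⁻ x p β) ⊛ afterInsert (G (st S⁻ x)) (x [ r ]≔ β)))
        ≡⟨ cong (inv aₚ ⊛_) (sumL-cong (allFin κ) (λ β → trans (sym (𝟙-×-⊛ (proper? S⁻ x) (free? S⁻ x p β) _))
             (𝟙-guard (proper? S⁻ x ×-dec free? S⁻ x p β) (half? (x [ r ]≔ β)) _ _
               (λ (a , b) → half-update {x} {β} a b) (half-update⁻ {x} {β})
               (λ _ → afterInsert-cong {G (st S⁻ x)} {G (st S⁻ (x [ r ]≔ β))} (x [ r ]≔ β) (λ s → ext (λ v → sym (st-update-root S⁻ x β root⁻ v)) (λ _ → refl)))))) ⟩
      inv aₚ ⊛ sumL (allFin κ) (λ β → F (x [ r ]≔ β)) ∎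
    total : ∑ V F ≡ ∑ V (λ x → 𝟙 (proper? S⁺ x) ⊛ G (st S⁻ x) (st S⁺ x)) ⊕
      sumL (allFin n) (λ w → 𝟙 (child? S⁻ r w) ⊛ (inv aᵣ ⊛ ∑ V (λ x → 𝟙 (proper? S⁺ x) ⊛ G (st S⁻ (switch w x)) (st S⁺ x))))
    total = begin
      ∑ V F
        ≡⟨ sumL-cong (enum V) (λ y → ℚₚ.*-distribˡ-+ (𝟙 (half? y)) _ _) ⟩
      ∑ V (λ y → 𝟙 (half? y) ⊛ (𝟙 (proper? S⁺ y) ⊛ G (st S⁻ y) (st S⁺ y)) ⊕ 𝟙 (half? y) ⊛ sumL (allFin n) (λ w → 𝟙 (clashing? y w) ⊛ (inv aᵣ ⊛ U w y)))
        ≡⟨ sumL-⊕ (enum V) _ _ ⟩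
      ∑ V (λ y → 𝟙 (half? y) ⊛ (𝟙 (proper? S⁺ y) ⊛ G (st S⁻ y) (st S⁺ y))) ⊕ ∑ V (λ y → 𝟙 (half? y) ⊛ sumL (allFin n) (λ w → 𝟙 (clashing? y w) ⊛ (inv aᵣ ⊛ U w y)))
        ≡⟨ cong₂ _⊕_ (sumL-cong (enum V) unclashed) clashed ⟩
      ∑ V (λ x → 𝟙 (proper? S⁺ x) ⊛ G (st S⁻ x) (st S⁺ x)) ⊕
      sumL (allFin n) (λ w → 𝟙 (child? S⁻ r w) ⊛ (inv aᵣ ⊛ ∑ V (λ x → 𝟙 (proper? S⁺ x) ⊛ G (st S⁻ (switch w x)) (st S⁺ x)))) ∎
      where
      U : Fin n → Vec (Fin κ) n → ℚ
      U w y = sumL (allFin κ) (λ α → 𝟙 (free? S⁺ y r α) ⊛ G (st S⁻ y) (st S⁺ (kempe acyclic⁺ w α (lookup y r) y)))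
      unclashed : ∀ y → 𝟙 (half? y) ⊛ (𝟙 (proper? S⁺ y) ⊛ G (st S⁻ y) (st S⁺ y)) ≡ 𝟙 (proper? S⁺ y) ⊛ G (st S⁻ y) (st S⁺ y)
      unclashed y = trans (sym (𝟙-×-⊛ (half? y) (proper? S⁺ y) _))
        (𝟙-guard (half? y ×-dec proper? S⁺ y) (proper? S⁺ y) _ _ proj₂ (λ pr → proper-half {y = y} pr , pr) (λ _ → refl))
      regroup : ∀ h c e i t → h ⊛ (c ⊛ e ⊛ (i ⊛ t)) ≡ (c ⊛ i) ⊛ (h ⊛ (e ⊛ t))
      regroup = solve-∀ ℚ-ring
      clashed : ∑ V (λ y → 𝟙 (half? y) ⊛ sumL (allFin n) (λ w → 𝟙 (clashing? y w) ⊛ (inv aᵣ ⊛ U w y))) ≡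
        sumL (allFin n) (λ w → 𝟙 (child? S⁻ r w) ⊛ (inv aᵣ ⊛ ∑ V (λ x → 𝟙 (proper? S⁺ x) ⊛ G (st S⁻ (switch w x)) (st S⁺ x))))
      clashed = begin
        ∑ V (λ y → 𝟙 (half? y) ⊛ sumL (allFin n) (λ w → 𝟙 (clashing? y w) ⊛ (inv aᵣ ⊛ U w y)))
          ≡⟨ sumL-cong (enum V) (λ y → sumL-⊛ (allFin n) (𝟙 (half? y)) _) ⟨
        ∑ V (λ y → sumL (allFin n) (λ w → 𝟙 (half? y) ⊛ (𝟙 (clashing? y w) ⊛ (inv aᵣ ⊛ U w y))))
          ≡⟨ sumL-swap (enum V) (allFin n) _ ⟩
        sumL (allFin n) (λ w → ∑ V (λ y → 𝟙 (half? y) ⊛ (𝟙 (clashing? y w) ⊛ (inv aᵣ ⊛ U w y))))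
          ≡⟨ sumL-cong (allFin n) (λ w → sumL-cong (enum V) (λ y → trans
               (cong (λ c → 𝟙 (half? y) ⊛ (c ⊛ (inv aᵣ ⊛ U w y))) (𝟙-× (child? S⁻ r w) (lookup y w Fin.≟ lookup y r)))
               (regroup (𝟙 (half? y)) (𝟙 (child? S⁻ r w)) (𝟙 (lookup y w Fin.≟ lookup y r)) (inv aᵣ) (U w y)))) ⟩
        sumL (allFin n) (λ w → ∑ V (λ y → (𝟙 (child? S⁻ r w) ⊛ inv aᵣ) ⊛ (𝟙 (half? y) ⊛ (𝟙 (lookup y w Fin.≟ lookup y r) ⊛ U w y))))
          ≡⟨ sumL-cong (allFin n) (λ w → trans (sumL-⊛ (enum V) (𝟙 (child? S⁻ r w) ⊛ inv aᵣ) _) (ℚₚ.*-assoc (𝟙 (child? S⁻ r w)) (inv aᵣ) _)) ⟩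
        sumL (allFin n) (λ w → 𝟙 (child? S⁻ r w) ⊛ (inv aᵣ ⊛ ∑ V (λ y → 𝟙 (half? y) ⊛ (𝟙 (lookup y w Fin.≟ lookup y r) ⊛ U w y))))
          ≡⟨ sumL-cong (allFin n) (λ w → 𝟙-congʳ (child? S⁻ r w) (λ wr → cong (inv aᵣ ⊛_)
               (trans (clash-reindex wr (λ (y , α) → G (st S⁻ y) (st S⁺ (kempe acyclic⁺ w α (lookup y r) y))))
                      (sumL-cong (enum V) (λ x → cong (λ v → 𝟙 (proper? S⁺ x) ⊛ G (st S⁻ (switch w x)) (st S⁺ v)) (Switch.resolve-unresolve wr x)))))) ⟩
        sumL (allFin n) (λ w → 𝟙 (child? S⁻ r w) ⊛ (inv aᵣ ⊛ ∑ V (λ x → 𝟙 (proper? S⁺ x) ⊛ G (st S⁻ (switch w x)) (st S⁺ x)))) ∎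

  -- K⁻ is aₚ aᵣ/κ², the ratio N⁺/N⁻, and K⁺ is its inverse, because 1 + ℓ/aᵣ = κ/aᵣ. Both are
  -- written in the form in which the sums over deletions and insertions produce them.
  N⁻ N⁺ K⁺ K⁻ : ℚ
  N⁻ = ∑ V (λ x → 𝟙 (proper? S⁻ x))
  N⁺ = ∑ V (λ x → 𝟙 (proper? S⁺ x))
  K⁺ = inv aₚ ⊛ (fromℕ κ ⊛ (1ℚ ⊕ fromℕ ℓ ⊛ inv aᵣ))
  K⁻ = inv κ ⊛ (fromℕ aᵣ ⊛ (inv κ ⊛ fromℕ aₚ))

  children-sum : ∀ (f : Fin n → ℚ) → sumL (kids S⁻ r) f ≡ sumL (allFin n) (λ w → 𝟙 (child? S⁻ r w) ⊛ f w)
  children-sum f = sumL-filterᵇ (does ∘ child? S⁻ r) (allFin n) f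

  children-const : ∀ c → sumL (allFin n) (λ w → 𝟙 (child? S⁻ r w) ⊛ c) ≡ fromℕ ℓ ⊛ c
  children-const c = trans (sym (children-sum (λ _ → c))) (sumL-const (kids S⁻ r) c)

  -- A deletion repairs in the forest without (p, r), while the bijection speaks of the forest with
  -- it. The chain hangs below r, where the two agree.
  switch⁻ : ∀ {w} → S⁻ w ≡ just r → ∀ x → kempe acyclic⁻ w (lookup x w) (lookup x r) x ≡ switch w x
  switch⁻ {w} wr x = flip-cong (chain? acyclic⁻ w (lookup x w) (lookup x r) x) (chain? acyclic⁺ w (lookup x w) (lookup x r) x)
    (λ _ → Reach-lift) (λ _ → Reach-lower) (lookup x w) (lookup x r) x
    where open Switch {κ} wr

  deletedState : Vec (Fin κ) n → State n κ
  deletedState x = set (st S⁺ x) r nothing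

  deleteBranch : Vec (Fin κ) n → Fin n → Dist (State n κ)
  deleteBranch x w = deleteStep (deletedState x) r (lookup x r) w (deletedState x w)

  deleteBranch-≈ : ∀ {x w} → Proper S⁻ x → S⁻ w ≡ just r → deleteBranch x w ≈ᵈ return (st S⁻ (switch w x))
  deleteBranch-≈ {x} {w} pr wr rewrite trans (set-cut L x w) (st-just S⁻ x wr) = return-cong λ z → begin
    fixForbidden (set (deletedState x) w (just (r , α))) w β α z
      ≡⟨ fixForbidden-cong (λ v → trans (set-cong (set-cut L x) w (just (r , α)) v) (set-recolor S⁻ x α wr v)) w β α z ⟩
    fixForbidden (st S⁻ (x [ w ]≔ α)) w β α z
      ≡⟨ fixForbidden-kempe acyclic⁻ n x w r β α wr refl (λ _ ne i i′ → pr _ _ _ ne i i′) (ℕₚ.m≤m+n n _) z ⟩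
    st S⁻ (kempe acyclic⁻ w β α x) z
      ≡⟨ cong (λ v → st S⁻ v z) (switch⁻ wr x) ⟩
    st S⁻ (switch w x) z ∎
    where
    open ≡-Reasoning
    α = lookup x r
    β = lookup x w

  children-deleted : ∀ x → children (deletedState x) r ≡ kids S⁻ r
  children-deleted x = trans (children-cong (set-cut L x) r) (children-st S⁻ x r)

  κ-split : fromℕ aᵣ ⊕ fromℕ ℓ ≡ fromℕ κ
  κ-split = trans (sym (fromℕ-homo-+ aᵣ ℓ)) (cong fromℕ aᵣ+ℓ)

  deletion-E : ∀ {g} → Ext g → ∀ x → Proper S⁺ x → E (deletion (st S⁺ x) p r) g ≡
    inv κ ⊛ (fromℕ aᵣ ⊛ g (st S⁻ x) ⊕ sumL (allFin n) (λ w → 𝟙 (child? S⁻ r w) ⊛ g (st S⁻ (switch w x))))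
  deletion-E {g} ext x pr = begin
    E (deletion (st S⁺ x) p r) g
      ≡⟨ cong (λ d → E d g) (trans (deletion-unfold (st S⁺ x) p r (st-just S⁺ x edge⁺))
           (cong (λ ws → choice (frac (κ ∸ length ws) κ) (return (deletedState x)) (bind (uniform ws) (deleteBranch x))) (children-deleted x))) ⟩
    E (choice (frac (κ ∸ ℓ) κ) (return (deletedState x)) (bind (uniform (kids S⁻ r)) (deleteBranch x))) g
      ≡⟨ E-choice (frac (κ ∸ ℓ) κ) (return (deletedState x)) (bind (uniform (kids S⁻ r)) (deleteBranch x)) g ⟩
    frac (κ ∸ ℓ) κ ⊛ E (return (deletedState x)) g ⊕ (1ℚ ℚ.- frac (κ ∸ ℓ) κ) ⊛ E (bind (uniform (kids S⁻ r)) (deleteBranch x)) g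
      ≡⟨ cong₂ (λ q e → q ⊛ e ⊕ (1ℚ ℚ.- q) ⊛ E (bind (uniform (kids S⁻ r)) (deleteBranch x)) g) stay (trans (E-return (deletedState x) g) (ext (set-cut L x))) ⟩
    (inv κ ⊛ fromℕ aᵣ) ⊛ g (st S⁻ x) ⊕ (1ℚ ℚ.- inv κ ⊛ fromℕ aᵣ) ⊛ E (bind (uniform (kids S⁻ r)) (deleteBranch x)) g
      ≡⟨ cong₂ (λ q e → (inv κ ⊛ fromℕ aᵣ) ⊛ g (st S⁻ x) ⊕ q ⊛ e) move branches ⟩
    (inv κ ⊛ fromℕ aᵣ) ⊛ g (st S⁻ x) ⊕ (inv κ ⊛ fromℕ ℓ) ⊛ (inv ℓ ⊛ sumL (kids S⁻ r) (λ w → E (deleteBranch x w) g))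
      ≡⟨ lem₂ (inv κ) (fromℕ aᵣ) (g (st S⁻ x)) (fromℕ ℓ) _ ⟩
    inv κ ⊛ (fromℕ aᵣ ⊛ g (st S⁻ x) ⊕ fromℕ ℓ ⊛ (inv ℓ ⊛ sumL (kids S⁻ r) (λ w → E (deleteBranch x w) g)))
      ≡⟨ cong (λ s → inv κ ⊛ (fromℕ aᵣ ⊛ g (st S⁻ x) ⊕ s)) (trans (mean-sum (kids S⁻ r) _) (children-sum (λ w → E (deleteBranch x w) g))) ⟩
    inv κ ⊛ (fromℕ aᵣ ⊛ g (st S⁻ x) ⊕ sumL (allFin n) (λ w → 𝟙 (child? S⁻ r w) ⊛ E (deleteBranch x w) g))
      ≡⟨ cong (λ s → inv κ ⊛ (fromℕ aᵣ ⊛ g (st S⁻ x) ⊕ s)) (sumL-cong (allFin n) (λ w → 𝟙-congʳ (child? S⁻ r w) (λ wr →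
           trans (E-cong (deleteBranch-≈ {x} (proj₁ (proper-half {y = x} pr)) wr) (λ {s} {s′} → ext {s} {s′})) (E-return (st S⁻ (switch w x)) g)))) ⟩
    inv κ ⊛ (fromℕ aᵣ ⊛ g (st S⁻ x) ⊕ sumL (allFin n) (λ w → 𝟙 (child? S⁻ r w) ⊛ g (st S⁻ (switch w x)))) ∎
    where
    open ≡-Reasoning
    stay : frac (κ ∸ ℓ) κ ≡ inv κ ⊛ fromℕ aᵣ
    stay = trans (frac-inv (κ ∸ ℓ) 0<κ) (cong (λ d → inv κ ⊛ fromℕ (κ ∸ d)) (sym degree-r))
    lem : ∀ i a l → i ⊛ (a ⊕ l) ℚ.- i ⊛ a ≡ i ⊛ l
    lem = solve-∀ ℚ-ring
    move : 1ℚ ℚ.- inv κ ⊛ fromℕ aᵣ ≡ inv κ ⊛ fromℕ ℓ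
    move = trans (cong (ℚ._- inv κ ⊛ fromℕ aᵣ) (sym (trans (cong (inv κ ⊛_) κ-split) (inv-fromℕ 0<κ)))) (lem (inv κ) (fromℕ aᵣ) (fromℕ ℓ))
    branches : E (bind (uniform (kids S⁻ r)) (deleteBranch x)) g ≡ inv ℓ ⊛ sumL (kids S⁻ r) (λ w → E (deleteBranch x w) g)
    branches = trans (E-bind (uniform (kids S⁻ r)) (deleteBranch x) g) (E-uniform (kids S⁻ r) _)
    lem₂ : ∀ i a g l s → (i ⊛ a) ⊛ g ⊕ (i ⊛ l) ⊛ s ≡ i ⊛ (a ⊛ g ⊕ l ⊛ s)
    lem₂ = solve-∀ ℚ-ring

  delete-sum : ∀ {G} → Ext₂ G →
    ∑ V (λ x → 𝟙 (proper? S⁺ x) ⊛ E (deletion (st S⁺ x) p r) (G (st S⁺ x))) ≡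
    inv κ ⊛ (fromℕ aᵣ ⊛ ∑ V (λ x → 𝟙 (proper? S⁺ x) ⊛ G (st S⁺ x) (st S⁻ x)) ⊕
      sumL (allFin n) (λ w → 𝟙 (child? S⁻ r w) ⊛ ∑ V (λ x → 𝟙 (proper? S⁺ x) ⊛ G (st S⁺ x) (st S⁻ (switch w x)))))
  delete-sum {G} ext = begin
    ∑ V (λ x → P x ⊛ E (deletion (st S⁺ x) p r) (G (st S⁺ x)))
      ≡⟨ sumL-cong (enum V) (λ x → 𝟙-congʳ (proper? S⁺ x) (deletion-E (ext (λ _ → refl)) x)) ⟩
    ∑ V (λ x → P x ⊛ (inv κ ⊛ (fromℕ aᵣ ⊛ a x ⊕ sumL (allFin n) (λ w → C w ⊛ b w x))))
      ≡⟨ sumL-cong (enum V) (λ x → trans (lem (P x) (inv κ) (fromℕ aᵣ) (a x) _)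
           (cong (λ s → inv κ ⊛ (fromℕ aᵣ ⊛ (P x ⊛ a x) ⊕ s)) (trans (sym (sumL-⊛ (allFin n) (P x) _)) (sumL-cong (allFin n) (λ w → ⊛-swap (P x) (C w) (b w x)))))) ⟩
    ∑ V (λ x → inv κ ⊛ (fromℕ aᵣ ⊛ (P x ⊛ a x) ⊕ sumL (allFin n) (λ w → C w ⊛ (P x ⊛ b w x))))
      ≡⟨ trans (sumL-⊛ (enum V) (inv κ) _) (cong (inv κ ⊛_) (sumL-⊕ (enum V) _ _)) ⟩
    inv κ ⊛ (∑ V (λ x → fromℕ aᵣ ⊛ (P x ⊛ a x)) ⊕ ∑ V (λ x → sumL (allFin n) (λ w → C w ⊛ (P x ⊛ b w x))))
      ≡⟨ cong₂ (λ s t → inv κ ⊛ (s ⊕ t)) (sumL-⊛ (enum V) (fromℕ aᵣ) _)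
           (trans (sumL-swap (enum V) (allFin n) _) (sumL-cong (allFin n) (λ w → sumL-⊛ (enum V) (C w) _))) ⟩
    inv κ ⊛ (fromℕ aᵣ ⊛ ∑ V (λ x → P x ⊛ a x) ⊕ sumL (allFin n) (λ w → C w ⊛ ∑ V (λ x → P x ⊛ b w x))) ∎
    where
    open ≡-Reasoning
    P : Vec (Fin κ) n → ℚ
    P x = 𝟙 (proper? S⁺ x)
    C : Fin n → ℚ
    C w = 𝟙 (child? S⁻ r w)
    a : Vec (Fin κ) n → ℚ
    a x = G (st S⁺ x) (st S⁻ x)
    b : Fin n → Vec (Fin κ) n → ℚ
    b w x = G (st S⁺ x) (st S⁻ (switch w x))
    lem : ∀ p i k a s → p ⊛ (i ⊛ (k ⊛ a ⊕ s)) ≡ i ⊛ (k ⊛ (p ⊛ a) ⊕ p ⊛ s)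
    lem = solve-∀ ℚ-ring

  -- A half colouring that clashes at w is the image of one x for every colour α free at r, that is,
  -- of aᵣ colourings.
  switch-sum : ∀ (g : State n κ → ℚ) {w} → S⁻ w ≡ just r →
    ∑ V (λ x → 𝟙 (proper? S⁺ x) ⊛ g (st S⁻ (switch w x))) ≡
    fromℕ aᵣ ⊛ ∑ V (λ y → 𝟙 (half? y) ⊛ (𝟙 (lookup y w Fin.≟ lookup y r) ⊛ g (st S⁻ y)))
  switch-sum g {w} wr = begin
    ∑ V (λ x → 𝟙 (proper? S⁺ x) ⊛ g (st S⁻ (switch w x)))
      ≡⟨ clash-reindex wr (λ (y , _) → g (st S⁻ y)) ⟨
    ∑ V (λ y → 𝟙 (half? y) ⊛ (𝟙 (lookup y w Fin.≟ lookup y r) ⊛ sumL (allFin κ) (λ α → 𝟙 (free? S⁺ y r α) ⊛ g (st S⁻ y))))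
      ≡⟨ sumL-cong (enum V) (λ y → 𝟙-congʳ (half? y) (λ hy → 𝟙-congʳ (lookup y w Fin.≟ lookup y r) (λ e → row y hy e))) ⟩
    ∑ V (λ y → 𝟙 (half? y) ⊛ (𝟙 (lookup y w Fin.≟ lookup y r) ⊛ (fromℕ aᵣ ⊛ g (st S⁻ y))))
      ≡⟨ sumL-cong (enum V) (λ y → lem (𝟙 (half? y)) (𝟙 (lookup y w Fin.≟ lookup y r)) (fromℕ aᵣ) (g (st S⁻ y))) ⟩
    ∑ V (λ y → fromℕ aᵣ ⊛ (𝟙 (half? y) ⊛ (𝟙 (lookup y w Fin.≟ lookup y r) ⊛ g (st S⁻ y))))
      ≡⟨ sumL-⊛ (enum V) (fromℕ aᵣ) _ ⟩
    fromℕ aᵣ ⊛ ∑ V (λ y → 𝟙 (half? y) ⊛ (𝟙 (lookup y w Fin.≟ lookup y r) ⊛ g (st S⁻ y))) ∎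
    where
    open ≡-Reasoning
    lem : ∀ h e a g → h ⊛ (e ⊛ (a ⊛ g)) ≡ a ⊛ (h ⊛ (e ⊛ g))
    lem = solve-∀ ℚ-ring
    row : ∀ y → Half y → lookup y w ≡ lookup y r → sumL (allFin κ) (λ α → 𝟙 (free? S⁺ y r α) ⊛ g (st S⁻ y)) ≡ fromℕ aᵣ ⊛ g (st S⁻ y)
    row y hy e = trans (sumL-cong (allFin κ) (λ α → ℚₚ.*-comm (𝟙 (free? S⁺ y r α)) (g (st S⁻ y))))
      (trans (sumL-⊛ (allFin κ) (g (st S⁻ y)) _) (trans (cong (g (st S⁻ y) ⊛_) (clash-free-count {y} (proj₁ hy) wr e)) (ℚₚ.*-comm (g (st S⁻ y)) (fromℕ aᵣ))))

  -- The stopping branch yields aᵣ times the half colourings without a clash, and the branch of w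
  -- yields aᵣ times those that clash at w. By `half-split` they add up to all half colourings, and
  -- `half-sum` then forgets the dummy.
  delete-measure : ∀ {g} → Ext g →
    ∑ V (λ x → 𝟙 (proper? S⁺ x) ⊛ E (deletion (st S⁺ x) p r) g) ≡ K⁻ ⊛ ∑ V (λ x → 𝟙 (proper? S⁻ x) ⊛ g (st S⁻ x))
  delete-measure {g} ext = begin
    ∑ V (λ x → 𝟙 (proper? S⁺ x) ⊛ E (deletion (st S⁺ x) p r) g)
      ≡⟨ delete-sum {λ _ → g} (λ _ e → ext e) ⟩
    inv κ ⊛ (fromℕ aᵣ ⊛ ∑ V (λ x → 𝟙 (proper? S⁺ x) ⊛ h x) ⊕ sumL (allFin n) (λ w → C w ⊛ ∑ V (λ x → 𝟙 (proper? S⁺ x) ⊛ h (switch w x))))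
      ≡⟨ cong (λ s → inv κ ⊛ (fromℕ aᵣ ⊛ ∑ V (λ x → 𝟙 (proper? S⁺ x) ⊛ h x) ⊕ s))
           (trans (sumL-cong (allFin n) (λ w → trans (𝟙-congʳ (child? S⁻ r w) (switch-sum g)) (⊛-swap (C w) (fromℕ aᵣ) _))) (sumL-⊛ (allFin n) (fromℕ aᵣ) _)) ⟩
    inv κ ⊛ (fromℕ aᵣ ⊛ ∑ V (λ x → 𝟙 (proper? S⁺ x) ⊛ h x) ⊕ fromℕ aᵣ ⊛ sumL (allFin n) (λ w → C w ⊛ ∑ V (λ y → H y ⊛ (e w y ⊛ h y))))
      ≡⟨ cong (inv κ ⊛_) (ℚₚ.*-distribˡ-+ (fromℕ aᵣ) _ _) ⟨
    inv κ ⊛ (fromℕ aᵣ ⊛ (∑ V (λ x → 𝟙 (proper? S⁺ x) ⊛ h x) ⊕ sumL (allFin n) (λ w → C w ⊛ ∑ V (λ y → H y ⊛ (e w y ⊛ h y)))))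
      ≡⟨ cong (λ s → inv κ ⊛ (fromℕ aᵣ ⊛ s)) merge ⟩
    inv κ ⊛ (fromℕ aᵣ ⊛ ∑ V (λ y → H y ⊛ h y))
      ≡⟨ cong (λ s → inv κ ⊛ (fromℕ aᵣ ⊛ s)) (trans (sym (ℚₚ.*-identityˡ _)) (trans (cong (_⊛ ∑ V (λ y → H y ⊛ h y)) (sym (inv-fromℕ 0<κ)))
           (trans (ℚₚ.*-assoc (inv κ) (fromℕ κ) _) (cong (inv κ ⊛_) (half-sum g ext))))) ⟩
    inv κ ⊛ (fromℕ aᵣ ⊛ (inv κ ⊛ (fromℕ aₚ ⊛ ∑ V (λ x → 𝟙 (proper? S⁻ x) ⊛ h x))))
      ≡⟨ lem₂ (inv κ) (fromℕ aᵣ) (inv κ) (fromℕ aₚ) _ ⟩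
    K⁻ ⊛ ∑ V (λ x → 𝟙 (proper? S⁻ x) ⊛ h x) ∎
    where
    open ≡-Reasoning
    h : Vec (Fin κ) n → ℚ
    h x = g (st S⁻ x)
    H : Vec (Fin κ) n → ℚ
    H y = 𝟙 (half? y)
    C : Fin n → ℚ
    C w = 𝟙 (child? S⁻ r w)
    e : Fin n → Vec (Fin κ) n → ℚ
    e w y = 𝟙 (lookup y w Fin.≟ lookup y r)
    lem₂ : ∀ a b c d e → a ⊛ (b ⊛ (c ⊛ (d ⊛ e))) ≡ (a ⊛ (b ⊛ (c ⊛ d))) ⊛ e
    lem₂ = solve-∀ ℚ-ring
    lem₃ : ∀ c h e x → c ⊛ (h ⊛ (e ⊛ x)) ≡ h ⊛ (c ⊛ e ⊛ x)
    lem₃ = solve-∀ ℚ-ring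
    merge : ∑ V (λ x → 𝟙 (proper? S⁺ x) ⊛ h x) ⊕ sumL (allFin n) (λ w → C w ⊛ ∑ V (λ y → H y ⊛ (e w y ⊛ h y))) ≡ ∑ V (λ y → H y ⊛ h y)
    merge = begin
      ∑ V (λ x → 𝟙 (proper? S⁺ x) ⊛ h x) ⊕ sumL (allFin n) (λ w → C w ⊛ ∑ V (λ y → H y ⊛ (e w y ⊛ h y)))
        ≡⟨ cong₂ _⊕_ (sumL-cong (enum V) (λ y → trans (𝟙-guard (proper? S⁺ y) (half? y ×-dec proper? S⁺ y) (h y) (h y) (λ pr → proper-half {y = y} pr , pr) proj₂ (λ _ → refl))
               (𝟙-×-⊛ (half? y) (proper? S⁺ y) (h y))))
             (trans (sumL-cong (allFin n) (λ w → sym (sumL-⊛ (enum V) (C w) _))) (trans (sumL-swap (allFin n) (enum V) _)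
               (sumL-cong (enum V) (λ y → trans (sumL-cong (allFin n) (λ w → trans (lem₃ (C w) (H y) (e w y) (h y))
                  (cong (λ c → H y ⊛ (c ⊛ h y)) (sym (𝟙-× (child? S⁻ r w) (lookup y w Fin.≟ lookup y r)))))) (sumL-⊛ (allFin n) (H y) _))))) ⟩
      ∑ V (λ y → H y ⊛ (𝟙 (proper? S⁺ y) ⊛ h y)) ⊕ ∑ V (λ y → H y ⊛ sumL (allFin n) (λ w → 𝟙 (clashing? y w) ⊛ h y))
        ≡⟨ sumL-⊕ (enum V) _ _ ⟨
      ∑ V (λ y → H y ⊛ (𝟙 (proper? S⁺ y) ⊛ h y) ⊕ H y ⊛ sumL (allFin n) (λ w → 𝟙 (clashing? y w) ⊛ h y))
        ≡⟨ sumL-cong (enum V) (λ y → trans (sym (ℚₚ.*-distribˡ-+ (H y) _ _))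
             (𝟙-congʳ (half? y) (λ hy → half-split y hy (h y) (λ _ → h y) (h y) (λ _ → refl) (λ _ _ _ → refl)))) ⟩
      ∑ V (λ y → H y ⊛ h y) ∎

  insert-measure : ∀ {g} → Ext g →
    ∑ V (λ x → 𝟙 (proper? S⁻ x) ⊛ E (rootedInsert (st S⁻ x) p r) g) ≡ K⁺ ⊛ ∑ V (λ x → 𝟙 (proper? S⁺ x) ⊛ g (st S⁺ x))
  insert-measure {g} ext = begin
    ∑ V (λ x → 𝟙 (proper? S⁻ x) ⊛ E (rootedInsert (st S⁻ x) p r) g)
      ≡⟨ insert-sum {λ _ → g} (λ _ e → ext e) ⟩
    inv aₚ ⊛ (fromℕ κ ⊛ (M ⊕ sumL (allFin n) (λ w → 𝟙 (child? S⁻ r w) ⊛ (inv aᵣ ⊛ M))))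
      ≡⟨ cong (λ s → inv aₚ ⊛ (fromℕ κ ⊛ (M ⊕ s))) (children-const (inv aᵣ ⊛ M)) ⟩
    inv aₚ ⊛ (fromℕ κ ⊛ (M ⊕ fromℕ ℓ ⊛ (inv aᵣ ⊛ M)))
      ≡⟨ lem (inv aₚ) (fromℕ κ) M (fromℕ ℓ) (inv aᵣ) ⟩
    K⁺ ⊛ M ∎
    where
    open ≡-Reasoning
    M : ℚ
    M = ∑ V (λ x → 𝟙 (proper? S⁺ x) ⊛ g (st S⁺ x))
    lem : ∀ a k m l i → a ⊛ (k ⊛ (m ⊕ l ⊛ (i ⊛ m))) ≡ (a ⊛ (k ⊛ (1ℚ ⊕ l ⊛ i))) ⊛ m
    lem = solve-∀ ℚ-ring

  -- Take the constant 1 in `delete-measure`: the outcomes of a deletion have total weight (aᵣ +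
  -- ℓ)/κ = 1.
  N⁺≡ : N⁺ ≡ K⁻ ⊛ N⁻
  N⁺≡ = begin
    ∑ V (λ x → 𝟙 (proper? S⁺ x))
      ≡⟨ sumL-cong (enum V) (λ x → trans (sym (ℚₚ.*-identityʳ _)) (𝟙-congʳ (proper? S⁺ x) (λ pr → sym (mass x pr)))) ⟩
    ∑ V (λ x → 𝟙 (proper? S⁺ x) ⊛ E (deletion (st S⁺ x) p r) (λ _ → 1ℚ))
      ≡⟨ delete-measure {λ _ → 1ℚ} (λ _ → refl) ⟩
    K⁻ ⊛ ∑ V (λ x → 𝟙 (proper? S⁻ x) ⊛ 1ℚ)
      ≡⟨ cong (K⁻ ⊛_) (sumL-cong (enum V) (λ x → ℚₚ.*-identityʳ _)) ⟩
    K⁻ ⊛ N⁻ ∎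
    where
    open ≡-Reasoning
    mass : ∀ x → Proper S⁺ x → E (deletion (st S⁺ x) p r) (λ _ → 1ℚ) ≡ 1ℚ
    mass x pr = trans (deletion-E {λ _ → 1ℚ} (λ _ → refl) x pr)
      (trans (cong₂ (λ s t → inv κ ⊛ (s ⊕ t)) (ℚₚ.*-identityʳ (fromℕ aᵣ)) (trans (children-const 1ℚ) (ℚₚ.*-identityʳ (fromℕ ℓ))))
        (trans (cong (inv κ ⊛_) κ-split) (inv-fromℕ 0<κ)))

  K⁺K⁻ : K⁺ ⊛ K⁻ ≡ 1ℚ
  K⁺K⁻ = begin
    K⁺ ⊛ K⁻
      ≡⟨ lem₁ (inv aₚ) (fromℕ κ) (fromℕ ℓ) (inv aᵣ) (inv κ) (fromℕ aᵣ) (fromℕ aₚ) ⟩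
    (inv aₚ ⊛ fromℕ aₚ) ⊛ ((inv κ ⊛ fromℕ κ) ⊛ (inv κ ⊛ (fromℕ aᵣ ⊕ fromℕ ℓ ⊛ (inv aᵣ ⊛ fromℕ aᵣ))))
      ≡⟨ cong₂ _⊛_ (inv-fromℕ 0<aₚ) (cong₂ (λ s t → s ⊛ (inv κ ⊛ (fromℕ aᵣ ⊕ fromℕ ℓ ⊛ t))) (inv-fromℕ 0<κ) (inv-fromℕ 0<aᵣ)) ⟩
    1ℚ ⊛ (1ℚ ⊛ (inv κ ⊛ (fromℕ aᵣ ⊕ fromℕ ℓ ⊛ 1ℚ)))
      ≡⟨ lem₂ (inv κ) (fromℕ aᵣ) (fromℕ ℓ) ⟩
    inv κ ⊛ (fromℕ aᵣ ⊕ fromℕ ℓ)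
      ≡⟨ trans (cong (inv κ ⊛_) κ-split) (inv-fromℕ 0<κ) ⟩
    1ℚ ∎
    where
    open ≡-Reasoning
    lem₁ : ∀ ip k l ir ik r p → (ip ⊛ (k ⊛ (1ℚ ⊕ l ⊛ ir))) ⊛ (ik ⊛ (r ⊛ (ik ⊛ p))) ≡
      (ip ⊛ p) ⊛ ((ik ⊛ k) ⊛ (ik ⊛ (r ⊕ l ⊛ (ir ⊛ r))))
    lem₁ = solve-∀ ℚ-ring
    lem₂ : ∀ i a l → 1ℚ ⊛ (1ℚ ⊛ (i ⊛ (a ⊕ l ⊛ 1ℚ))) ≡ i ⊛ (a ⊕ l)
    lem₂ = solve-∀ ℚ-ring

  N⁻≡ : N⁻ ≡ K⁺ ⊛ N⁺
  N⁻≡ = trans (sym (ℚₚ.*-identityˡ N⁻)) (trans (cong (_⊛ N⁻) (sym K⁺K⁻)) (trans (ℚₚ.*-assoc K⁺ K⁻ N⁻) (cong (K⁺ ⊛_) (sym N⁺≡))))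

  0≤K⁺ : 0ℚ ≼ K⁺
  0≤K⁺ = *-nonneg (0≤inv aₚ) (*-nonneg (0≤fromℕ κ) (ℚₚ.+-mono-≤ 0≤1 (*-nonneg (0≤fromℕ ℓ) (0≤inv aᵣ))))

  0≤K⁻ : 0ℚ ≼ K⁻
  0≤K⁻ = *-nonneg (0≤inv κ) (*-nonneg (0≤fromℕ aᵣ) (*-nonneg (0≤inv κ) (0≤fromℕ aₚ)))

  chainLength : Fin n → Vec (Fin κ) n → ℚ
  chainLength w x = sumL (allFin n) (λ z → 𝟙 (chain? acyclic⁺ w (lookup x w) (lookup x r) x z))

  hamming-self : ∀ (x : Vec (Fin κ) n) → hamming x x ≡ 0ℚ
  hamming-self x = trans (sumL-cong (allFin n) (λ z → 𝟙-no (¬? (lookup x z Fin.≟ lookup x z)) (λ ne → ne refl))) (sumL-zero (allFin n))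

  hamming-switch : ∀ w x → hamming (switch w x) x ≼ chainLength w x
  hamming-switch w x = sumL-mono (allFin n) (λ z → 𝟙-mono (¬? (lookup (switch w x) z Fin.≟ lookup x z)) (chain? acyclic⁺ w (lookup x w) (lookup x r) x z) (on-chain z))
    where
    on-chain : ∀ z → lookup (switch w x) z ≢ lookup x z → Chain acyclic⁺ w (lookup x w) (lookup x r) x z
    on-chain z ne with chain? acyclic⁺ w (lookup x w) (lookup x r) x z
    ... | yes c = c
    ... | no ¬c = contradiction (kempe-out acyclic⁺ w (lookup x w) (lookup x r) x ¬c) ne

  hamming-sym : ∀ (x y : Vec (Fin κ) n) → hamming x y ≡ hamming y x
  hamming-sym x y = sumL-cong (allFin n) (λ z → 𝟙-cong (¬? (lookup x z Fin.≟ lookup y z)) (¬? (lookup y z Fin.≟ lookup x z)) (_∘ sym) (_∘ sym))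

  module Recourse (step : State n κ → Upd n → Dist (State n κ)) (valid : State n κ → Upd n → Set) {B : ℚ}
    (chain-bound : ∀ w → S⁻ w ≡ just r → ∑ V (λ x → 𝟙 (proper? S⁺ x) ⊛ chainLength w x) ≼ B ⊛ N⁺) where

    rec : State n κ → State n κ → ℚ
    rec s t = fromℕ (recourse step valid s t)

    private
      rec-ext : Ext₂ rec
      rec-ext h k = cong fromℕ (recourse-cong step valid h k)

      rec⁻⁺ : ∀ x y → rec (st S⁻ x) (st S⁺ y) ≼ hamming x y
      rec⁻⁺ = recourse-hamming step valid acyclic⁺ lift id

      rec⁺⁻ : ∀ x y → rec (st S⁺ x) (st S⁻ y) ≼ hamming x y
      rec⁺⁻ = recourse-hamming step valid acyclic⁺ id lift

      idle : ∀ (f : Vec (Fin κ) n → ℚ) → (∀ x → f x ≼ 0ℚ) → ∑ V (λ x → 𝟙 (proper? S⁺ x) ⊛ f x) ≼ 0ℚ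
      idle f h = ℚₚ.≤-trans (sumL-mono (enum V) (λ x → ℚₚ.≤-trans (*-mono-≼ˡ (𝟙-nonneg (proper? S⁺ x)) (h x)) (ℚₚ.≤-reflexive (ℚₚ.*-zeroʳ (𝟙 (proper? S⁺ x))))))
        (ℚₚ.≤-reflexive (sumL-zero (enum V)))

      active : ∀ (f : Fin n → Vec (Fin κ) n → ℚ) → (∀ w x → f w x ≼ chainLength w x) →
        ∀ w → S⁻ w ≡ just r → ∑ V (λ x → 𝟙 (proper? S⁺ x) ⊛ f w x) ≼ B ⊛ N⁺
      active f h w wr = ℚₚ.≤-trans (sumL-mono (enum V) (λ x → *-mono-≼ˡ (𝟙-nonneg (proper? S⁺ x)) (h w x))) (chain-bound w wr)

    -- Without a clash no previously coloured edge changes. The ℓ children contribute at most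
    -- (κ/aₚ)(ℓ/aᵣ) B N⁺ together, and N⁺ = (aₚ aᵣ/κ²) N⁻ reduces this to (ℓ/κ) B N⁻.
    insert-recourse : ∑ V (λ x → 𝟙 (proper? S⁻ x) ⊛ E (rootedInsert (st S⁻ x) p r) (rec (st S⁻ x))) ≼ ((inv κ ⊛ fromℕ ℓ) ⊛ B) ⊛ N⁻
    insert-recourse = begin
      ∑ V (λ x → 𝟙 (proper? S⁻ x) ⊛ E (rootedInsert (st S⁻ x) p r) (rec (st S⁻ x)))
        ≡⟨ insert-sum {rec} rec-ext ⟩
      inv aₚ ⊛ (fromℕ κ ⊛ (∑ V (λ x → 𝟙 (proper? S⁺ x) ⊛ rec (st S⁻ x) (st S⁺ x)) ⊕
        sumL (allFin n) (λ w → 𝟙 (child? S⁻ r w) ⊛ (inv aᵣ ⊛ ∑ V (λ x → 𝟙 (proper? S⁺ x) ⊛ rec (st S⁻ (switch w x)) (st S⁺ x))))))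
        ≤⟨ *-mono-≼ˡ (0≤inv aₚ) (*-mono-≼ˡ (0≤fromℕ κ) (ℚₚ.+-mono-≤
             (idle (λ x → rec (st S⁻ x) (st S⁺ x)) (λ x → ℚₚ.≤-trans (rec⁻⁺ x x) (ℚₚ.≤-reflexive (hamming-self x))))
             (sumL-mono (allFin n) (λ w → 𝟙-guard-≼ (child? S⁻ r w) _ _ (λ wr → *-mono-≼ˡ (0≤inv aᵣ)
               (active (λ w x → rec (st S⁻ (switch w x)) (st S⁺ x)) (λ w x → ℚₚ.≤-trans (rec⁻⁺ (switch w x) x) (hamming-switch w x)) w wr)))))) ⟩
      inv aₚ ⊛ (fromℕ κ ⊛ (0ℚ ⊕ sumL (allFin n) (λ w → 𝟙 (child? S⁻ r w) ⊛ (inv aᵣ ⊛ (B ⊛ N⁺)))))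
        ≡⟨ cong₂ (λ s m → inv aₚ ⊛ (fromℕ κ ⊛ (0ℚ ⊕ s))) (trans (children-const (inv aᵣ ⊛ (B ⊛ N⁺))) (cong (λ m → fromℕ ℓ ⊛ (inv aᵣ ⊛ (B ⊛ m))) N⁺≡)) (refl {x = 0ℚ}) ⟩
      inv aₚ ⊛ (fromℕ κ ⊛ (0ℚ ⊕ fromℕ ℓ ⊛ (inv aᵣ ⊛ (B ⊛ (K⁻ ⊛ N⁻)))))
        ≡⟨ lem₁ (inv aₚ) (fromℕ κ) (fromℕ ℓ) (inv aᵣ) B (inv κ) (fromℕ aᵣ) (fromℕ aₚ) N⁻ ⟩
      (inv aₚ ⊛ fromℕ aₚ) ⊛ ((inv κ ⊛ fromℕ κ) ⊛ ((inv aᵣ ⊛ fromℕ aᵣ) ⊛ (((inv κ ⊛ fromℕ ℓ) ⊛ B) ⊛ N⁻)))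
        ≡⟨ cong₂ _⊛_ (inv-fromℕ 0<aₚ) (cong₂ (λ s t → s ⊛ (t ⊛ (((inv κ ⊛ fromℕ ℓ) ⊛ B) ⊛ N⁻))) (inv-fromℕ 0<κ) (inv-fromℕ 0<aᵣ)) ⟩
      1ℚ ⊛ (1ℚ ⊛ (1ℚ ⊛ (((inv κ ⊛ fromℕ ℓ) ⊛ B) ⊛ N⁻)))
        ≡⟨ trans (ℚₚ.*-identityˡ _) (trans (ℚₚ.*-identityˡ _) (ℚₚ.*-identityˡ _)) ⟩
      ((inv κ ⊛ fromℕ ℓ) ⊛ B) ⊛ N⁻ ∎
      where
      open ℚₚ.≤-Reasoning
      lem₁ : ∀ ip k l ir b ik r p m → ip ⊛ (k ⊛ (0ℚ ⊕ l ⊛ (ir ⊛ (b ⊛ ((ik ⊛ (r ⊛ (ik ⊛ p))) ⊛ m))))) ≡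
        (ip ⊛ p) ⊛ ((ik ⊛ k) ⊛ ((ir ⊛ r) ⊛ (((ik ⊛ l) ⊛ b) ⊛ m)))
      lem₁ = solve-∀ ℚ-ring

    delete-recourse : ∑ V (λ x → 𝟙 (proper? S⁺ x) ⊛ E (deletion (st S⁺ x) p r) (rec (st S⁺ x))) ≼ ((inv κ ⊛ fromℕ ℓ) ⊛ B) ⊛ N⁺
    delete-recourse = begin
      ∑ V (λ x → 𝟙 (proper? S⁺ x) ⊛ E (deletion (st S⁺ x) p r) (rec (st S⁺ x)))
        ≡⟨ delete-sum {rec} rec-ext ⟩
      inv κ ⊛ (fromℕ aᵣ ⊛ ∑ V (λ x → 𝟙 (proper? S⁺ x) ⊛ rec (st S⁺ x) (st S⁻ x)) ⊕
        sumL (allFin n) (λ w → 𝟙 (child? S⁻ r w) ⊛ ∑ V (λ x → 𝟙 (proper? S⁺ x) ⊛ rec (st S⁺ x) (st S⁻ (switch w x)))))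
        ≤⟨ *-mono-≼ˡ (0≤inv κ) (ℚₚ.+-mono-≤
             (*-mono-≼ˡ (0≤fromℕ aᵣ) (idle (λ x → rec (st S⁺ x) (st S⁻ x)) (λ x → ℚₚ.≤-trans (rec⁺⁻ x x) (ℚₚ.≤-reflexive (hamming-self x)))))
             (sumL-mono (allFin n) (λ w → 𝟙-guard-≼ (child? S⁻ r w) _ _ (λ wr →
               active (λ w x → rec (st S⁺ x) (st S⁻ (switch w x)))
                 (λ w x → ℚₚ.≤-trans (rec⁺⁻ x (switch w x)) (ℚₚ.≤-trans (ℚₚ.≤-reflexive (hamming-sym x (switch w x))) (hamming-switch w x))) w wr)))) ⟩
      inv κ ⊛ (fromℕ aᵣ ⊛ 0ℚ ⊕ sumL (allFin n) (λ w → 𝟙 (child? S⁻ r w) ⊛ (B ⊛ N⁺)))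
        ≡⟨ cong (λ s → inv κ ⊛ (fromℕ aᵣ ⊛ 0ℚ ⊕ s)) (children-const (B ⊛ N⁺)) ⟩
      inv κ ⊛ (fromℕ aᵣ ⊛ 0ℚ ⊕ fromℕ ℓ ⊛ (B ⊛ N⁺))
        ≡⟨ lem (inv κ) (fromℕ aᵣ) (fromℕ ℓ) B N⁺ ⟩
      ((inv κ ⊛ fromℕ ℓ) ⊛ B) ⊛ N⁺ ∎
      where
      open ℚₚ.≤-Reasoning
      lem : ∀ i a l b m → i ⊛ (a ⊛ 0ℚ ⊕ l ⊛ (b ⊛ m)) ≡ ((i ⊛ l) ⊛ b) ⊛ m
      lem = solve-∀ ℚ-ring

-- The expected length of a Kempe chain

others-count : ∀ {κ} (γ₀ : Fin κ) → sumL (allFin κ) (λ γ → 𝟙 (¬? (γ Fin.≟ γ₀))) ≡ fromℕ (κ ∸ 1)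
others-count {suc k} γ₀ = ∙-cancelˡ ℚₚ.+-0-group 1ℚ _ _ (begin
  1ℚ ⊕ sumL (allFin (suc k)) (λ γ → 𝟙 (¬? (γ Fin.≟ γ₀)))
    ≡⟨ cong (_⊕ sumL (allFin (suc k)) (λ γ → 𝟙 (¬? (γ Fin.≟ γ₀)))) (enum-once (finFinite (suc k)) γ₀) ⟨
  sumL (allFin (suc k)) (λ γ → 𝟙 (γ Fin.≟ γ₀)) ⊕ sumL (allFin (suc k)) (λ γ → 𝟙 (¬? (γ Fin.≟ γ₀)))
    ≡⟨ sumL-⊕ (allFin (suc k)) (λ γ → 𝟙 (γ Fin.≟ γ₀)) (λ γ → 𝟙 (¬? (γ Fin.≟ γ₀))) ⟨
  sumL (allFin (suc k)) (λ γ → 𝟙 (γ Fin.≟ γ₀) ⊕ 𝟙 (¬? (γ Fin.≟ γ₀)))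
    ≡⟨ sumL-cong (allFin (suc k)) (λ γ → either (γ Fin.≟ γ₀)) ⟩
  sumL (allFin (suc k)) (λ γ → 1ℚ)
    ≡⟨ length-sumL (allFin (suc k)) ⟨
  fromℕ (length (allFin (suc k)))
    ≡⟨ cong fromℕ (length-allFin (suc k)) ⟩
  fromℕ (suc k)
    ≡⟨ fromℕ-suc k ⟩
  1ℚ ⊕ fromℕ k ∎)
  where
  open ≡-Reasoning
  either : ∀ {P : Set} (d : Dec P) → 𝟙 d ⊕ 𝟙 (¬? d) ≡ 1ℚ
  either (yes _) = refl
  either (no _) = refl

module _ {n κ : ℕ} {S : Str n} (a : Acyclic S) (q : Fin n) where

  Under : Fin n → Set
  Under z = Reach S (λ _ → ⊤) q z × z ≢ q

  under? : ∀ z → Dec (Under z)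
  under? z = reach? a (λ _ → yes tt) q z ×-dec ¬? (z Fin.≟ q)

  under-depth : ∀ {z} → Under z → depth a q < depth a z
  under-depth (here , z≢q) = contradiction refl z≢q
  under-depth (there e _ r , _) = ℕₚ.≤-<-trans (Reach-depth a r) (depth-< a e)

  ¬under : ∀ {z} → depth a z ≤ depth a q → ¬ Under z
  ¬under l u = ℕₚ.<⇒≱ (under-depth u) l

  child≢ : ∀ {z u} → S z ≡ just u → z ≢ u
  child≢ e refl = ℕₚ.<-irrefl refl (depth-< a e)

  -- At every vertex either all incident edges are recoloured or none is,
  -- except at q, where the edge to the parent has a colour fixed by the transposition.
  under-proper : ∀ c₁ c₂ (x : Vec (Fin κ) n) → Proper S x → c₁ ≢ lookup x q → c₂ ≢ lookup x q →
    Proper S (flip under? c₁ c₂ x)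
  under-proper c₁ c₂ x pr c₁≢ c₂≢ u z z′ ne i i′ with reach? a (λ _ → yes tt) q u
  ... | yes r = λ e → pr u z z′ ne i i′ (tr-injective c₁ c₂ (trans (sym (moved i)) (trans e (moved i′))))
    where
    moved : ∀ {z} → Inc S z u → lookup (flip under? c₁ c₂ x) z ≡ tr c₁ c₂ (lookup x z)
    moved {z} (s , e , inj₂ refl) = flip-in under? c₁ c₂ x (there e tt r , λ { refl → ℕₚ.<⇒≱ (depth-< a e) (Reach-depth a r) })
    moved {z} (s , e , inj₁ refl) with z Fin.≟ q
    ... | yes refl = trans (flip-out under? c₁ c₂ x (λ (_ , z≢q) → z≢q refl)) (sym (tr-other (≢-sym c₁≢) (≢-sym c₂≢)))
    ... | no z≢q = flip-in under? c₁ c₂ x (r , z≢q)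
  ... | no ¬r = λ e → pr u z z′ ne i i′ (trans (sym (kept i)) (trans e (kept i′)))
    where
    kept : ∀ {z} → Inc S z u → lookup (flip under? c₁ c₂ x) z ≡ lookup x z
    kept (s , e , inj₁ refl) = flip-out under? c₁ c₂ x (¬r ∘ proj₁)
    kept (s , e , inj₂ refl) = flip-out under? c₁ c₂ x (λ (r , z≢q) → ¬r (proj₂ (Reach-parent z≢q e r)))

module ChainBound {n κ : ℕ} {S : Str n} (a : Acyclic S) {p r w : Fin n} (rp : S r ≡ just p) (wr : S w ≡ just r) where

  private
    V : Finite (Vec (Fin κ) n)
    V = vecFinite κ n

    d : Fin n → ℕ
    d = depth a

    w≢r : w ≢ r
    w≢r refl = ℕₚ.<-irrefl refl (depth-< a wr)

  Ch : Vec (Fin κ) n → Fin n → Set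
  Ch x = Chain a w (lookup x w) (lookup x r) x

  ch? : ∀ x z → Dec (Ch x z)
  ch? x = chain? a w (lookup x w) (lookup x r) x

  N : ℚ
  N = ∑ V (λ x → 𝟙 (proper? S x))

  -- Relative to N, the probability that z lies on the chain.
  m : Fin n → ℚ
  m z = ∑ V (λ x → 𝟙 (proper? S x) ⊛ 𝟙 (ch? x z))

  0≤m : ∀ z → 0ℚ ≼ m z
  0≤m z = sumL-nonneg (enum V) (λ x → *-nonneg (𝟙-nonneg (proper? S x)) (𝟙-nonneg (ch? x z)))

  m≤N : ∀ z → m z ≼ N
  m≤N z = sumL-mono (enum V) (λ x → ℚₚ.≤-trans (*-mono-≼ˡ (𝟙-nonneg (proper? S x)) (𝟙-≤1 (ch? x z))) (ℚₚ.≤-reflexive (ℚₚ.*-identityʳ (𝟙 (proper? S x)))))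

  0≤N : 0ℚ ≼ N
  0≤N = ℚₚ.≤-trans (0≤m w) (m≤N w)

  m-none : ∀ z → (∀ x → ¬ Ch x z) → m z ≡ 0ℚ
  m-none z h = trans (sumL-cong (enum V) (λ x → trans (cong (𝟙 (proper? S x) ⊛_) (𝟙-no (ch? x z) (h x))) (ℚₚ.*-zeroʳ (𝟙 (proper? S x))))) (sumL-zero (enum V))

  m-root : ∀ z → S z ≡ nothing → m z ≡ 0ℚ
  m-root z e = m-none z (λ x c → just≢nothing (trans (cong S (Reach-root e c)) wr) e)

  module _ {z q : Fin n} (zq : S z ≡ just q) (z≢w : z ≢ w) where

    private
      -- The two chain colours alternate on the way down, so below q the chain continues in the one
      -- that the edge above q does not have.
      target : Vec (Fin κ) n → Fin κ
      target x = if does (lookup x q Fin.≟ lookup x r) then lookup x w else lookup x r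

      PC : Vec (Fin κ) n → Set
      PC x = Proper S x × Ch x q

      pc? : ∀ x → Dec (PC x)
      pc? x = proper? S x ×-dec ch? x q

      VC = V ×-finite finFinite κ

      -- A spare colour γ other than that of q is carried along. `From` counts every colouring whose
      -- chain passes q and continues to z κ - 1 times, `To` counts a colouring whose chain passes q
      -- at most once, as γ is the colour of z; `move` matches the two.
      From To : Vec (Fin κ) n × Fin κ → Set
      From (x , γ) = PC x × γ ≢ lookup x q × lookup x z ≡ target x
      To (x , γ) = PC x × γ ≢ lookup x q × lookup x z ≡ γ

      from? : ∀ xγ → Dec (From xγ)
      from? (x , γ) = pc? x ×-dec ¬? (γ Fin.≟ lookup x q) ×-dec (lookup x z Fin.≟ target x)
      to? : ∀ xγ → Dec (To xγ)
      to? (x , γ) = pc? x ×-dec ¬? (γ Fin.≟ lookup x q) ×-dec (lookup x z Fin.≟ γ)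

      chain-edge : ∀ {x v} → Ch x v → ∃[ s ] S v ≡ just s
      chain-edge here = r , wr
      chain-edge (there e _ _) = _ , e

      chain-color : ∀ {x v} → Ch x v → OneOf (lookup x w) (lookup x r) (lookup x v)
      chain-color here = inj₁ refl
      chain-color (there _ o _) = o

      target≢ : ∀ x → Proper S x → target x ≢ lookup x q
      target≢ x pr with lookup x q Fin.≟ lookup x r
      ... | yes e = λ h → pr r w r w≢r (r , wr , inj₂ refl) (p , rp , inj₁ refl) (trans h e)
      ... | no ne = λ h → ne (sym h)

      chain-target : ∀ x → Proper S x → Ch x z → Ch x q × lookup x z ≡ target x
      chain-target x pr c with Reach-parent z≢w zq c
      ... | o , cq = cq , eq o (chain-color {x} cq)
        where
        xz≢xq : lookup x z ≢ lookup x q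
        xz≢xq = pr q z q (child≢ {κ = κ} a q zq) (q , zq , inj₂ refl) (let (s , e) = chain-edge {x} cq in s , e , inj₁ refl)
        eq : OneOf (lookup x w) (lookup x r) (lookup x z) → OneOf (lookup x w) (lookup x r) (lookup x q) → lookup x z ≡ target x
        eq o o′ with lookup x q Fin.≟ lookup x r
        eq (inj₁ e) o′ | yes _ = e
        eq (inj₂ e) o′ | yes h = contradiction (trans e (sym h)) xz≢xq
        eq (inj₂ e) o′ | no _ = e
        eq (inj₁ e) (inj₁ e′) | no _ = contradiction (trans e (sym e′)) xz≢xq
        eq (inj₁ e) (inj₂ e′) | no h = contradiction e′ h

      move : Vec (Fin κ) n × Fin κ → Vec (Fin κ) n × Fin κ
      move (x , γ) = flip (under? {κ = κ} a q) (target x) γ x , γ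

      module _ (x : Vec (Fin κ) n) (γ : Fin κ) (cq : Ch x q) where
        x′ = flip (under? {κ = κ} a q) (target x) γ x

        -- Recoloured vertices lie strictly below q. All of w, r and the chain from w to q are at
        -- most as deep as q, so the chain up to q and its next colour survive the move.
        kept : ∀ {v} → d v ≤ d q → lookup x′ v ≡ lookup x v
        kept l = flip-out (under? {κ = κ} a q) (target x) γ x (¬under {κ = κ} a q l)

        kept-q : lookup x′ q ≡ lookup x q
        kept-q = kept ℕₚ.≤-refl
        kept-w : lookup x′ w ≡ lookup x w
        kept-w = kept (Reach-depth a cq)
        kept-r : lookup x′ r ≡ lookup x r
        kept-r = kept (ℕₚ.≤-trans (ℕₚ.<⇒≤ (depth-< a wr)) (Reach-depth a cq))

        target-kept : target x′ ≡ target x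
        target-kept rewrite kept-q | kept-r | kept-w = refl

        moved-z : lookup x′ z ≡ tr (target x) γ (lookup x z)
        moved-z = flip-in (under? {κ = κ} a q) (target x) γ x (there zq tt here , child≢ {κ = κ} a q zq)

        chain-kept : Ch x′ q
        chain-kept rewrite kept-w | kept-r = go cq ℕₚ.≤-refl
          where
          go : ∀ {v} → Ch x v → d v ≤ d q → Reach S (λ z → OneOf (lookup x w) (lookup x r) (lookup x′ z)) w v
          go here l = here
          go (there e o c) l = there e (subst (OneOf (lookup x w) (lookup x r)) (sym (kept l)) o) (go c (ℕₚ.≤-trans (ℕₚ.<⇒≤ (depth-< a e)) l))

        move-move : move (move (x , γ)) ≡ (x , γ)
        move-move rewrite target-kept =
          cong (_, γ) (flip-involutive (under? {κ = κ} a q) (under? {κ = κ} a q) (λ _ → id) (λ _ → id) (target x) γ x)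

        pc-kept : Proper S x → γ ≢ lookup x q → PC x′
        pc-kept pr γ≢ = under-proper a q (target x) γ x pr (target≢ x pr) γ≢ , chain-kept

      fwd : ∀ xγ → From xγ → To (move xγ) × move (move xγ) ≡ xγ
      fwd (x , γ) ((pr , cq) , γ≢ , e) =
        (pc-kept x γ cq pr γ≢ , (λ h → γ≢ (trans h (kept-q x γ cq))) , trans (moved-z x γ cq) (trans (cong (tr (target x) γ) e) (tr-left (target x) γ))) ,
        move-move x γ cq

      bwd : ∀ xγ → To xγ → From (move xγ) × move (move xγ) ≡ xγ
      bwd (x , γ) ((pr , cq) , γ≢ , e) =
        (pc-kept x γ cq pr γ≢ , (λ h → γ≢ (trans h (kept-q x γ cq))) ,
          trans (moved-z x γ cq) (trans (cong (tr (target x) γ) e) (trans (tr-right (target x) γ) (sym (target-kept x γ cq))))) ,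
        move-move x γ cq

    -- Transposing two colours other than that of (parent of q, q) strictly below q shows that
    -- the colour of (q, z) is uniform among the remaining κ − 1, independently of the chain up to q.
    chain-decay : fromℕ (κ ∸ 1) ⊛ m z ≼ m q
    chain-decay = begin
      fromℕ (κ ∸ 1) ⊛ m z
        ≤⟨ *-mono-≼ˡ (0≤fromℕ (κ ∸ 1)) (sumL-mono (enum V) (λ x → ℚₚ.≤-trans (ℚₚ.≤-reflexive (sym (𝟙-× (proper? S x) (ch? x z))))
             (𝟙-mono (proper? S x ×-dec ch? x z) (hit? x) (λ (pr , c) → let (cq , e) = chain-target x pr c in (pr , cq) , e)))) ⟩
      fromℕ (κ ∸ 1) ⊛ ∑ V (λ x → 𝟙 (hit? x))
        ≡⟨ sumL-⊛ (enum V) (fromℕ (κ ∸ 1)) _ ⟨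
      ∑ V (λ x → fromℕ (κ ∸ 1) ⊛ 𝟙 (hit? x))
        ≡⟨ sumL-cong (enum V) (λ x → trans (cong (_⊛ 𝟙 (hit? x)) (sym (others-count (lookup x q))))
             (trans (ℚₚ.*-comm _ (𝟙 (hit? x))) (trans (sym (sumL-⊛ (allFin κ) (𝟙 (hit? x)) _)) (sumL-cong (allFin κ) (split x))))) ⟩
      ∑ V (λ x → sumL (allFin κ) (λ γ → 𝟙 (from? (x , γ)) ⊛ 1ℚ))
        ≡⟨ ∑-× V (finFinite κ) (λ xγ → 𝟙 (from? xγ) ⊛ 1ℚ) ⟨
      ∑ VC (λ xγ → 𝟙 (from? xγ) ⊛ 1ℚ)
        ≡⟨ reindex VC VC from? to? move move fwd bwd (λ _ → 1ℚ) ⟩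
      ∑ VC (λ xγ → 𝟙 (to? xγ) ⊛ 1ℚ)
        ≡⟨ ∑-× V (finFinite κ) (λ xγ → 𝟙 (to? xγ) ⊛ 1ℚ) ⟩
      ∑ V (λ x → sumL (allFin κ) (λ γ → 𝟙 (to? (x , γ)) ⊛ 1ℚ))
        ≤⟨ sumL-mono (enum V) (λ x → sumL-mono (allFin κ) (λ γ → ℚₚ.≤-trans (ℚₚ.≤-reflexive (ℚₚ.*-identityʳ (𝟙 (to? (x , γ)))))
             (𝟙-mono (to? (x , γ)) (pc? x ×-dec (γ Fin.≟ lookup x z)) (λ (pc , _ , e) → pc , sym e)))) ⟩
      ∑ V (λ x → sumL (allFin κ) (λ γ → 𝟙 (pc? x ×-dec (γ Fin.≟ lookup x z))))
        ≡⟨ sumL-cong (enum V) (λ x → trans (sumL-cong (allFin κ) (λ γ → 𝟙-× (pc? x) (γ Fin.≟ lookup x z)))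
             (trans (sumL-⊛ (allFin κ) (𝟙 (pc? x)) (λ γ → 𝟙 (γ Fin.≟ lookup x z)))
               (trans (cong (𝟙 (pc? x) ⊛_) (enum-once (finFinite κ) (lookup x z))) (trans (ℚₚ.*-identityʳ (𝟙 (pc? x))) (𝟙-× (proper? S x) (ch? x q)))))) ⟩
      m q ∎
      where
      open ℚₚ.≤-Reasoning
      hit? : ∀ x → Dec (PC x × lookup x z ≡ target x)
      hit? x = pc? x ×-dec (lookup x z Fin.≟ target x)
      split : ∀ x γ → 𝟙 (hit? x) ⊛ 𝟙 (¬? (γ Fin.≟ lookup x q)) ≡ 𝟙 (from? (x , γ)) ⊛ 1ℚ
      split x γ = trans (sym (𝟙-× (hit? x) (¬? (γ Fin.≟ lookup x q))))
        (trans (𝟙-cong (hit? x ×-dec ¬? (γ Fin.≟ lookup x q)) (from? (x , γ)) (λ ((pc , e) , ne) → pc , ne , e) (λ (pc , ne , e) → (pc , e) , ne))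
          (sym (ℚₚ.*-identityʳ (𝟙 (from? (x , γ))))))

  expectedLength : ℚ
  expectedLength = sumL (allFin n) m

  expectedLength-∑ : ∑ V (λ x → 𝟙 (proper? S x) ⊛ sumL (allFin n) (λ z → 𝟙 (ch? x z))) ≡ expectedLength
  expectedLength-∑ = trans (sumL-cong (enum V) (λ x → sym (sumL-⊛ (allFin n) (𝟙 (proper? S x)) _))) (sumL-swap (enum V) (allFin n) _)

  private
    k : ℚ
    k = fromℕ (κ ∸ 1)

  module _ (D : ℕ) (few-kids : ∀ {q s} → S q ≡ just s → length (kids S q) ≤ D) where

    private
      -- The value at the parent of z, or 0 at a root. Being a sum it can be exchanged with the sum
      -- over z, which replaces one parent per vertex by at most D children per vertex.
      parents : Fin n → (Fin n → ℚ) → ℚ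
      parents z f = sumL (allFin n) (λ q → 𝟙 (child? S q z) ⊛ f q)

      parents-just : ∀ {z q} → S z ≡ just q → ∀ f → parents z f ≡ f q
      parents-just {z} e f = ∑-unique (finFinite n) (λ q → child? S q z) f e (λ q′ e′ → just-injective (trans (sym e′) e))

      0≤parents : ∀ z f → (∀ q → 0ℚ ≼ f q) → 0ℚ ≼ parents z f
      0≤parents z f h = sumL-nonneg (allFin n) (λ q → *-nonneg (𝟙-nonneg (child? S q z)) (h q))

      parents-sum : ∀ (c : Fin n → ℚ) → (∀ q → 0ℚ ≼ c q) →
        sumL (allFin n) (λ z → parents z (λ q → c q ⊛ m q)) ≼ fromℕ D ⊛ sumL (allFin n) (λ q → c q ⊛ m q)
      parents-sum c 0≤c = begin
        sumL (allFin n) (λ z → sumL (allFin n) (λ q → 𝟙 (child? S q z) ⊛ (c q ⊛ m q)))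
          ≡⟨ sumL-swap (allFin n) (allFin n) _ ⟩
        sumL (allFin n) (λ q → sumL (allFin n) (λ z → 𝟙 (child? S q z) ⊛ (c q ⊛ m q)))
          ≡⟨ sumL-cong (allFin n) (λ q → trans (sym (sumL-filterᵇ (does ∘ child? S q) (allFin n) (λ _ → c q ⊛ m q))) (sumL-const (kids S q) (c q ⊛ m q))) ⟩
        sumL (allFin n) (λ q → fromℕ (length (kids S q)) ⊛ (c q ⊛ m q))
          ≤⟨ sumL-mono (allFin n) (λ q → few q (S q) refl) ⟩
        sumL (allFin n) (λ q → fromℕ D ⊛ (c q ⊛ m q))
          ≡⟨ sumL-⊛ (allFin n) (fromℕ D) _ ⟩
        fromℕ D ⊛ sumL (allFin n) (λ q → c q ⊛ m q) ∎
        where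
        open ℚₚ.≤-Reasoning
        few : ∀ q s → S q ≡ s → fromℕ (length (kids S q)) ⊛ (c q ⊛ m q) ≼ fromℕ D ⊛ (c q ⊛ m q)
        few q (just s) e = *-mono-≼ʳ (*-nonneg (0≤c q) (0≤m q)) (fromℕ-mono (few-kids e))
        few q nothing e rewrite m-root q e | ℚₚ.*-zeroʳ (c q) =
          ℚₚ.≤-reflexive (trans (ℚₚ.*-zeroʳ (fromℕ (length (kids S q)))) (sym (ℚₚ.*-zeroʳ (fromℕ D))))

    -- Every vertex on the chain has on average at most D / (κ − 1) children on it.
    length-recurrence : fromℕ (κ ∸ 1) ⊛ expectedLength ≼ fromℕ (κ ∸ 1) ⊛ N ⊕ fromℕ D ⊛ expectedLength
    length-recurrence = begin
      k ⊛ expectedLength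
        ≡⟨ sumL-⊛ (allFin n) k m ⟨
      sumL (allFin n) (λ z → k ⊛ m z)
        ≤⟨ sumL-mono (allFin n) (λ z → point z (S z) refl) ⟩
      sumL (allFin n) (λ z → 𝟙 (z Fin.≟ w) ⊛ (k ⊛ N) ⊕ parents z (λ q → 1ℚ ⊛ m q))
        ≡⟨ sumL-⊕ (allFin n) _ _ ⟩
      sumL (allFin n) (λ z → 𝟙 (z Fin.≟ w) ⊛ (k ⊛ N)) ⊕ sumL (allFin n) (λ z → parents z (λ q → 1ℚ ⊛ m q))
        ≤⟨ ℚₚ.+-mono-≤ (ℚₚ.≤-reflexive (∑-δ (finFinite n) w (λ _ → k ⊛ N))) (parents-sum (λ _ → 1ℚ) (λ _ → 0≤1)) ⟩
      k ⊛ N ⊕ fromℕ D ⊛ sumL (allFin n) (λ q → 1ℚ ⊛ m q)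
        ≡⟨ cong (λ s → k ⊛ N ⊕ fromℕ D ⊛ s) (sumL-cong (allFin n) (λ q → ℚₚ.*-identityˡ (m q))) ⟩
      k ⊛ N ⊕ fromℕ D ⊛ expectedLength ∎
      where
      open ℚₚ.≤-Reasoning
      0≤kN : 0ℚ ≼ k ⊛ N
      0≤kN = *-nonneg (0≤fromℕ (κ ∸ 1)) 0≤N
      0≤1m : ∀ q → 0ℚ ≼ 1ℚ ⊛ m q
      0≤1m q = *-nonneg 0≤1 (0≤m q)
      point : ∀ z s → S z ≡ s → k ⊛ m z ≼ 𝟙 (z Fin.≟ w) ⊛ (k ⊛ N) ⊕ parents z (λ q → 1ℚ ⊛ m q)
      point z nothing e rewrite m-root z e = ℚₚ.≤-trans (ℚₚ.≤-reflexive (ℚₚ.*-zeroʳ k))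
        (ℚₚ.+-mono-≤ (*-nonneg (𝟙-nonneg (z Fin.≟ w)) 0≤kN) (0≤parents z _ 0≤1m))
      point z (just q) e with z Fin.≟ w
      ... | yes refl = ℚₚ.≤-trans (ℚₚ.≤-reflexive (sym (ℚₚ.+-identityʳ (k ⊛ m w)))) (ℚₚ.+-mono-≤
              (ℚₚ.≤-trans (*-mono-≼ˡ (0≤fromℕ (κ ∸ 1)) (m≤N w)) (ℚₚ.≤-reflexive (sym (ℚₚ.*-identityˡ (k ⊛ N))))) (0≤parents z _ 0≤1m))
      ... | no z≢w = ℚₚ.≤-trans (chain-decay e z≢w) (ℚₚ.≤-reflexive (sym
              (trans (cong₂ _⊕_ (ℚₚ.*-zeroˡ (k ⊛ N)) (trans (parents-just e (λ q → 1ℚ ⊛ m q)) (ℚₚ.*-identityˡ (m q)))) (ℚₚ.+-identityˡ (m q)))))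

    module _ (0<k : 0 < κ ∸ 1) (D≤k : D ≤ κ ∸ 1) where

      private
        level : ℕ → ℚ
        level i = sumL (allFin n) (λ z → 𝟙 (d z ℕ.≟ d w + i) ⊛ m z)

        tail : ℕ → ℚ
        tail i = sumL (allFin n) (λ z → 𝟙 (d w + i ℕ.≤? d z) ⊛ m z)

        cancel-k : ∀ {x y} → k ⊛ x ≼ k ⊛ y → x ≼ y
        cancel-k = ℚₚ.*-cancelˡ-≤-pos k {{fromℕ-pos 0<k}}

        0≤level : ∀ i → 0ℚ ≼ level i
        0≤level i = sumL-nonneg (allFin n) (λ z → *-nonneg (𝟙-nonneg (d z ℕ.≟ d w + i)) (0≤m z))

        same-level : ∀ {x z} → Ch x z → d z ≡ d w → z ≡ w
        same-level here _ = refl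
        same-level (there e _ c) h = contradiction (subst (d _ <_) h (depth-< a e)) (ℕₚ.≤⇒≯ (Reach-depth a c))

        level-zero : level 0 ≼ N
        level-zero = ℚₚ.≤-trans (sumL-mono (allFin n) point) (ℚₚ.≤-reflexive (∑-δ (finFinite n) w (λ _ → N)))
          where
          point : ∀ z → 𝟙 (d z ℕ.≟ d w + 0) ⊛ m z ≼ 𝟙 (z Fin.≟ w) ⊛ N
          point z with z Fin.≟ w
          ... | yes refl = ℚₚ.≤-trans (*-mono-≼ʳ (0≤m z) (𝟙-≤1 (d z ℕ.≟ d w + 0)))
                 (ℚₚ.≤-trans (ℚₚ.≤-reflexive (ℚₚ.*-identityˡ (m z))) (ℚₚ.≤-trans (m≤N z) (ℚₚ.≤-reflexive (sym (ℚₚ.*-identityˡ N)))))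
          ... | no z≢w = ℚₚ.≤-reflexive (trans (vanish (d z ℕ.≟ d w + 0)) (sym (ℚₚ.*-zeroˡ N)))
            where
            vanish : (e : Dec (d z ≡ d w + 0)) → 𝟙 e ⊛ m z ≡ 0ℚ
            vanish (no _) = ℚₚ.*-zeroˡ (m z)
            vanish (yes h) = trans (cong (1ℚ ⊛_) (m-none z (λ x c → z≢w (same-level {x} c (trans h (ℕₚ.+-identityʳ (d w))))))) (ℚₚ.*-zeroʳ 1ℚ)

        -- A vertex of level i passes the chain on to each of its at most D children with
        -- probability at most 1/(κ - 1), and D ≤ κ - 1 keeps the expected size from growing.
        level-suc : ∀ i → level (suc i) ≼ level i
        level-suc i = cancel-k (begin
          k ⊛ level (suc i)
            ≡⟨ sumL-⊛ (allFin n) k _ ⟨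
          sumL (allFin n) (λ z → k ⊛ (𝟙 (d z ℕ.≟ d w + suc i) ⊛ m z))
            ≤⟨ sumL-mono (allFin n) (λ z → point z (S z) refl (d z ℕ.≟ d w + suc i)) ⟩
          sumL (allFin n) (λ z → parents z (λ q → 𝟙 (d q ℕ.≟ d w + i) ⊛ m q))
            ≤⟨ parents-sum (λ q → 𝟙 (d q ℕ.≟ d w + i)) (λ q → 𝟙-nonneg (d q ℕ.≟ d w + i)) ⟩
          fromℕ D ⊛ level i
            ≤⟨ *-mono-≼ʳ (0≤level i) (fromℕ-mono D≤k) ⟩
          k ⊛ level i ∎)
          where
          open ℚₚ.≤-Reasoning
          nonneg : ∀ q → 0ℚ ≼ 𝟙 (d q ℕ.≟ d w + i) ⊛ m q
          nonneg q = *-nonneg (𝟙-nonneg (d q ℕ.≟ d w + i)) (0≤m q)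
          point : ∀ z s → S z ≡ s → (h : Dec (d z ≡ d w + suc i)) → k ⊛ (𝟙 h ⊛ m z) ≼ parents z (λ q → 𝟙 (d q ℕ.≟ d w + i) ⊛ m q)
          point z s e (no _) = ℚₚ.≤-trans (ℚₚ.≤-reflexive (trans (cong (k ⊛_) (ℚₚ.*-zeroˡ (m z))) (ℚₚ.*-zeroʳ k))) (0≤parents z _ nonneg)
          point z nothing e (yes h) = ℚₚ.≤-trans (ℚₚ.≤-reflexive (trans (cong (λ t → k ⊛ (1ℚ ⊛ t)) (m-root z e)) (ℚₚ.*-zeroʳ k))) (0≤parents z _ nonneg)
          point z (just q) e (yes h) = begin
            k ⊛ (1ℚ ⊛ m z)                      ≡⟨ cong (k ⊛_) (ℚₚ.*-identityˡ (m z)) ⟩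
            k ⊛ m z                             ≤⟨ chain-decay e (λ { refl → ℕₚ.m≢1+m+n (d w) (trans h (ℕₚ.+-suc (d w) i)) }) ⟩
            m q                                 ≡⟨ ℚₚ.*-identityˡ (m q) ⟨
            1ℚ ⊛ m q                            ≡⟨ cong (_⊛ m q) (𝟙-yes (d q ℕ.≟ d w + i) (ℕₚ.suc-injective (trans (sym (depth-child a e)) (trans h (ℕₚ.+-suc (d w) i))))) ⟨
            𝟙 (d q ℕ.≟ d w + i) ⊛ m q           ≡⟨ parents-just e (λ q → 𝟙 (d q ℕ.≟ d w + i) ⊛ m q) ⟨
            parents z (λ q → 𝟙 (d q ℕ.≟ d w + i) ⊛ m q) ∎

        level≤N : ∀ i → level i ≼ N
        level≤N zero = level-zero
        level≤N (suc i) = ℚₚ.≤-trans (level-suc i) (level≤N i)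

        deep : ∀ L z → d w + L ≤ d z → fromℕ ((κ ∸ 1) ℕ.^ L) ⊛ m z ≼ N
        deep zero z _ = ℚₚ.≤-trans (ℚₚ.≤-reflexive (ℚₚ.*-identityˡ (m z))) (m≤N z)
        deep (suc L) z l = go (S z) refl
          where
          open ℚₚ.≤-Reasoning
          lem : ∀ a b c → (a ⊛ b) ⊛ c ≡ b ⊛ (a ⊛ c)
          lem = solve-∀ ℚ-ring
          l′ : suc (d w + L) ≤ d z
          l′ = subst (_≤ d z) (ℕₚ.+-suc (d w) L) l
          go : ∀ s → S z ≡ s → fromℕ ((κ ∸ 1) ℕ.^ suc L) ⊛ m z ≼ N
          go nothing e = ℚₚ.≤-trans (ℚₚ.≤-reflexive (trans (cong (fromℕ ((κ ∸ 1) ℕ.^ suc L) ⊛_) (m-root z e)) (ℚₚ.*-zeroʳ (fromℕ ((κ ∸ 1) ℕ.^ suc L))))) 0≤N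
          go (just q) e = begin
            fromℕ ((κ ∸ 1) ℕ.* (κ ∸ 1) ℕ.^ L) ⊛ m z         ≡⟨ cong (_⊛ m z) (fromℕ-homo-* (κ ∸ 1) ((κ ∸ 1) ℕ.^ L)) ⟩
            (k ⊛ fromℕ ((κ ∸ 1) ℕ.^ L)) ⊛ m z               ≡⟨ lem k (fromℕ ((κ ∸ 1) ℕ.^ L)) (m z) ⟩
            fromℕ ((κ ∸ 1) ℕ.^ L) ⊛ (k ⊛ m z)               ≤⟨ *-mono-≼ˡ (0≤fromℕ ((κ ∸ 1) ℕ.^ L)) (chain-decay e (λ { refl → ℕₚ.<⇒≱ l′ (ℕₚ.m≤m+n (d w) L) })) ⟩
            fromℕ ((κ ∸ 1) ℕ.^ L) ⊛ m q                     ≤⟨ deep L q (ℕₚ.≤-pred (subst (suc (d w + L) ≤_) (depth-child a e) l′)) ⟩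
            N ∎

        expectedLength≤tail : ∀ L → expectedLength ≼ fromℕ L ⊛ N ⊕ tail L
        expectedLength≤tail zero = begin
          expectedLength            ≤⟨ sumL-mono (allFin n) (λ z → point z (d w + 0 ℕ.≤? d z)) ⟩
          tail 0                    ≡⟨ ℚₚ.+-identityˡ (tail 0) ⟨
          0ℚ ⊕ tail 0               ≡⟨ cong (_⊕ tail 0) (ℚₚ.*-zeroˡ N) ⟨
          fromℕ 0 ⊛ N ⊕ tail 0      ∎
          where
          open ℚₚ.≤-Reasoning
          point : ∀ z (e : Dec (d w + 0 ≤ d z)) → m z ≼ 𝟙 e ⊛ m z
          point z (yes _) = ℚₚ.≤-reflexive (sym (ℚₚ.*-identityˡ (m z)))
          point z (no h) = ℚₚ.≤-reflexive (trans (m-none z (λ x c → h (subst (_≤ d z) (sym (ℕₚ.+-identityʳ (d w))) (Reach-depth a c)))) (sym (ℚₚ.*-zeroˡ (m z))))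
        expectedLength≤tail (suc L) = begin
          expectedLength                              ≤⟨ expectedLength≤tail L ⟩
          fromℕ L ⊛ N ⊕ tail L                        ≤⟨ ℚₚ.+-monoʳ-≤ (fromℕ L ⊛ N) (sumL-mono (allFin n) point) ⟩
          fromℕ L ⊛ N ⊕ sumL (allFin n) (λ z → 𝟙 (d z ℕ.≟ d w + L) ⊛ m z ⊕ 𝟙 (d w + suc L ℕ.≤? d z) ⊛ m z)
                                                      ≡⟨ cong (fromℕ L ⊛ N ⊕_) (sumL-⊕ (allFin n) _ _) ⟩
          fromℕ L ⊛ N ⊕ (level L ⊕ tail (suc L))      ≤⟨ ℚₚ.+-monoʳ-≤ (fromℕ L ⊛ N) (ℚₚ.+-monoˡ-≤ (tail (suc L)) (level≤N L)) ⟩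
          fromℕ L ⊛ N ⊕ (N ⊕ tail (suc L))            ≡⟨ lem (fromℕ L) N (tail (suc L)) ⟩
          (1ℚ ⊕ fromℕ L) ⊛ N ⊕ tail (suc L)           ≡⟨ cong (λ s → s ⊛ N ⊕ tail (suc L)) (fromℕ-suc L) ⟨
          fromℕ (suc L) ⊛ N ⊕ tail (suc L)            ∎
          where
          open ℚₚ.≤-Reasoning
          lem : ∀ l n t → l ⊛ n ⊕ (n ⊕ t) ≡ (1ℚ ⊕ l) ⊛ n ⊕ t
          lem = solve-∀ ℚ-ring
          cover : ∀ z (e : Dec (d w + L ≤ d z)) (f : Dec (d z ≡ d w + L)) (g : Dec (d w + suc L ≤ d z)) → 𝟙 e ≼ 𝟙 f ⊕ 𝟙 g
          cover z (no _) f g = ℚₚ.+-mono-≤ (𝟙-nonneg f) (𝟙-nonneg g)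
          cover z (yes h) f g with ℕₚ.m≤n⇒m<n∨m≡n h
          ... | inj₂ e = ℚₚ.+-mono-≤ (ℚₚ.≤-reflexive (sym (𝟙-yes f (sym e)))) (𝟙-nonneg g)
          ... | inj₁ l = ℚₚ.+-mono-≤ (𝟙-nonneg f) (ℚₚ.≤-reflexive (sym (𝟙-yes g (subst (_≤ d z) (sym (ℕₚ.+-suc (d w) L)) l))))
          point : ∀ z → 𝟙 (d w + L ℕ.≤? d z) ⊛ m z ≼ 𝟙 (d z ℕ.≟ d w + L) ⊛ m z ⊕ 𝟙 (d w + suc L ℕ.≤? d z) ⊛ m z
          point z = ℚₚ.≤-trans (*-mono-≼ʳ (0≤m z) (cover z (d w + L ℕ.≤? d z) (d z ℕ.≟ d w + L) (d w + suc L ℕ.≤? d z)))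
            (ℚₚ.≤-reflexive (ℚₚ.*-distribʳ-+ (m z) (𝟙 (d z ℕ.≟ d w + L)) (𝟙 (d w + suc L ℕ.≤? d z))))

      -- The first L levels contribute at most N each. Below them there are at most n vertices of
      -- weight at most N/(κ - 1)^L, together at most one more N by the choice of L.
      length-log : ∀ L → n ≤ (κ ∸ 1) ℕ.^ L → expectedLength ≼ fromℕ (suc L) ⊛ N
      length-log L n≤ = begin
        expectedLength              ≤⟨ expectedLength≤tail L ⟩
        fromℕ L ⊛ N ⊕ tail L        ≤⟨ ℚₚ.+-monoʳ-≤ (fromℕ L ⊛ N) (ℚₚ.*-cancelˡ-≤-pos b {{fromℕ-pos 0<b}} tail-bound) ⟩
        fromℕ L ⊛ N ⊕ N             ≡⟨ lem (fromℕ L) N ⟩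
        (1ℚ ⊕ fromℕ L) ⊛ N          ≡⟨ cong (_⊛ N) (fromℕ-suc L) ⟨
        fromℕ (suc L) ⊛ N           ∎
        where
        open ℚₚ.≤-Reasoning
        b : ℚ
        b = fromℕ ((κ ∸ 1) ℕ.^ L)
        0<b : 0 < (κ ∸ 1) ℕ.^ L
        0<b = ℕₚ.m^n>0 (κ ∸ 1) {{ℕ.>-nonZero 0<k}} L
        lem : ∀ l n → l ⊛ n ⊕ n ≡ (1ℚ ⊕ l) ⊛ n
        lem = solve-∀ ℚ-ring
        point : ∀ z (e : Dec (d w + L ≤ d z)) → b ⊛ (𝟙 e ⊛ m z) ≼ N
        point z (yes h) = ℚₚ.≤-trans (ℚₚ.≤-reflexive (cong (b ⊛_) (ℚₚ.*-identityˡ (m z)))) (deep L z h)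
        point z (no _) = ℚₚ.≤-trans (ℚₚ.≤-reflexive (trans (cong (b ⊛_) (ℚₚ.*-zeroˡ (m z))) (ℚₚ.*-zeroʳ b))) 0≤N
        tail-bound : b ⊛ tail L ≼ b ⊛ N
        tail-bound = begin
          b ⊛ tail L                                                  ≡⟨ sumL-⊛ (allFin n) b _ ⟨
          sumL (allFin n) (λ z → b ⊛ (𝟙 (d w + L ℕ.≤? d z) ⊛ m z))    ≤⟨ sumL-mono (allFin n) (λ z → point z (d w + L ℕ.≤? d z)) ⟩
          sumL (allFin n) (λ _ → N)                                   ≡⟨ sumL-const (allFin n) N ⟩
          fromℕ (length (allFin n)) ⊛ N                               ≡⟨ cong (λ l → fromℕ l ⊛ N) (length-allFin n) ⟩
          fromℕ n ⊛ N                                                 ≤⟨ *-mono-≼ʳ 0≤N (fromℕ-mono n≤) ⟩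
          b ⊛ N                                                       ∎

-- The rounded-up logarithm

n≤b^n : ∀ {b} → 2 ≤ b → ∀ n → n ≤ b ℕ.^ n
n≤b^n 2≤b zero = ℕ.z≤n
n≤b^n {b} 2≤b (suc n) = begin
  suc n             ≤⟨ ℕ.s≤s (n≤b^n 2≤b n) ⟩
  1 + b ℕ.^ n       ≤⟨ ℕₚ.+-monoˡ-≤ (b ℕ.^ n) (ℕₚ.m^n>0 b {{ℕ.>-nonZero (ℕₚ.<-≤-trans (ℕ.s≤s ℕ.z≤n) 2≤b)}} n) ⟩
  b ℕ.^ n + b ℕ.^ n ≡⟨ cong (λ t → b ℕ.^ n + t) (ℕₚ.+-identityʳ (b ℕ.^ n)) ⟨
  2 ℕ.* b ℕ.^ n     ≤⟨ ℕₚ.*-monoˡ-≤ (b ℕ.^ n) 2≤b ⟩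
  b ℕ.* b ℕ.^ n     ∎
  where open ℕₚ.≤-Reasoning

-- n ≤ b ^ (k + f), as a record so that the arguments can be recovered by unification
record Suffices (b n f k : ℕ) : Set where
  constructor suffices
  field sufficient : n ≤ b ℕ.^ (k + f)

-- The search loop of ceilLog is local to its definition, so its property is
-- proved for every function with the same defining equations.
search-spec : (go : ℕ → ℕ → ℕ → ℕ → ℕ) → (∀ b n k → go b n 0 k ≡ k) →
  (∀ b n f k → go b n (suc f) k ≡ (if n ≤ᵇ b ℕ.^ k then k else go b n f (suc k))) →
  ∀ b n f k → Suffices b n f k → Suffices b n 0 (go b n f k)
search-spec go e₀ e₁ b n zero k h rewrite e₀ b n k = h
search-spec go e₀ e₁ b n (suc f) k (suffices h) rewrite e₁ b n f k with n ≤ᵇ b ℕ.^ k in eq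
... | true = suffices (subst (λ e → n ≤ b ℕ.^ e) (sym (ℕₚ.+-identityʳ k)) (ℕₚ.≤ᵇ⇒≤ n (b ℕ.^ k) (subst T (sym eq) tt)))
... | false = search-spec go e₀ e₁ b n f (suc k) (suffices (subst (λ e → n ≤ b ℕ.^ e) (ℕₚ.+-suc k f) h))

-- Abstracting suc m and 1 turns the arguments of the loop into variables, so that
-- the loop itself is found by unification.
mutual
  searchLoop : ℕ → ℕ → ℕ → ℕ → ℕ
  searchLoop = _

  ceilLog-suffices : ∀ {b} → 2 ≤ b → ∀ n → Suffices b n 0 (ceilLog b n)
  ceilLog-suffices 2≤b zero = suffices ℕ.z≤n
  ceilLog-suffices {b} 2≤b (suc m) with suc m ≤ᵇ 1 in eq
  ... | true = suffices (ℕₚ.≤ᵇ⇒≤ (suc m) 1 (subst T (sym eq) tt))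
  ... | false with suc m | 1 | suffices {b} {suc m} {m} {1} (n≤b^n 2≤b (suc m))
  ...   | n | k | h = search-spec searchLoop (λ _ _ _ → refl) (λ _ _ _ _ → refl) b n m k h

-- The search tests the exponents 0, ..., n - 1 and, if all of them fail, returns n untested. That
-- last answer is correct by `n≤b^n`.
ceilLog-spec : ∀ {b} → 2 ≤ b → ∀ n → n ≤ b ℕ.^ ceilLog b n
ceilLog-spec {b} 2≤b n = subst (λ e → n ≤ b ℕ.^ e) (ℕₚ.+-identityʳ (ceilLog b n)) (Suffices.sufficient (ceilLog-suffices 2≤b n))

-- Changing a single parent pointer

module _ {n : ℕ} where

  abstract
    setS : Str n → Fin n → Maybe (Fin n) → Str n
    setS S v m z = if does (z Fin.≟ v) then m else S z

    setS-same : ∀ S v m → setS S v m v ≡ m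
    setS-same S v m = cong (if_then m else S v) (dec-true (v Fin.≟ v) refl)

    setS-other : ∀ S v m {z} → z ≢ v → setS S v m z ≡ S z
    setS-other S v m {z} ne = cong (if_then m else S z) (dec-false (z Fin.≟ v) ne)

  -- Raising the ranks in the tree of r by rank p + 1 lifts r above p. Other edges lie inside or
  -- outside this tree and keep their inequalities.
  insert-link : ∀ {S} → Acyclic S → ∀ {p r} → S r ≡ nothing → ¬ Reach S (λ _ → ⊤) r p → Link S (setS S r (just p)) p r
  insert-link {S} a {p} {r} root ¬below = record
    { root⁻ = root
    ; edge⁺ = setS-same S r (just p)
    ; same = λ z≢r → sym (setS-other S r (just p) z≢r)
    ; acyclic⁺ = record { rank = λ z → rank′ z (below? z) ; rank-< = λ {z} {q} e → dec (z Fin.≟ r) e } }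
    where
    open Acyclic a
    below? : ∀ z → Dec (Reach S (λ _ → ⊤) r z)
    below? = reach? a (λ _ → yes tt) r
    rank′ : ∀ z → Dec (Reach S (λ _ → ⊤) r z) → ℕ
    rank′ z (yes _) = rank z + suc (rank p)
    rank′ z (no _) = rank z
    lt : ∀ {z q} → z ≢ r → S z ≡ just q → ∀ e f → rank′ q e < rank′ z f
    lt z≢r e (yes _) (yes _) = ℕₚ.+-monoˡ-< (suc (rank p)) (rank-< e)
    lt z≢r e (no _) (no _) = rank-< e
    lt z≢r e (yes b) (no ¬b) = contradiction (there e tt b) ¬b
    lt z≢r e (no ¬b) (yes b) = contradiction (proj₂ (Reach-parent z≢r e b)) ¬b
    dec : ∀ {z q} → Dec (z ≡ r) → setS S r (just p) z ≡ just q → rank′ q (below? q) < rank′ z (below? z)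
    dec {z} {q} (no z≢r) e = lt z≢r (trans (sym (setS-other S r (just p) z≢r)) e) (below? q) (below? z)
    dec (yes refl) e with refl ← just-injective (trans (sym (setS-same S r (just p))) e) = top (below? p) (below? r)
      where
      top : ∀ e f → rank′ p e < rank′ r f
      top (yes b) _ = contradiction b ¬below
      top (no _) (yes _) = ℕₚ.m≤n+m (suc (rank p)) (rank r)
      top (no _) (no ¬b) = contradiction here ¬b

  cut-link : ∀ {S} → Acyclic S → ∀ {p r} → S r ≡ just p → Link (setS S r nothing) S p r
  cut-link {S} a {p} {r} e = record
    { root⁻ = setS-same S r nothing ; edge⁺ = e ; same = setS-other S r nothing ; acyclic⁺ = a }

  module _ {S⁻ S⁺ : Str n} {p r : Fin n} (L : Link S⁻ S⁺ p r) where
    open Link L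

    private
      end? : ∀ u → Dec (r ≡ u ⊎ p ≡ u)
      end? u = (r Fin.≟ u) ⊎-dec (p Fin.≟ u)

    degree-link : ∀ u → fromℕ (degree S⁺ u) ≡ fromℕ (degree S⁻ u) ⊕ 𝟙 (end? u)
    degree-link u = begin
      fromℕ (degree S⁺ u)
        ≡⟨ degree-inc acyclic⁺ u ⟨
      sumL (allFin n) (λ z → 𝟙 (inc? S⁺ z u))
        ≡⟨ sumL-cong (allFin n) (λ z → split z (z Fin.≟ r)) ⟩
      sumL (allFin n) (λ z → 𝟙 (inc? S⁻ z u) ⊕ 𝟙 (z Fin.≟ r) ⊛ 𝟙 (end? u))
        ≡⟨ sumL-⊕ (allFin n) _ _ ⟩
      sumL (allFin n) (λ z → 𝟙 (inc? S⁻ z u)) ⊕ sumL (allFin n) (λ z → 𝟙 (z Fin.≟ r) ⊛ 𝟙 (end? u))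
        ≡⟨ cong₂ _⊕_ (degree-inc acyclic⁻ u) (∑-δ (finFinite n) r (λ _ → 𝟙 (end? u))) ⟩
      fromℕ (degree S⁻ u) ⊕ 𝟙 (end? u) ∎
      where
      open ≡-Reasoning
      split : ∀ z (d : Dec (z ≡ r)) → 𝟙 (inc? S⁺ z u) ≡ 𝟙 (inc? S⁻ z u) ⊕ 𝟙 d ⊛ 𝟙 (end? u)
      split z (no z≢r) = trans (𝟙-cong (inc? S⁺ z u) (inc? S⁻ z u) (lower-Inc z≢r) lift-Inc)
        (sym (trans (cong (𝟙 (inc? S⁻ z u) ⊕_) (ℚₚ.*-zeroˡ (𝟙 (end? u)))) (ℚₚ.+-identityʳ _)))
      split z (yes refl) = trans (𝟙-cong (inc? S⁺ r u) (end? u)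
          (λ { (_ , e , inj₁ h) → inj₁ h ; (_ , e , inj₂ h) → inj₂ (trans (just-injective (trans (sym edge⁺) e)) h) }) (λ d → p , edge⁺ , d))
        (sym (trans (cong₂ _⊕_ (𝟙-no (inc? S⁻ r u) (λ i → Inc⁻≢r i refl)) (ℚₚ.*-identityˡ (𝟙 (end? u)))) (ℚₚ.+-identityˡ _)))

    degree-end : ∀ {u} → r ≡ u ⊎ p ≡ u → degree S⁺ u ≡ suc (degree S⁻ u)
    degree-end {u} h = fromℕ-injective (trans (degree-link u) (trans (cong (fromℕ (degree S⁻ u) ⊕_) (𝟙-yes (end? u) h))
      (trans (ℚₚ.+-comm (fromℕ (degree S⁻ u)) 1ℚ) (sym (fromℕ-suc (degree S⁻ u))))))

    degree-off : ∀ {u} → ¬ (r ≡ u ⊎ p ≡ u) → degree S⁺ u ≡ degree S⁻ u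
    degree-off {u} h = fromℕ-injective (trans (degree-link u) (trans (cong (fromℕ (degree S⁻ u) ⊕_) (𝟙-no (end? u) h)) (ℚₚ.+-identityʳ _)))

    degree-insert : ∀ {Δ} → degree S⁻ p < Δ → degree S⁻ r < Δ → (∀ u → degree S⁻ u ≤ Δ) → ∀ u → degree S⁺ u ≤ Δ
    degree-insert {Δ} dp dr h u with r Fin.≟ u | p Fin.≟ u
    ... | yes refl | _ = subst (_≤ Δ) (sym (degree-end (inj₁ refl))) dr
    ... | no _ | yes refl = subst (_≤ Δ) (sym (degree-end (inj₂ refl))) dp
    ... | no r≢u | no p≢u = subst (_≤ Δ) (sym (degree-off [ r≢u , p≢u ])) (h u)

    degree-delete : ∀ {Δ} → (∀ u → degree S⁺ u ≤ Δ) → ∀ u → degree S⁻ u ≤ Δ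
    degree-delete {Δ} h u with end? u
    ... | yes e = ℕₚ.≤-trans (ℕₚ.n≤1+n _) (subst (_≤ Δ) (degree-end e) (h u))
    ... | no ne = subst (_≤ Δ) (degree-off ne) (h u)

module _ {n κ : ℕ} {S : Str n} (a : Acyclic S) (x : Vec (Fin κ) n) where

  private
    rootOf′-suc : ∀ {z q} → S z ≡ just q → ∀ f → rootOf′ (suc f) (st S x) z ≡ rootOf′ f (st S x) q
    rootOf′-suc {z} e f rewrite e = refl

    rootOf′-root : ∀ {z} → S z ≡ nothing → ∀ f → rootOf′ f (st S x) z ≡ z
    rootOf′-root e zero = refl
    rootOf′-root {z} e (suc f) rewrite e = refl

    rootOf′-stable : ∀ f g z → depth a z ≤ f → depth a z ≤ g → rootOf′ f (st S x) z ≡ rootOf′ g (st S x) z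
    rootOf′-stable f g z l l′ with S z in e
    ... | nothing = trans (rootOf′-root e f) (sym (rootOf′-root e g))
    ... | just q rewrite depth-child a e with f | g | l | l′
    ...   | suc f′ | suc g′ | ℕ.s≤s k | ℕ.s≤s k′ =
      trans (rootOf′-suc e f′) (trans (rootOf′-stable f′ g′ q k k′) (sym (rootOf′-suc e g′)))

  rootOf-root : ∀ {z} → S z ≡ nothing → rootOf (st S x) z ≡ z
  rootOf-root e = rootOf′-root e n

  rootOf-edge : ∀ {z q} → S z ≡ just q → rootOf (st S x) z ≡ rootOf (st S x) q
  rootOf-edge {z} {q} e = trans (rootOf′-stable n (suc n) z (ℕₚ.<⇒≤ (depth<n a z)) (ℕₚ.m≤n⇒m≤1+n (ℕₚ.<⇒≤ (depth<n a z)))) (rootOf′-suc e n)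

-- Outcomes in the support of a distribution

nonempty-∈ : (xs : List A) → 0 < length xs → ∃[ a ] a ∈ xs
nonempty-∈ (x ∷ xs) _ = x , here refl

∈-uniform : (xs : List A) {a : A} → a ∈ xs → ∃[ q ] (q , a) ∈ uniform xs
∈-uniform (x ∷ xs) m = _ , ∈ₚ.∈-map⁺ (λ a → (+ 1 ℚ./ suc (length xs) , a)) m

∈-bind : (d : Dist A) (f : A → Dist B) {q q′ : ℚ} {a : A} {b : B} → (q , a) ∈ d → (q′ , b) ∈ f a → (q ⊛ q′ , b) ∈ bind d f
∈-bind ((q , a) ∷ d) f (here refl) m = ∈ₚ.∈-++⁺ˡ (∈ₚ.∈-map⁺ (λ qa → (q ⊛ proj₁ qa , proj₂ qa)) m)
∈-bind ((p , a) ∷ d) f (there m) m′ = ∈ₚ.∈-++⁺ʳ (scale p (f a)) (∈-bind d f m m′)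

avail-free : ∀ {n κ} (S : Str n) (x : Vec (Fin κ) n) u {γ} → γ ∈ avail (st S x) u → Free S x u γ
avail-free S x u {γ} m with subst (γ ∈_) (avail-st S x u) m
... | m′ = does-true (free? S x u γ) (Boolₚ.T-≡ .Equivalence.to (proj₂ (∈ₚ.∈-filter⁻ (λ γ → T? (does (free? S x u γ))) {xs = allFin _} m′)))

-- From the chain length to the stated bounds

≼-⊓ : ∀ {a b x c} → x ≼ a ⊛ c → x ≼ b ⊛ c → x ≼ (a ℚ.⊓ b) ⊛ c
≼-⊓ {a} {b} {x} {c} h h′ with ℚₚ.≤-total a b
... | inj₁ a≤b = subst (λ t → x ≼ t ⊛ c) (sym (ℚₚ.p≤q⇒p⊓q≡p a≤b)) h
... | inj₂ b≤a = subst (λ t → x ≼ t ⊛ c) (sym (ℚₚ.p≥q⇒p⊓q≡q b≤a)) h′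

-- A bound for the expected length of a single chain. It becomes `bound` through the factor ℓ/κ,
-- with ℓ ≤ Δ the number of children of r; for c = 0 this factor is estimated by 1.
chainBound : ℕ → ℕ → ℕ → ℚ
chainBound Δ zero n = fromℕ (2 + ceilLog (Δ ∸ 1) n)
chainBound Δ (suc c) n = (+ (Δ + suc c ∸ 1) ℚ./ suc c) ℚ.⊓ fromℕ (2 + ceilLog (Δ + suc c ∸ 1) n)

module Bounds (Δ n : ℕ) (3≤Δ : 3 ≤ Δ) where

  0<Δ : 0 < Δ
  0<Δ = ℕₚ.≤-trans (ℕ.s≤s ℕ.z≤n) 3≤Δ

  chainBound-nonneg : ∀ c → 0ℚ ≼ chainBound Δ c n
  chainBound-nonneg zero = 0≤fromℕ (2 + ceilLog (Δ ∸ 1) n)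
  chainBound-nonneg (suc c) = ℚₚ.⊓-glb
    (ℚₚ.nonNegative⁻¹ (+ (Δ + suc c ∸ 1) ℚ./ suc c) {{ℚₚ.normalize-nonNeg (Δ + suc c ∸ 1) (suc c)}}) (0≤fromℕ (2 + ceilLog (Δ + suc c ∸ 1) n))

  bound-chainBound : ∀ c ℓ → ℓ ≤ Δ → (inv (Δ + c) ⊛ fromℕ ℓ) ⊛ chainBound Δ c n ≼ bound Δ c n
  bound-chainBound zero ℓ ℓ≤Δ = begin
    (inv (Δ + 0) ⊛ fromℕ ℓ) ⊛ chainBound Δ 0 n         ≤⟨ *-mono-≼ʳ (chainBound-nonneg 0) (*-mono-≼ˡ (0≤inv (Δ + 0)) (fromℕ-mono (ℕₚ.≤-trans ℓ≤Δ (ℕₚ.m≤m+n Δ 0)))) ⟩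
    (inv (Δ + 0) ⊛ fromℕ (Δ + 0)) ⊛ chainBound Δ 0 n   ≡⟨ cong (_⊛ chainBound Δ 0 n) (inv-fromℕ (ℕₚ.≤-trans 0<Δ (ℕₚ.m≤m+n Δ 0))) ⟩
    1ℚ ⊛ chainBound Δ 0 n                              ≡⟨ ℚₚ.*-identityˡ (chainBound Δ 0 n) ⟩
    chainBound Δ 0 n                                   ∎
    where open ℚₚ.≤-Reasoning
  bound-chainBound (suc c) ℓ ℓ≤Δ = begin
    (inv (Δ + suc c) ⊛ fromℕ ℓ) ⊛ chainBound Δ (suc c) n     ≤⟨ *-mono-≼ʳ (chainBound-nonneg (suc c)) (*-mono-≼ˡ (0≤inv (Δ + suc c)) (fromℕ-mono ℓ≤Δ)) ⟩
    (inv (Δ + suc c) ⊛ fromℕ Δ) ⊛ chainBound Δ (suc c) n     ≡⟨ cong (λ k → (inv k ⊛ fromℕ Δ) ⊛ chainBound Δ (suc c) n) (ℕₚ.+-comm Δ (suc c)) ⟩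
    (inv (suc c + Δ) ⊛ fromℕ Δ) ⊛ chainBound Δ (suc c) n     ≡⟨ cong (_⊛ chainBound Δ (suc c) n) (/-inv Δ (c + Δ)) ⟨
    (+ Δ ℚ./ (suc c + Δ)) ⊛ chainBound Δ (suc c) n           ∎
    where open ℚₚ.≤-Reasoning

  module _ {S : Str n} (a : Acyclic S) (deg≤ : ∀ u → degree S u ≤ Δ) {p r w : Fin n} (rp : S r ≡ just p) (wr : S w ≡ just r) where

    private
      -- A vertex with a parent has spent one of its at most Δ edges on it.
      few-kids : ∀ {q s} → S q ≡ just s → length (kids S q) ≤ Δ ∸ 1
      few-kids {q} e = ℕₚ.≤-trans (ℕₚ.≤-reflexive (cong (λ m → (parentCount m + length (kids S q)) ∸ 1) (sym e))) (ℕₚ.∸-monoˡ-≤ 1 (deg≤ q))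

      log : ∀ c L → n ≤ (Δ + c ∸ 1) ℕ.^ L → ChainBound.expectedLength {κ = Δ + c} a rp wr ≼ fromℕ (2 + L) ⊛ ChainBound.N {κ = Δ + c} a rp wr
      log c L h = ℚₚ.≤-trans
        (length-log (Δ ∸ 1) few-kids (ℕₚ.≤-trans (ℕ.s≤s ℕ.z≤n) (ℕₚ.≤-trans (ℕₚ.∸-monoˡ-≤ 1 3≤Δ) D≤k)) D≤k L h)
        -- The chain estimate gives L + 1; the stated bound has L + 2.
        (*-mono-≼ʳ 0≤N (fromℕ-mono (ℕₚ.n≤1+n (suc L))))
        where
        open ChainBound {κ = Δ + c} a rp wr
        D≤k : Δ ∸ 1 ≤ Δ + c ∸ 1
        D≤k = ℕₚ.∸-monoˡ-≤ 1 (ℕₚ.m≤m+n Δ c)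

      2≤k : ∀ c → 2 ≤ Δ + c ∸ 1
      2≤k c = ℕₚ.∸-monoˡ-≤ 1 (ℕₚ.≤-trans 3≤Δ (ℕₚ.m≤m+n Δ c))

    expectedLength≤ : ∀ c → ChainBound.expectedLength {κ = Δ + c} a rp wr ≼ chainBound Δ c n ⊛ ChainBound.N {κ = Δ + c} a rp wr
    expectedLength≤ zero = log 0 (ceilLog (Δ ∸ 1) n)
      (subst (λ k → n ≤ (k ∸ 1) ℕ.^ ceilLog (Δ ∸ 1) n) (sym (ℕₚ.+-identityʳ Δ)) (ceilLog-spec (ℕₚ.∸-monoˡ-≤ 1 3≤Δ) n))
    expectedLength≤ (suc c) = ≼-⊓ {+ k ℚ./ suc c} {fromℕ (2 + ceilLog k n)} linear (log (suc c) (ceilLog k n) (ceilLog-spec (2≤k (suc c)) n))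
      where
      open ChainBound {κ = Δ + suc c} a rp wr
      open ℚₚ.≤-Reasoning
      k = Δ + suc c ∸ 1
      D = Δ ∸ 1
      k≡ : k ≡ suc c + D
      k≡ = trans (cong (_∸ 1) (trans (cong (_+ suc c) (sym (ℕₚ.m+[n∸m]≡n 0<Δ))) refl)) (ℕₚ.+-comm D (suc c))
      split : ∀ a d x → (a ⊕ d) ⊛ x ≡ a ⊛ x ⊕ d ⊛ x
      split = solve-∀ ℚ-ring
      -- Subtract D times the expected length on both sides of the recurrence: k - D is the number
      -- `suc c` of surplus colours.
      excess : fromℕ (suc c) ⊛ expectedLength ≼ fromℕ k ⊛ N
      excess = ℚₚ.≤-trans (ℚₚ.≤-reflexive (add-sub (fromℕ (suc c) ⊛ expectedLength) (fromℕ D ⊛ expectedLength)))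
        (ℚₚ.≤-trans (ℚₚ.+-monoˡ-≤ (ℚ.- (fromℕ D ⊛ expectedLength)) (begin
          fromℕ (suc c) ⊛ expectedLength ⊕ fromℕ D ⊛ expectedLength  ≡⟨ split (fromℕ (suc c)) (fromℕ D) expectedLength ⟨
          (fromℕ (suc c) ⊕ fromℕ D) ⊛ expectedLength                 ≡⟨ cong (_⊛ expectedLength) (fromℕ-homo-+ (suc c) D) ⟨
          fromℕ (suc c + D) ⊛ expectedLength                         ≡⟨ cong (λ t → fromℕ t ⊛ expectedLength) k≡ ⟨
          fromℕ k ⊛ expectedLength                                   ≤⟨ length-recurrence D few-kids ⟩
          fromℕ k ⊛ N ⊕ fromℕ D ⊛ expectedLength                     ∎))
        (ℚₚ.≤-reflexive (sym (add-sub (fromℕ k ⊛ N) (fromℕ D ⊛ expectedLength)))))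
        where
        add-sub : ∀ x y → x ≡ x ⊕ y ⊕ (ℚ.- y)
        add-sub = solve-∀ ℚ-ring
      linear : expectedLength ≼ (+ k ℚ./ suc c) ⊛ N
      linear = begin
        expectedLength                                            ≡⟨ ℚₚ.*-identityˡ expectedLength ⟨
        1ℚ ⊛ expectedLength                                       ≡⟨ cong (_⊛ expectedLength) (inv-fromℕ {suc c} (ℕ.s≤s ℕ.z≤n)) ⟨
        (inv (suc c) ⊛ fromℕ (suc c)) ⊛ expectedLength            ≡⟨ ℚₚ.*-assoc (inv (suc c)) (fromℕ (suc c)) expectedLength ⟩
        inv (suc c) ⊛ (fromℕ (suc c) ⊛ expectedLength)            ≤⟨ *-mono-≼ˡ (0≤inv (suc c)) excess ⟩
        inv (suc c) ⊛ (fromℕ k ⊛ N)                               ≡⟨ ℚₚ.*-assoc (inv (suc c)) (fromℕ k) N ⟨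
        (inv (suc c) ⊛ fromℕ k) ⊛ N                               ≡⟨ cong (_⊛ N) (/-inv k c) ⟨
        (+ k ℚ./ suc c) ⊛ N                                       ∎

-- Fixed sequences of updates

module Process (Δ c n : ℕ) (3≤Δ : 3 ≤ Δ)
  (step : State n (Δ + c) → Upd n → Dist (State n (Δ + c))) (valid : State n (Δ + c) → Upd n → Set) where
  open Bounds Δ n 3≤Δ

  κ : ℕ
  κ = Δ + c

  V : Finite (Vec (Fin κ) n)
  V = vecFinite κ n

  count : Str n → ℚ
  count S = ∑ V (λ x → 𝟙 (proper? S x))

  average : Str n → (State n κ → ℚ) → ℚ
  average S g = ∑ V (λ x → 𝟙 (proper? S x) ⊛ g (st S x))

  rec : State n κ → State n κ → ℚ
  rec s t = fromℕ (recourse step valid s t)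

  -- Running F on a uniformly random proper colouring of S yields a uniformly random
  -- proper colouring of S′ (both sides are unnormalised sums, whence the factor K).
  record StepResult (F : State n κ → Dist (State n κ)) (S : Str n) : Set where
    field
      S′ : Str n
      acyclic′ : Acyclic S′
      degree′ : ∀ u → degree S′ u ≤ Δ
      K : ℚ
      0≤K : 0ℚ ≼ K
      count-K : count S ≡ K ⊛ count S′
      measure : ∀ {g} → Ext g → average S (λ s → E (F s) g) ≡ K ⊛ average S′ g
      recourse≤ : average S (λ s → E (F s) (rec s)) ≼ bound Δ c n ⊛ count S
      -- The remaining updates are known to be valid only in states that the step can reach. One
      -- reachable colouring of the new shape is enough to continue, since the next step is then
      -- analysed for all colourings of that shape.
      support : ∀ x → Proper S x → ∃[ y ] ∃[ s ] ∃[ q ] (Proper S′ y × (s ≗ st S′ y) × (q , s) ∈ F (st S x))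

  module _ {S⁻ S⁺ : Str n} {p r : Fin n} (L : Link S⁻ S⁺ p r)
           (dp : degree S⁻ p < Δ) (dr : degree S⁻ r < Δ) (deg⁺ : ∀ u → degree S⁺ u ≤ Δ) where
    open Link L
    private
      dpκ : degree S⁻ p < κ
      dpκ = ℕₚ.<-≤-trans dp (ℕₚ.m≤m+n Δ c)
      drκ : degree S⁻ r < κ
      drκ = ℕₚ.<-≤-trans dr (ℕₚ.m≤m+n Δ c)
    open LinkStep {κ = κ} L dpκ drκ hiding (V)

    private
      chain≤ : ∀ w → S⁻ w ≡ just r → ∑ V (λ x → 𝟙 (proper? S⁺ x) ⊛ chainLength w x) ≼ chainBound Δ c n ⊛ N⁺
      chain≤ w wr = ℚₚ.≤-trans (ℚₚ.≤-reflexive (ChainBound.expectedLength-∑ acyclic⁺ edge⁺ (lift wr))) (expectedLength≤ acyclic⁺ deg⁺ edge⁺ (lift wr) c)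

      open Recourse step valid {chainBound Δ c n} chain≤ using (insert-recourse; delete-recourse)

      ℓ≤Δ : ℓ ≤ Δ
      ℓ≤Δ = ℕₚ.<⇒≤ (subst (_< Δ) degree-r dr)

      0≤count : ∀ S → 0ℚ ≼ count S
      0≤count S = sumL-nonneg (enum V) (λ x → 𝟙-nonneg (proper? S x))

    private
      Supported : Dist (State n κ) → Set
      Supported d = ∃[ y ] ∃[ s ] ∃[ q ] (Proper S⁺ y × (s ≗ st S⁺ y) × (q , s) ∈ d)

      supported-≈ : ∀ {d d′} → d ≈ᵈ d′ → Supported d′ → Supported d
      supported-≈ h (y , s , q , py , s≗ , m) = let (s′ , e , m′) = ≈ᵈ-∈ h m in y , s′ , q , py , (λ z → trans (e z) (s≗ z)) , m′

      supported-bind : {A : Set} (xs : List A) (f : A → Dist (State n κ)) → ∀ {a} → a ∈ xs → Supported (f a) → Supported (bind (uniform xs) f)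
      supported-bind xs f a∈ (y , s , q , py , s≗ , m) =
        let (q₁ , q₁∈) = ∈-uniform xs a∈ in y , s , q₁ ⊛ q , py , s≗ , ∈-bind (uniform xs) f q₁∈ m

      branch-support : ∀ y → Half y → ∀ m → childWithColor (st S⁺ y) r (lookup y r) ≡ m → Supported (insertStep r (lookup y r) (st S⁺ y) m)
      branch-support y hy nothing eq = y , st S⁺ y , 1ℚ , half-proper {y = y} hy (λ z e → childWithColor-nothing S⁺ y eq (lift e)) , (λ _ → refl) , here refl
      branch-support y hy (just w) eq = supported-bind (avail (st S⁺ y) r) (λ α → return (fix α)) α∈
        (kempe acyclic⁺ w α (lookup y r) y , fix α , 1ℚ , Switch.resolve-proper wr (y , α) (hy , e , avail-free S⁺ y r α∈) ,
         fixForbidden-link {y} α hy wr e , here refl)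
        where
        fix : Fin κ → State n κ
        fix α = fixForbidden (set (st S⁺ y) w (just (r , α))) w (lookup y r) α
        wr⁺ : S⁺ w ≡ just r
        wr⁺ = proj₁ (childWithColor-just S⁺ y eq)
        e : lookup y w ≡ lookup y r
        e = proj₂ (childWithColor-just S⁺ y eq)
        wr : S⁻ w ≡ just r
        wr = lower (λ { refl → p≢r (just-injective (trans (sym edge⁺) wr⁺)) }) wr⁺
        some = nonempty-∈ (avail (st S⁺ y) r) (subst (0 <_) (sym (clash-avail-length {y} (proj₁ hy) wr e)) 0<aᵣ)
        α = proj₁ some
        α∈ = proj₂ some

    insert-support : ∀ x → Proper S⁻ x → ∃[ y ] ∃[ s ] ∃[ q ] (Proper S⁺ y × (s ≗ st S⁺ y) × (q , s) ∈ rootedInsert (st S⁻ x) p r)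
    insert-support x pr = subst Supported (sym (rootedInsert-unfold (st S⁻ x) p r))
      (supported-bind (avail (st S⁻ x) p) (insertBranch x) β∈
        (supported-≈ (insertBranch-≈ x β) (branch-support y (half-update {x} {β} pr (avail-free S⁻ x p β∈)) _ refl)))
      where
      some = nonempty-∈ (avail (st S⁻ x) p) (subst (0 <_) (sym (avail-length acyclic⁻ {x = x} pr p)) 0<aₚ)
      β = proj₁ some
      β∈ = proj₂ some
      y = x [ r ]≔ β

    insert-result : StepResult (λ s → rootedInsert s p r) S⁻
    insert-result = record
      { S′ = S⁺ ; acyclic′ = acyclic⁺ ; degree′ = deg⁺ ; K = K⁺ ; 0≤K = 0≤K⁺ ; count-K = N⁻≡ ; measure = insert-measure
      ; recourse≤ = ℚₚ.≤-trans insert-recourse (*-mono-≼ʳ (0≤count S⁻) (bound-chainBound c ℓ ℓ≤Δ))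
      ; support = insert-support }

    delete-support : ∀ x → Proper S⁺ x → ∃[ y ] ∃[ s ] ∃[ q ] (Proper S⁻ y × (s ≗ st S⁻ y) × (q , s) ∈ deletion (st S⁺ x) p r)
    -- The stopping branch is the first entry of the distribution and leaves the colours of x as
    -- they are.
    delete-support x pr = x , deletedState x , stay ⊛ 1ℚ , proj₁ (proper-half {y = x} pr) , set-cut L x ,
      subst ((stay ⊛ 1ℚ , deletedState x) ∈_) (sym (deletion-unfold (st S⁺ x) p r (st-just S⁺ x edge⁺))) (here refl)
      where
      stay = frac (κ ∸ length (children (deletedState x) r)) κ

    delete-result : StepResult (λ s → deletion s p r) S⁺
    delete-result = record
      { S′ = S⁻ ; acyclic′ = acyclic⁻ ; degree′ = degree-delete L deg⁺ ; K = K⁻ ; 0≤K = 0≤K⁻ ; count-K = N⁺≡ ; measure = delete-measure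
      ; recourse≤ = ℚₚ.≤-trans delete-recourse (*-mono-≼ʳ (0≤count S⁺) (bound-chainBound c ℓ ℓ≤Δ))
      ; support = delete-support }

  module Run (step-cong : ∀ {s s′} → s ≗ s′ → ∀ u → step s u ≈ᵈ step s′ u)
             (valid-cong : ∀ {s s′} → s ≗ s′ → ∀ u → valid s u → valid s′ u)
             (result : ∀ {S} → Acyclic S → (∀ u → degree S u ≤ Δ) → ∀ x → Proper S x → ∀ u → valid (st S x) u →
                       StepResult (λ s → step s u) S) where

    -- Every colouring of S leads to the same shape S′, so `measure` turns the average over S into K
    -- times the average over S′, to which the induction hypothesis applies as a whole. The factor K
    -- is absorbed by `count-K`.
    average-recourse : ∀ {S} → Acyclic S → (∀ u → degree S u ≤ Δ) → ∀ x → Proper S x → ∀ us → ValidSeq step valid (st S x) us →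
      ∀ t → t < length us → average S (λ s → expRecourse step valid s us t) ≼ bound Δ c n ⊛ count S
    average-recourse a deg≤ x pr (u ∷ us) (v , k) zero _ = StepResult.recourse≤ (result a deg≤ x pr u v)
    average-recourse {S} a deg≤ x pr (u ∷ us) (v , k) (suc t) (ℕ.s≤s t<) = begin
      average S (λ s → E (step s u) (λ s′ → expRecourse step valid s′ us t))
        ≡⟨ measure (λ h → expRecourse-cong step valid step-cong valid-cong h us t) ⟩
      K ⊛ average S′ (λ s → expRecourse step valid s us t)
        ≤⟨ *-mono-≼ˡ 0≤K (next (support x pr)) ⟩
      K ⊛ (bound Δ c n ⊛ count S′)
        ≡⟨ ⊛-swap K (bound Δ c n) (count S′) ⟩
      bound Δ c n ⊛ (K ⊛ count S′)
        ≡⟨ cong (bound Δ c n ⊛_) count-K ⟨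
      bound Δ c n ⊛ count S ∎
      where
      open StepResult (result a deg≤ x pr u v)
      open ℚₚ.≤-Reasoning
      next : ∃[ y ] ∃[ s ] ∃[ q ] (Proper S′ y × (s ≗ st S′ y) × (q , s) ∈ step (st S x) u) →
        average S′ (λ s → expRecourse step valid s us t) ≼ bound Δ c n ⊛ count S′
      next (y , s , q , py , s≗ , m) = average-recourse acyclic′ degree′ y py us (ValidSeq-cong step valid step-cong valid-cong s≗ us (k m)) t t<

    -- All vectors are proper on the edgeless shape and represent the same state `emptyForest`, so
    -- averaging over them changes nothing. Cancelling their number requires that a vector exists; κ
    -- ≥ Δ > 0 provides a colour for it.
    expected-recourse : ∀ us → ValidSeq step valid emptyForest us → ∀ t → t < length us →
      expRecourse step valid emptyForest us t ≼ bound Δ c n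
    expected-recourse us v t t< = ℚₚ.*-cancelˡ-≤-pos (count ∅) {{ℚ.positive 0<count}} (begin
      count ∅ ⊛ X                                    ≡⟨ ℚₚ.*-comm (count ∅) X ⟩
      X ⊛ count ∅                                    ≡⟨ sumL-⊛ (enum V) X (λ x → 𝟙 (proper? ∅ x)) ⟨
      ∑ V (λ x → X ⊛ 𝟙 (proper? ∅ x))                ≡⟨ sumL-cong (enum V) (λ x → ℚₚ.*-comm X (𝟙 (proper? ∅ x))) ⟩
      average ∅ (λ s → expRecourse step valid s us t) ≤⟨ average-recourse ∅-acyclic ∅-degree x₀ (∅-proper x₀) us v t t< ⟩
      bound Δ c n ⊛ count ∅                          ≡⟨ ℚₚ.*-comm (bound Δ c n) (count ∅) ⟩
      count ∅ ⊛ bound Δ c n                          ∎)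
      where
      open ℚₚ.≤-Reasoning
      X = expRecourse step valid emptyForest us t
      ∅ : Str n
      ∅ _ = nothing
      ∅-acyclic : Acyclic ∅
      ∅-acyclic = record { rank = λ _ → 0 ; rank-< = λ () }
      ∅-proper : ∀ x → Proper ∅ x
      ∅-proper x u z z′ ne (_ , () , _) i′
      ∅-degree : ∀ u → degree ∅ u ≤ Δ
      ∅-degree u = ℕₚ.≤-trans (ℕₚ.≤-reflexive (fromℕ-injective (trans (sym (degree-inc ∅-acyclic u))
        (trans (sumL-cong (allFin n) (λ z → 𝟙-no (inc? ∅ z u) (λ { (_ , () , _) }))) (sumL-zero (allFin n)))))) ℕ.z≤n
      x₀ : Vec (Fin κ) n
      x₀ = Vec.replicate n (Fin.fromℕ< (ℕₚ.≤-trans 0<Δ (ℕₚ.m≤m+n Δ c)))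
      0<count : 0ℚ ℚ.< count ∅
      0<count = begin-strict
        0ℚ                             <⟨ ℚₚ.positive⁻¹ 1ℚ ⟩
        1ℚ                             ≡⟨ enum-once V x₀ ⟨
        ∑ V (λ x → 𝟙 (eq? V x x₀))     ≤⟨ sumL-mono (enum V) (λ x → 𝟙-mono (eq? V x x₀) (proper? ∅ x) (λ _ → ∅-proper x)) ⟩
        count ∅                        ∎

-- The rooted version

module Rooted (Δ c n : ℕ) (3≤Δ : 3 ≤ Δ) where
  open Process Δ c n 3≤Δ (rootedStep Δ) (RootedValid Δ)

  ¬below : ∀ {S : Str n} (a : Acyclic S) (x : Vec (Fin κ) n) {p r} → S r ≡ nothing → rootOf (st S x) p ≢ r → ¬ Reach S (λ _ → ⊤) r p
  ¬below {S} a x root ne below = ne (trans (go below) (rootOf-root a x root))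
    where
    go : ∀ {r z} → Reach S (λ _ → ⊤) r z → rootOf (st S x) z ≡ rootOf (st S x) r
    go here = refl
    go (there e _ b) = trans (rootOf-edge a x e) (go b)

  result : ∀ {S} → Acyclic S → (∀ u → degree S u ≤ Δ) → ∀ x → Proper S x → ∀ u → RootedValid Δ (st S x) u →
    StepResult (λ s → rootedStep Δ s u) S
  result {S} a deg≤ x pr (ins p r) (root , ne , dp , dr) = insert-result L dp′ dr′ (degree-insert L dp′ dr′ deg≤)
    where
    L : Link S (setS S r (just p)) p r
    L = insert-link a (st-nothing⁻ S x root) (¬below a x (st-nothing⁻ S x root) ne)
    dp′ : degree S p < Δ
    dp′ = subst (_< Δ) (deg-st S x p) dp
    dr′ : degree S r < Δ
    dr′ = subst (_< Δ) (deg-st S x r) dr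
  result {S} a deg≤ x pr (del p r) (α , e) = delete-result L
    (subst (_≤ Δ) (degree-end L (inj₂ refl)) (deg≤ p)) (subst (_≤ Δ) (degree-end L (inj₁ refl)) (deg≤ r)) deg≤
    where
    L : Link (setS S r nothing) S p r
    L = cut-link a (st-just⁻ S x e)

  open Run (rootedStep-cong Δ) (rootedValid-cong Δ) result public using (expected-recourse)

-- Commuting the pointer changes on the way to the root

module _ {n κ : ℕ} where

  set-off : ∀ (s : State n κ) v m {z} → z ≢ v → set s v m z ≡ s z
  set-off s v m {z} ne = cong (if_then m else s z) (==-≢ ne)

  set-swap : ∀ (s : State n κ) {v w} m m′ → v ≢ w → set (set s v m) w m′ ≗ set (set s w m′) v m
  set-swap s {v} {w} m m′ v≢w z with z Fin.≟ v | z Fin.≟ w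
  ... | yes refl | yes refl = contradiction refl v≢w
  ... | yes refl | no z≢w = refl
  ... | no z≢v | yes refl = refl
  ... | no z≢v | no z≢w = refl

  set-set : ∀ (s : State n κ) v m m′ → set (set s v m) v m′ ≗ set s v m′
  set-set s v m m′ z with z Fin.≟ v
  ... | yes _ = refl
  ... | no _ = refl

  module _ (ρ : Fin n → ℕ) where

    Descending : State n κ → Fin n → Set
    Descending s x = ∀ {z q col} → ρ z ≤ ρ x → s z ≡ just (q , col) → ρ q < ρ z

    private
      descending-set : ∀ {s x y} m → Descending s x → ρ y < ρ x → Descending (set s x m) y
      descending-set {s} {x} m h y<x {z} z≤y e =
        h (ℕₚ.≤-trans z≤y (ℕₚ.<⇒≤ y<x)) (trans (sym (set-off s x m (λ { refl → ℕₚ.<⇒≱ y<x z≤y }))) e)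

      reroot′-just : ∀ f (s : State n κ) x m {y col} → s x ≡ just (y , col) → reroot′ (suc f) s x m ≡ reroot′ f (set s x m) y (just (x , col))
      reroot′-just f s x m e rewrite e = refl

      reroot′-nothing : ∀ f (s : State n κ) x m → s x ≡ nothing → reroot′ f s x m ≡ set s x m
      reroot′-nothing zero s x m e = refl
      reroot′-nothing (suc f) s x m e rewrite e = refl

    -- Starting at x, the walk meets only vertices whose ρ is at most that of x, so a write at a
    -- vertex of larger ρ is neither read nor overwritten.
    reroot′-set : ∀ f s x m {v} t → Descending s x → ρ x < ρ v → reroot′ f (set s v t) x m ≗ set (reroot′ f s x m) v t
    reroot′-set f s x m {v} t h x<v = go f (s x) refl
      where
      v≢x : v ≢ x
      v≢x refl = ℕₚ.<-irrefl refl x<v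
      go : ∀ f c → s x ≡ c → reroot′ f (set s v t) x m ≗ set (reroot′ f s x m) v t
      go zero c e = set-swap s t m v≢x
      go (suc f) nothing e z = trans (cong (λ s → s z) (reroot′-nothing (suc f) (set s v t) x m (trans (set-off s v t (≢-sym v≢x)) e)))
        (trans (set-swap s t m v≢x z) (cong (λ s → set s v t z) (sym (reroot′-nothing (suc f) s x m e))))
      go (suc f) (just (y , col)) e z = begin
        reroot′ (suc f) (set s v t) x m z                          ≡⟨ cong (λ s → s z) (reroot′-just f (set s v t) x m (trans (set-off s v t (≢-sym v≢x)) e)) ⟩
        reroot′ f (set (set s v t) x m) y (just (x , col)) z       ≡⟨ reroot′-cong (set-swap s t m v≢x) f y (just (x , col)) z ⟩
        reroot′ f (set (set s x m) v t) y (just (x , col)) z       ≡⟨ reroot′-set f (set s x m) y (just (x , col)) t (descending-set m h y<x) (ℕₚ.<-trans y<x x<v) z ⟩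
        set (reroot′ f (set s x m) y (just (x , col))) v t z       ≡⟨ cong (λ s → set s v t z) (reroot′-just f s x m e) ⟨
        set (reroot′ (suc f) s x m) v t z                          ∎
        where
        open ≡-Reasoning
        y<x : ρ y < ρ x
        y<x = h ℕₚ.≤-refl e

    reroot′-new : ∀ f s x m → Descending s x → reroot′ f s x m ≗ set (reroot′ f s x nothing) x m
    reroot′-new f s x m h = go f (s x) refl
      where
      go : ∀ f c → s x ≡ c → reroot′ f s x m ≗ set (reroot′ f s x nothing) x m
      go zero c e z = sym (set-set s x nothing m z)
      go (suc f) nothing e z = trans (cong (λ s → s z) (reroot′-nothing (suc f) s x m e))
        (trans (sym (set-set s x nothing m z)) (cong (λ s → set s x m z) (sym (reroot′-nothing (suc f) s x nothing e))))
      go (suc f) (just (y , col)) e z = begin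
        reroot′ (suc f) s x m z                                        ≡⟨ cong (λ s → s z) (reroot′-just f s x m e) ⟩
        reroot′ f (set s x m) y (just (x , col)) z                     ≡⟨ reroot′-set f s y (just (x , col)) m h′ y<x z ⟩
        set s₁ x m z                                                   ≡⟨ set-set s₁ x nothing m z ⟨
        set (set s₁ x nothing) x m z                                   ≡⟨ set-cong (λ v → sym (reroot′-set f s y (just (x , col)) nothing h′ y<x v)) x m z ⟩
        set (reroot′ f (set s x nothing) y (just (x , col))) x m z     ≡⟨ cong (λ s → set s x m z) (reroot′-just f s x nothing e) ⟨
        set (reroot′ (suc f) s x nothing) x m z                        ∎
        where
        open ≡-Reasoning
        s₁ = reroot′ f s y (just (x , col))
        y<x : ρ y < ρ x
        y<x = h ℕₚ.≤-refl e
        h′ : Descending s y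
        h′ l = h (ℕₚ.≤-trans l (ℕₚ.<⇒≤ y<x))

    -- The algorithm rewrites pointers from v upwards. Since its writes commute, the walk may be
    -- read from its end: reroot at the parent y, then turn the edge between y and v. In this order
    -- each edge is turned when its upper endpoint is a root, which permits an induction along
    -- parents.
    reroot′-parent : ∀ f s v {y col} → Descending s v → s v ≡ just (y , col) →
      reroot′ (suc f) s v nothing ≗ set (set (reroot′ f s y nothing) y (just (v , col))) v nothing
    reroot′-parent f s v {y} {col} h e z = begin
      reroot′ (suc f) s v nothing z                                      ≡⟨ cong (λ s → s z) (reroot′-just f s v nothing e) ⟩
      reroot′ f (set s v nothing) y (just (v , col)) z                   ≡⟨ reroot′-set f s y (just (v , col)) nothing h′ y<v z ⟩
      set (reroot′ f s y (just (v , col))) v nothing z                   ≡⟨ set-cong (reroot′-new f s y (just (v , col)) h′) v nothing z ⟩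
      set (set (reroot′ f s y nothing) y (just (v , col))) v nothing z   ∎
      where
      open ≡-Reasoning
      y<v : ρ y < ρ v
      y<v = h ℕₚ.≤-refl e
      h′ : Descending s y
      h′ l = h (ℕₚ.≤-trans l (ℕₚ.<⇒≤ y<v))

-- Rerooting

module _ {n κ : ℕ} (step : State n κ → Upd n → Dist (State n κ)) (valid : State n κ → Upd n → Set) where

  EdgeColor : Str n → Vec (Fin κ) n → Fin n → Fin n → Fin κ → Set
  EdgeColor S x u v γ = (S u ≡ just v × lookup x u ≡ γ) ⊎ (S v ≡ just u × lookup x v ≡ γ)

  colorOf-st⁻ : ∀ {S} → Acyclic S → ∀ x {u v γ} → EdgeColor S x u v γ → colorOf step valid (st S x) u v ≡ just γ
  colorOf-st⁻ {S} a x {u} {v} (inj₁ (e , refl)) rewrite e | ==-refl v = refl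
  colorOf-st⁻ {S} a x {u} {v} (inj₂ (e , refl)) with S u in eᵤ
  ... | nothing rewrite e | ==-refl u = refl
  ... | just p with p Fin.≟ v
  ...   | yes refl = contradiction (depth-< a e) (ℕₚ.<-asym (depth-< a eᵤ))
  ...   | no p≢v rewrite e | ==-refl u = refl

  colorOf-EdgeColor : ∀ {S S′ : Str n} → Acyclic S → Acyclic S′ → ∀ x x′ {u v} →
    (∀ γ → EdgeColor S x u v γ → EdgeColor S′ x′ u v γ) → (∀ γ → EdgeColor S′ x′ u v γ → EdgeColor S x u v γ) →
    colorOf step valid (st S x) u v ≡ colorOf step valid (st S′ x′) u v
  colorOf-EdgeColor {S} {S′} a a′ x x′ {u} {v} f g with colorOf step valid (st S x) u v in e | colorOf step valid (st S′ x′) u v in e′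
  ... | nothing | nothing = refl
  ... | just γ | m = trans (sym (colorOf-st⁻ a′ x′ (f γ (colorOf-st step valid S x e)))) e′
  ... | nothing | just γ = trans (sym e) (colorOf-st⁻ a x (g γ (colorOf-st step valid S′ x′ e′)))

  -- Expresses that the two shapes are rootings of the same forest, with σ moving each colour to the
  -- new name of its edge. Colours are compared through `colorOf`, which ignores orientation, so
  -- that recourse is invariant.
  record Rebase (S S′ : Str n) : Set where
    field
      acyclic′ : Acyclic S′
      σ σ⁻¹ : Vec (Fin κ) n → Vec (Fin κ) n
      σ-inverse : ∀ x → σ⁻¹ (σ x) ≡ x
      σ⁻¹-inverse : ∀ x → σ (σ⁻¹ x) ≡ x
      σ-proper : ∀ x → Proper S x → Proper S′ (σ x)
      σ⁻¹-proper : ∀ x → Proper S′ x → Proper S (σ⁻¹ x)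
      same-color : ∀ x u v → colorOf step valid (st S x) u v ≡ colorOf step valid (st S′ (σ x)) u v
      same-degree : ∀ u → degree S′ u ≡ degree S u
      -- With R the root in the old shape, this says that adjacent vertices of the new shape were in
      -- one tree before.
      same-tree : ∀ (R : Fin n → Fin n) → (∀ {z q} → S z ≡ just q → R z ≡ R q) → ∀ {z q} → S′ z ≡ just q → R z ≡ R q

  rebase-id : ∀ {S} → Acyclic S → Rebase S S
  rebase-id a = record
    { acyclic′ = a ; σ = id ; σ⁻¹ = id ; σ-inverse = λ _ → refl ; σ⁻¹-inverse = λ _ → refl
    ; σ-proper = λ _ → id ; σ⁻¹-proper = λ _ → id ; same-color = λ _ _ _ → refl ; same-degree = λ _ → refl ; same-tree = λ _ → id }

  rebase-trans : ∀ {S S′ S″} → Rebase S S′ → Rebase S′ S″ → Rebase S S″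
  rebase-trans P Q = record
    { acyclic′ = Q.acyclic′
    ; σ = Q.σ ∘ P.σ ; σ⁻¹ = P.σ⁻¹ ∘ Q.σ⁻¹
    ; σ-inverse = λ x → trans (cong P.σ⁻¹ (Q.σ-inverse (P.σ x))) (P.σ-inverse x)
    ; σ⁻¹-inverse = λ x → trans (cong Q.σ (P.σ⁻¹-inverse (Q.σ⁻¹ x))) (Q.σ⁻¹-inverse x)
    ; σ-proper = λ x → Q.σ-proper (P.σ x) ∘ P.σ-proper x
    ; σ⁻¹-proper = λ x → P.σ⁻¹-proper (Q.σ⁻¹ x) ∘ Q.σ⁻¹-proper x
    ; same-color = λ x u v → trans (P.same-color x u v) (Q.same-color (P.σ x) u v)
    ; same-degree = λ u → trans (Q.same-degree u) (P.same-degree u)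
    ; same-tree = λ R h → Q.same-tree R (P.same-tree R h) }
    where
    module P = Rebase P
    module Q = Rebase Q

  -- Turning the edge between a root y and its child v around exchanges the roles of v and y as edge names.
  module TurnEdge {S : Str n} (a : Acyclic S) {v y : Fin n} (vy : S v ≡ just y) (root : S y ≡ nothing) where

    private
      y≢v : y ≢ v
      y≢v refl = just≢nothing vy root

    turned : Str n
    turned = setS (setS S v nothing) y (just v)

    turned-y : turned y ≡ just v
    turned-y = setS-same (setS S v nothing) y (just v)

    turned-v : turned v ≡ nothing
    turned-v = trans (setS-other (setS S v nothing) y (just v) (≢-sym y≢v)) (setS-same S v nothing)

    turned-off : ∀ {z} → z ≢ v → z ≢ y → turned z ≡ S z
    turned-off z≢v z≢y = trans (setS-other (setS S v nothing) y (just v) z≢y) (setS-other S v nothing z≢v)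

    -- The edge between v and y is now named y and v becomes a root, so the colour at v moves to y
    -- and the dummy at y moves to v.
    turn : Vec (Fin κ) n → Vec (Fin κ) n
    turn x = tabulate (λ z → lookup x (tr v y z))

    lookup-turn : ∀ x z → lookup (turn x) z ≡ lookup x (tr v y z)
    lookup-turn x z = Vecₚ.lookup∘tabulate _ z

    turn-involutive : ∀ x → turn (turn x) ≡ x
    turn-involutive x = vec-ext λ z → trans (lookup-turn (turn x) z) (trans (lookup-turn x (tr v y z)) (cong (lookup x) (tr-involutive v y z)))

    turn-inc : ∀ {z u} → Inc turned z u → Inc S (tr v y z) u
    turn-inc {z} {u} (q , e , d) with z Fin.≟ v | z Fin.≟ y
    ... | yes refl | _ with () ← just≢nothing e turned-v
    ... | no _ | yes refl with refl ← just-injective (trans (sym e) turned-y) = y , vy , Sum.swap d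
    ... | no z≢v | no z≢y = q , trans (sym (turned-off z≢v z≢y)) e , d

    turn-inc⁻ : ∀ {z u} → Inc S z u → Inc turned (tr v y z) u
    turn-inc⁻ {z} {u} (q , e , d) with z Fin.≟ v | z Fin.≟ y
    ... | yes refl | _ with refl ← just-injective (trans (sym e) vy) = v , turned-y , Sum.swap d
    ... | no _ | yes refl with () ← just≢nothing e root
    ... | no z≢v | no z≢y = q , trans (turned-off z≢v z≢y) e , d

    -- Vertices outside the subtree of v are raised by rank v + 1. This puts y above v, and no edge
    -- other than the turned one joins the two sides.
    turned-acyclic : Acyclic turned
    turned-acyclic = record { rank = λ z → rank′ z (below? z) ; rank-< = λ {z} → dec (z Fin.≟ v) (z Fin.≟ y) }
      where
      open Acyclic a
      below? : ∀ z → Dec (Reach S (λ _ → ⊤) v z)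
      below? = reach? a (λ _ → yes tt) v
      rank′ : ∀ z → Dec (Reach S (λ _ → ⊤) v z) → ℕ
      rank′ z (yes _) = rank z
      rank′ z (no _) = rank z + suc (rank v)
      lt : ∀ {z q} → z ≢ v → S z ≡ just q → ∀ e f → rank′ q e < rank′ z f
      lt z≢v e (yes _) (yes _) = rank-< e
      lt z≢v e (no _) (no _) = ℕₚ.+-monoˡ-< (suc (rank v)) (rank-< e)
      lt z≢v e (yes b) (no ¬b) = contradiction (there e tt b) ¬b
      lt z≢v e (no ¬b) (yes b) = contradiction (proj₂ (Reach-parent z≢v e b)) ¬b
      top : ∀ e f → rank′ v e < rank′ y f
      top (no ¬b) _ = contradiction here ¬b
      top (yes _) (yes b) = contradiction (Reach-root root b) y≢v
      top (yes _) (no _) = ℕₚ.m≤n+m (suc (rank v)) (rank y)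
      dec : ∀ {z q} → Dec (z ≡ v) → Dec (z ≡ y) → turned z ≡ just q → rank′ q (below? q) < rank′ z (below? z)
      dec (yes refl) _ e with () ← just≢nothing e turned-v
      dec (no _) (yes refl) e with refl ← just-injective (trans (sym e) turned-y) = top (below? v) (below? y)
      dec {z} {q} (no z≢v) (no z≢y) e = lt z≢v (trans (sym (turned-off z≢v z≢y)) e) (below? q) (below? z)

    turn-color : ∀ x u u′ γ → S u ≡ just u′ × lookup x u ≡ γ → EdgeColor turned (turn x) u u′ γ
    turn-color x u u′ γ (e , h) with u Fin.≟ v | u Fin.≟ y
    ... | yes refl | _ with refl ← just-injective (trans (sym e) vy) =
      inj₂ (turned-y , trans (lookup-turn x y) (trans (cong (lookup x) (tr-right v y)) h))
    ... | no _ | yes refl with () ← just≢nothing e root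
    ... | no u≢v | no u≢y = inj₁ (trans (turned-off u≢v u≢y) e , trans (lookup-turn x u) (trans (cong (lookup x) (tr-other u≢v u≢y)) h))

    turn-color⁻ : ∀ x u u′ γ → turned u ≡ just u′ × lookup (turn x) u ≡ γ → EdgeColor S x u u′ γ
    turn-color⁻ x u u′ γ (e , h) with u Fin.≟ v | u Fin.≟ y
    ... | yes refl | _ with () ← just≢nothing e turned-v
    ... | no _ | yes refl with refl ← just-injective (trans (sym e) turned-y) =
      inj₂ (vy , trans (cong (lookup x) (sym (tr-right v y))) (trans (sym (lookup-turn x y)) h))
    ... | no u≢v | no u≢y = inj₁ (trans (sym (turned-off u≢v u≢y)) e , trans (cong (lookup x) (sym (tr-other u≢v u≢y))) (trans (sym (lookup-turn x u)) h))

    rebase-turn : Rebase S turned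
    rebase-turn = record
      { acyclic′ = turned-acyclic
      ; σ = turn ; σ⁻¹ = turn ; σ-inverse = turn-involutive ; σ⁻¹-inverse = turn-involutive
      ; σ-proper = λ x pr u z z′ ne i i′ e → pr u (tr v y z) (tr v y z′) (ne ∘ tr-injective v y) (turn-inc i) (turn-inc i′)
          (trans (sym (lookup-turn x z)) (trans e (lookup-turn x z′)))
      ; σ⁻¹-proper = λ x pr u z z′ ne i i′ e → pr u (tr v y z) (tr v y z′) (ne ∘ tr-injective v y) (turn-inc⁻ i) (turn-inc⁻ i′)
          (trans (sym (lookup-turn x z)) (trans e (lookup-turn x z′)))
      ; same-color = λ x u u′ → colorOf-EdgeColor a turned-acyclic x (turn x)
          (λ γ → [ turn-color x u u′ γ , Sum.swap ∘ turn-color x u′ u γ ])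
          (λ γ → [ turn-color⁻ x u u′ γ , Sum.swap ∘ turn-color⁻ x u′ u γ ])
      ; same-degree = λ u → fromℕ-injective (begin
          fromℕ (degree turned u)                               ≡⟨ degree-inc turned-acyclic u ⟨
          sumL (allFin n) (λ z → 𝟙 (inc? turned z u))           ≡⟨ sumL-cong (allFin n) (λ z → ℚₚ.*-identityʳ (𝟙 (inc? turned z u))) ⟨
          sumL (allFin n) (λ z → 𝟙 (inc? turned z u) ⊛ 1ℚ)      ≡⟨ reindex (finFinite n) (finFinite n) (λ z → inc? turned z u) (λ z → inc? S z u) (tr v y) (tr v y)
                                                                     (λ z i → turn-inc i , tr-involutive v y z) (λ z i → turn-inc⁻ i , tr-involutive v y z) (λ _ → 1ℚ) ⟩
          sumL (allFin n) (λ z → 𝟙 (inc? S z u) ⊛ 1ℚ)           ≡⟨ sumL-cong (allFin n) (λ z → ℚₚ.*-identityʳ (𝟙 (inc? S z u))) ⟩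
          sumL (allFin n) (λ z → 𝟙 (inc? S z u))                ≡⟨ degree-inc a u ⟩
          fromℕ (degree S u)                                    ∎)
      ; same-tree = λ R h {z} {q} e → tree R h (z Fin.≟ v) (z Fin.≟ y) e }
      where
      open ≡-Reasoning
      tree : ∀ (R : Fin n → Fin n) → (∀ {z q} → S z ≡ just q → R z ≡ R q) → ∀ {z q} → Dec (z ≡ v) → Dec (z ≡ y) → turned z ≡ just q → R z ≡ R q
      tree R h (yes refl) _ e with () ← just≢nothing e turned-v
      tree R h (no _) (yes refl) e with refl ← just-injective (trans (sym e) turned-y) = sym (h vy)
      tree R h (no z≢v) (no z≢y) e = h (trans (sym (turned-off z≢v z≢y)) e)

  record Rerooted {S : Str n} (a : Acyclic S) (v : Fin n) : Set where
    field
      S′ : Str n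
      rebase : Rebase S S′
    open Rebase rebase public
    field
      new-root : S′ v ≡ nothing
      computes : ∀ f x → depth a v ≤ f → reroot′ f (st S x) v nothing ≗ st S′ (σ x)
      -- After rerooting at the parent of a vertex, this shows that the vertex is still attached
      -- there with its old colour, as the next turn requires.
      deeper : ∀ {z} → depth a v < depth a z → S′ z ≡ S z
      deeper-color : ∀ {z} x → depth a v < depth a z → lookup (σ x) z ≡ lookup x z

  rerooted : ∀ {S} (a : Acyclic S) v → Rerooted a v
  rerooted {S} a = parent-ind a (Rerooted a) (λ v ih → build v ih (S v) refl)
    where
    build : ∀ v → (∀ y → S v ≡ just y → Rerooted a y) → ∀ m → S v ≡ m → Rerooted a v
    build v ih nothing e = record
      { S′ = S ; rebase = rebase-id a ; new-root = e
      ; computes = λ f x _ → at-root f x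
      ; deeper = λ _ → refl ; deeper-color = λ _ _ → refl }
      where
      unset : ∀ x → set (st S x) v nothing ≗ st S x
      unset x z with z Fin.≟ v
      ... | yes refl = sym (st-nothing S x e)
      ... | no _ = refl
      at-root : ∀ f x → reroot′ f (st S x) v nothing ≗ st S x
      at-root zero x = unset x
      at-root (suc f) x with st S x v | st-nothing S x e
      ... | _ | refl = unset x
    build v ih (just y) e = record
      { S′ = turned ; rebase = rebase-trans R.rebase rebase-turn ; new-root = turned-v
      ; computes = computes
      ; deeper = λ l → trans (turned-off (≢v l) (≢y l)) (R.deeper (ℕₚ.<-trans y<v l))
      ; deeper-color = λ {z} x l → trans (lookup-turn (R.σ x) z) (trans (cong (lookup (R.σ x)) (tr-other (≢v l) (≢y l))) (R.deeper-color x (ℕₚ.<-trans y<v l))) }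
      where
      module R = Rerooted (ih y e)
      y<v : depth a y < depth a v
      y<v = depth-< a e
      ≢v : ∀ {z} → depth a v < depth a z → z ≢ v
      ≢v l refl = ℕₚ.<-irrefl refl l
      ≢y : ∀ {z} → depth a v < depth a z → z ≢ y
      ≢y l refl = ℕₚ.<-asym l y<v
      open TurnEdge R.acyclic′ {v} {y} (trans (R.deeper y<v) e) R.new-root
      computes : ∀ f x → depth a v ≤ f → reroot′ f (st S x) v nothing ≗ st turned (turn (R.σ x))
      computes zero x l = contradiction (ℕₚ.<-≤-trans y<v l) λ ()
      computes (suc f) x l z = begin
        reroot′ (suc f) (st S x) v nothing z
          ≡⟨ reroot′-parent (depth a) f (st S x) v (λ _ h → depth-< a (st-just⁻ S x h)) (st-just S x e) z ⟩
        set (set (reroot′ f (st S x) y nothing) y (just (v , lookup x v))) v nothing z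
          ≡⟨ set-cong (set-cong (R.computes f x (ℕₚ.≤-pred (ℕₚ.<-≤-trans y<v l))) y (just (v , lookup x v))) v nothing z ⟩
        set (set (st R.S′ (R.σ x)) y (just (v , lookup x v))) v nothing z
          ≡⟨ final ⟩
        st turned (turn (R.σ x)) z ∎
        where
        open ≡-Reasoning
        final : set (set (st R.S′ (R.σ x)) y (just (v , lookup x v))) v nothing z ≡ st turned (turn (R.σ x)) z
        final with z Fin.≟ v
        ... | yes refl = sym (st-nothing turned (turn (R.σ x)) turned-v)
        ... | no z≢v with z Fin.≟ y
        ...   | yes refl = sym (trans (st-just turned (turn (R.σ x)) turned-y) (cong (λ c → just (v , c))
                  (trans (lookup-turn (R.σ x) y) (trans (cong (lookup (R.σ x)) (tr-right v y)) (R.deeper-color x y<v)))))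
        ...   | no z≢y = sym (trans (cong (Maybe.map _) (turned-off z≢v z≢y))
                  (cong (λ c → Maybe.map (λ q → q , c) (R.S′ z)) (trans (lookup-turn (R.σ x) z) (cong (lookup (R.σ x)) (tr-other z≢v z≢y)))))

module _ {n κ : ℕ} (S : Str n) (x y : Vec (Fin κ) n) where

  rootOf′-shape : ∀ f v → rootOf′ f (st S x) v ≡ rootOf′ f (st S y) v
  rootOf′-shape zero v = refl
  rootOf′-shape (suc f) v with S v
  ... | nothing = refl
  ... | just q = rootOf′-shape f q

  mutual
    treeEdges-shape : ∀ v → treeEdges (st S x) v ≡ treeEdges (st S y) v
    treeEdges-shape v = cong length (filterᵇ-cong (inTree-shape v) (allFin n))

    inTree-shape : ∀ v w → _ ≡ _
    inTree-shape v w with S w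
    ... | nothing = refl
    ... | just _ = cong₂ _==_ (rootOf′-shape n w) (rootOf′-shape n v)

-- The unrooted version

module Unrooted (Δ c n : ℕ) (3≤Δ : 3 ≤ Δ) where
  open Process Δ c n 3≤Δ (unrootedStep Δ) (UnrootedValid Δ)

  -- σ is a bijection between the proper vectors of the two shapes, so numbers and averages agree,
  -- and recourse depends only on colours of pairs of vertices. With the identity rebase it replaces
  -- a step by the branch that the step takes.
  rebase-result : ∀ {S S₁} {F F₁ : State n κ → Dist (State n κ)} (R : Rebase (unrootedStep Δ) (UnrootedValid Δ) S S₁) →
    (∀ x → F (st S x) ≈ᵈ F₁ (st S₁ (Rebase.σ R x))) → StepResult F₁ S₁ → StepResult F S
  rebase-result {S} {S₁} {F} {F₁} R F≈ T = record
    { S′ = T.S′ ; acyclic′ = T.acyclic′ ; degree′ = T.degree′ ; K = T.K ; 0≤K = T.0≤K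
    ; count-K = trans count-eq T.count-K
    ; measure = λ {g} ext → trans (average-eq (λ s → E (F s) g) (λ s → E (F₁ s) g) (λ x → E-cong (F≈ x) (λ {s} {s′} → ext {s} {s′}))) (T.measure ext)
    ; recourse≤ = ℚₚ.≤-trans (ℚₚ.≤-reflexive (average-eq (λ s → E (F s) (rec s)) (λ s → E (F₁ s) (rec s))
          (λ x → E-cong (F≈ x) (λ {t} {t′} h → cong fromℕ (recourse-colorOf (unrootedStep Δ) (UnrootedValid Δ) {st S x} {st S₁ (R.σ x)} {t} {t′}
            (R.same-color x) (colorOf-cong (unrootedStep Δ) (UnrootedValid Δ) h))))))
        (ℚₚ.≤-trans T.recourse≤ (ℚₚ.≤-reflexive (cong (bound Δ c n ⊛_) (sym count-eq))))
    ; support = λ x pr → let (y , s , q , py , s≗ , m) = T.support (R.σ x) (R.σ-proper x pr)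
                             (s′ , e , m′) = ≈ᵈ-∈ (F≈ x) m
                         in y , s′ , q , py , (λ z → trans (e z) (s≗ z)) , m′ }
    where
    module R = Rebase R
    module T = StepResult T
    average-eq : ∀ (f f₁ : State n κ → ℚ) → (∀ x → f (st S x) ≡ f₁ (st S₁ (R.σ x))) → average S f ≡ average S₁ f₁
    average-eq f f₁ h = trans
      (reindex V V (proper? S) (proper? S₁) R.σ R.σ⁻¹
        (λ x pr → R.σ-proper x pr , R.σ-inverse x) (λ x pr → R.σ⁻¹-proper x pr , R.σ⁻¹-inverse x) (λ x → f (st S x)))
      (sumL-cong (enum V) (λ x → cong (𝟙 (proper? S₁ x) ⊛_) (trans (h (R.σ⁻¹ x)) (cong (λ v → f₁ (st S₁ v)) (R.σ⁻¹-inverse x)))))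
    count-eq : count S ≡ count S₁
    count-eq = trans (sumL-cong (enum V) (λ x → sym (ℚₚ.*-identityʳ (𝟙 (proper? S x)))))
      (trans (average-eq (λ _ → 1ℚ) (λ _ → 1ℚ) (λ _ → refl)) (sumL-cong (enum V) (λ x → ℚₚ.*-identityʳ (𝟙 (proper? S₁ x)))))

  reroot-insert : ∀ {S} → Acyclic S → (∀ u → degree S u ≤ Δ) → ∀ (x : Vec (Fin κ) n) u v → rootOf (st S x) u ≢ rootOf (st S x) v →
    degree S u < Δ → degree S v < Δ → StepResult (λ s → rootedInsert (reroot s v) u v) S
  reroot-insert {S} a deg≤ x u v ne du dv = rebase-result R.rebase
    (λ x → rootedInsert-cong (R.computes n x (ℕₚ.<⇒≤ (depth<n a v))) u v)
    (insert-result L du′ dv′ (degree-insert L du′ dv′ (λ w → subst (_≤ Δ) (sym (R.same-degree w)) (deg≤ w))))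
    where
    module R = Rerooted (rerooted (unrootedStep Δ) (UnrootedValid Δ) a v)
    ¬below : ¬ Reach R.S′ (λ _ → ⊤) v u
    ¬below b = ne (go b)
      where
      go : ∀ {z} → Reach R.S′ (λ _ → ⊤) v z → rootOf (st S x) z ≡ rootOf (st S x) v
      go here = refl
      go (there e _ b) = trans (R.same-tree (rootOf (st S x)) (rootOf-edge a x) e) (go b)
    L : Link R.S′ (setS R.S′ v (just u)) u v
    L = insert-link R.acyclic′ R.new-root ¬below
    du′ : degree R.S′ u < Δ
    du′ = subst (_< Δ) (sym (R.same-degree u)) du
    dv′ : degree R.S′ v < Δ
    dv′ = subst (_< Δ) (sym (R.same-degree v)) dv

  delete-edge : ∀ {S} → Acyclic S → (∀ u → degree S u ≤ Δ) → ∀ {p r} → S r ≡ just p → StepResult (λ s → deletion s p r) S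
  delete-edge {S} a deg≤ {p} {r} e = delete-result L
    (subst (_≤ Δ) (degree-end L (inj₂ refl)) (deg≤ p)) (subst (_≤ Δ) (degree-end L (inj₁ refl)) (deg≤ r)) deg≤
    where
    L : Link (setS S r nothing) S p r
    L = cut-link a e

  private
    newRoot : State n κ → Fin n → Fin n → Bool
    newRoot s a b = if (treeEdges s a ≤ᵇ Δ) ∧ (treeEdges s b ≤ᵇ Δ) then deg s b ≤ᵇ deg s a else (treeEdges s b ≤ᵇ treeEdges s a)

    -- Tree sizes and degrees depend on the shape only. All colourings in an average therefore
    -- reroot the same tree, and a single rebase covers them.
    newRoot-shape : ∀ S x y a b → newRoot (st S x) a b ≡ newRoot (st S y) a b
    newRoot-shape S x y a b rewrite treeEdges-shape S x y a | treeEdges-shape S x y b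
      | deg-st S x a | deg-st S x b | deg-st S y a | deg-st S y b = refl

    ≡⇒≈ᵈ : {d e : Dist (State n κ)} → d ≡ e → d ≈ᵈ e
    ≡⇒≈ᵈ refl = ≈ᵈ-refl

    insert-branch : ∀ s a b {t} → newRoot s a b ≡ t →
      unrootedStep Δ s (ins a b) ≡ (if t then rootedInsert (reroot s b) a b else rootedInsert (reroot s a) b a)
    insert-branch s a b h = cong (if_then rootedInsert (reroot s b) a b else rootedInsert (reroot s a) b a) h

  result : ∀ {S} → Acyclic S → (∀ u → degree S u ≤ Δ) → ∀ x → Proper S x → ∀ u → UnrootedValid Δ (st S x) u →
    StepResult (λ s → unrootedStep Δ s u) S
  result {S} a deg≤ x pr (ins u v) (ne , du , dv) with newRoot (st S x) u v in eq
  ... | true = rebase-result (rebase-id (unrootedStep Δ) (UnrootedValid Δ) a)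
        (λ y → ≡⇒≈ᵈ (insert-branch (st S y) u v (trans (newRoot-shape S y x u v) eq)))
        (reroot-insert a deg≤ x u v ne (subst (_< Δ) (deg-st S x u) du) (subst (_< Δ) (deg-st S x v) dv))
  ... | false = rebase-result (rebase-id (unrootedStep Δ) (UnrootedValid Δ) a)
        (λ y → ≡⇒≈ᵈ (insert-branch (st S y) u v (trans (newRoot-shape S y x u v) eq)))
        (reroot-insert a deg≤ x v u (≢-sym ne) (subst (_< Δ) (deg-st S x v) dv) (subst (_< Δ) (deg-st S x u) du))
  result {S} a deg≤ x pr (del u v) valid with child? S u v in c | valid
  ... | yes e | _ = rebase-result (rebase-id (unrootedStep Δ) (UnrootedValid Δ) a)
        (λ y → ≡⇒≈ᵈ (cong (if_then deletion (st S y) u v else (if isChildOf (st S y) v u then deletion (st S y) v u else return (st S y))) (trans (isChildOf-st S y u v) (cong does c))))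
        (delete-edge a deg≤ e)
  ... | no ¬e | inj₁ h = contradiction (trans (sym (parentOf-st S x v)) h) ¬e
  ... | no ¬e | inj₂ h = rebase-result (rebase-id (unrootedStep Δ) (UnrootedValid Δ) a)
        (λ y → ≡⇒≈ᵈ (trans (cong (if_then deletion (st S y) u v else (if isChildOf (st S y) v u then deletion (st S y) v u else return (st S y))) (trans (isChildOf-st S y u v) (cong does c)))
          (cong (if_then deletion (st S y) v u else return (st S y)) (trans (isChildOf-st S y v u) (dec-true (child? S v u) e)))))
        (delete-edge a deg≤ e)
    where
    e : S u ≡ just v
    e = trans (sym (parentOf-st S x u)) h

  open Run (unrootedStep-cong Δ) (unrootedValid-cong Δ) result public using (expected-recourse)

theorem4p15 : (Δ c n : ℕ) → 3 ≤ Δ → c ≤ Δ ∸ 2 →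
    ((us : List (Upd n)) →
    ValidSeq (rootedStep {n} {Δ + c} Δ) (RootedValid Δ) emptyForest us →
    (t : ℕ) → t < length us →
    expRecourse (rootedStep {n} {Δ + c} Δ) (RootedValid Δ) emptyForest us t
    Data.Rational.≤ bound Δ c n)
    ×
    ((us : List (Upd n)) →
    ValidSeq (unrootedStep {n} {Δ + c} Δ) (UnrootedValid Δ) emptyForest us →
    (t : ℕ) → t < length us →
    expRecourse (unrootedStep {n} {Δ + c} Δ) (UnrootedValid Δ) emptyForest us t
    Data.Rational.≤ bound Δ c n)
theorem4p15 Δ c n 3≤Δ _ = Rooted.expected-recourse Δ c n 3≤Δ , Unrooted.expected-recourse Δ c n 3≤Δ
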